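{- Let $d\ge 1$ and let $\mathcal{B}_d^+$ be the set of all boxes $\prod_{i=1}^d[a_i,b_i]\subseteq\mathbb{R}^d$ with $a_i\le b_i$ nonnegative integers. The $\mathbb{C}$-algebra homomorphism $\phi:\mathbb{C}[x_1,\dots,x_d,y_1,\dots,y_d]\to M(\mathcal{B}_d^+)$ given by $\phi(x_i)=[\{\tilde e_i\}]$ and $\phi(y_i)=[\pi_i([0,1]^d)]$ is surjective with kernel $\ker(\phi)=((y_1-1)(y_1-x_1),\dots,(y_d-1)(y_d-x_d))$, and so $$M(\mathcal{B}_d^+)\cong \mathbb{C}[x_1,\dots,x_d,y_1,\dots,y_d]/((y_1-1)(y_1-x_1),\dots,(y_d-1)(y_d-x_d)).$$ In particular $M(\mathcal{B}_d^+)\cong\bigotimes_{i=1}^d M(\mathcal{B}_1^+)=\bigotimes_{i=1}^d M(\{1\},[0,1])$, where the tensor product is taken over $\mathbb{C}$.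
   Context: For $S\subseteq W=\mathbb{R}^d$, $[S]:W\to\mathbb{C}$ denotes its indicator function. Let $M(\mathcal{P}(W))$ be the complex vector space of functions on $W$ spanned by the indicator functions of closed convex polyhedra; it is a commutative $\mathbb{C}$-algebra with the well-defined bilinear product determined by $[A]\cdot[B]=[A+B]$ (Minkowski sum) for nonempty closed convex polyhedra $A,B$, with unit $[\{0\}]$. For a set $\mathcal{D}$ of closed convex polyhedra, the Minkowski ring $M(\mathcal{D})$ is the unital $\mathbb{C}$-subalgebra generated by all $[P]$, $P\in\mathcal{D}$; $M(P_1,\dots,P_n)=M(\{P_1,\dots,P_n\})$. $\tilde e_i$ is the $i$-th standard basis vector of $\mathbb{R}^d$ and $\pi_i:\mathbb{R}^d\to\mathbb{R}^d$ is $\tilde x\mapsto x_i\tilde e_i$. -}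

module Defs where

open import Algebra.Bundles using (CommutativeMonoid; CommutativeRing)
open import Algebra.Definitions.RawMonoid using () renaming (sum to ∑)
open import Algebra.Morphism.Structures using (IsRingHomomorphism; IsRingIsomorphism)
import Algebra.Properties.CommutativeSemigroup as CommutativeSemigroupProperties
import Algebra.Properties.Ring as RingProperties
import Algebra.Properties.Semiring.Mult as SemiringMult
import Algebra.Solver.Ring as RingSolver
open import Algebra.Solver.Ring.AlmostCommutativeRing using (fromCommutativeRing; _-Raw-AlmostCommutative⟶_)
open import Data.Bool.Base using (if_then_else_)
open import Data.Fin.Base as Fin using (Fin; zero; suc)
import Data.Fin.Properties as Fin
open import Data.Integer.Base as ℤ using (ℤ; +_; -[1+_])
import Data.Integer.Properties as ℤ
open import Data.List.Base using (List; []; _∷_; _++_; map; concatMap; allFin)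
open import Data.List.Membership.Propositional using (_∈_; find; lose)
open import Data.List.Membership.Propositional.Properties using (∈-++⁺ˡ; ∈-++⁺ʳ; ∈-allFin)
import Data.List.Properties as List
open import Data.List.Relation.Binary.Permutation.Propositional using (↭-sym)
open import Data.List.Relation.Binary.Permutation.Propositional.Properties using (∈-resp-↭)
open import Data.List.Relation.Unary.All as All using (All; []; _∷_)
import Data.List.Relation.Unary.All.Properties as All
open import Data.List.Relation.Unary.AllPairs using (AllPairs; []; _∷_)
open import Data.List.Relation.Unary.Any using (Any; here; there)
open import Data.List.Relation.Unary.Linked.Properties using (Linked⇒AllPairs)
import Data.List.Sort as Sort
open import Data.Maybe.Base using (Maybe; just; nothing)
open import Data.Nat.Base as ℕ using (ℕ; zero; suc)
import Data.Nat.Properties as ℕ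
open import Data.Product.Base using (_×_; _,_; proj₁; proj₂; ∃; ∃₂)
open import Data.Sum.Base using (_⊎_; inj₁; inj₂)
open import Data.Vec.Base as Vec using (Vec; []; _∷_)
open import Data.Vec.Functional as Vector using (Vector)
import Data.Vec.Properties as Vec
open import Function.Base using (_∘_)
open import Function.Bundles using (_⇔_; mk⇔; Equivalence)
open import Level using (0ℓ; _⊔_) renaming (suc to lsuc)
open import Relation.Binary.Bundles using (DecTotalOrder)
open import Relation.Binary.Core using (Rel)
open import Relation.Binary.PropositionalEquality as ≡ using (_≡_; _≢_)
import Relation.Binary.Reasoning.Setoid as SetoidReasoning
open import Relation.Binary.Structures using (IsEquivalence; IsDecTotalOrder)
open import Relation.Nullary using (¬_; Dec; yes; no; does; contradiction)
open import Relation.Nullary.Decidable using (map′)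
open import Relation.Unary using (Pred; _≐_)

-- The ring solver with integer coefficients, for an arbitrary commutative ring.
module IntegerCoefficients {c ℓ} (R : CommutativeRing c ℓ) where
  open CommutativeRing R
  open RingProperties ring
  open SemiringMult semiring using (×-homo-+; ×1-homo-*) renaming (_×_ to _·_)
  open SetoidReasoning setoid

  ⟦_⟧ : ℤ → Carrier
  ⟦ + n ⟧      = n · 1#
  ⟦ -[1+ n ] ⟧ = - (suc n · 1#)

  neg-homo : ∀ i → ⟦ ℤ.- i ⟧ ≈ - ⟦ i ⟧
  neg-homo (+ zero)   = sym -0#≈0#
  neg-homo (+ suc n)  = refl
  neg-homo -[1+ n ]   = sym (-‿involutive _)

  ⊖-homo : ∀ m n → ⟦ m ℤ.⊖ n ⟧ ≈ m · 1# - n · 1#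
  ⊖-homo m zero = sym (trans (+-congˡ -0#≈0#) (+-identityʳ _))
  ⊖-homo zero (suc n) = sym (+-identityˡ _)
  ⊖-homo (suc m) (suc n) = begin
    ⟦ suc m ℤ.⊖ suc n ⟧                     ≡⟨ ≡.cong ⟦_⟧ (ℤ.[1+m]⊖[1+n]≡m⊖n m n) ⟩
    ⟦ m ℤ.⊖ n ⟧                             ≈⟨ ⊖-homo m n ⟩
    m · 1# - n · 1#                         ≈⟨ +-congʳ (+-identityˡ _) ⟨
    (0# + m · 1#) - n · 1#                  ≈⟨ +-congʳ (+-congʳ (-‿inverseʳ 1#)) ⟨
    ((1# - 1#) + m · 1#) - n · 1#           ≈⟨ +-congʳ (trans (+-assoc _ _ _) (trans (+-congˡ (+-comm _ _)) (sym (+-assoc _ _ _)))) ⟩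
    ((1# + m · 1#) - 1#) - n · 1#           ≈⟨ +-assoc _ _ _ ⟩
    (1# + m · 1#) + (- 1# - n · 1#)         ≈⟨ +-congˡ (-‿+-comm _ _) ⟩
    (1# + m · 1#) - (1# + n · 1#)           ∎

  +-homo : ∀ i j → ⟦ i ℤ.+ j ⟧ ≈ ⟦ i ⟧ + ⟦ j ⟧
  +-homo (+ m)    (+ n)    = ×-homo-+ 1# m n
  +-homo (+ m)    -[1+ n ] = ⊖-homo m (suc n)
  +-homo -[1+ m ] (+ n)    = trans (⊖-homo n (suc m)) (+-comm _ _)
  +-homo -[1+ m ] -[1+ n ] = begin
    - (suc (suc (m ℕ.+ n)) · 1#)        ≡⟨ ≡.cong (λ k → - (k · 1#)) (≡.cong suc (≡.sym (ℕ.+-suc m n))) ⟩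
    - ((suc m ℕ.+ suc n) · 1#)          ≈⟨ -‿cong (×-homo-+ 1# (suc m) (suc n)) ⟩
    - (suc m · 1# + suc n · 1#)         ≈⟨ -‿+-comm _ _ ⟨
    - (suc m · 1#) - (suc n · 1#)       ∎

  pos*pos : ∀ m n → ⟦ + m ℤ.* + n ⟧ ≈ ⟦ + m ⟧ * ⟦ + n ⟧
  pos*pos m n = trans (reflexive (≡.cong ⟦_⟧ (≡.sym (ℤ.pos-* m n)))) (×1-homo-* m n)

  *-homo : ∀ i j → ⟦ i ℤ.* j ⟧ ≈ ⟦ i ⟧ * ⟦ j ⟧
  *-homo (+ m)    (+ n)    = pos*pos m n
  *-homo (+ m)    -[1+ n ] = begin
    ⟦ + m ℤ.* -[1+ n ] ⟧           ≡⟨ ≡.cong ⟦_⟧ (≡.sym (ℤ.neg-distribʳ-* (+ m) (+ suc n))) ⟩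
    ⟦ ℤ.- (+ m ℤ.* + suc n) ⟧      ≈⟨ neg-homo (+ m ℤ.* + suc n) ⟩
    - ⟦ + m ℤ.* + suc n ⟧          ≈⟨ -‿cong (pos*pos m (suc n)) ⟩
    - (⟦ + m ⟧ * ⟦ + suc n ⟧)      ≈⟨ -‿distribʳ-* _ _ ⟩
    ⟦ + m ⟧ * - ⟦ + suc n ⟧        ∎
  *-homo -[1+ m ] (+ n)    = begin
    ⟦ -[1+ m ] ℤ.* + n ⟧           ≡⟨ ≡.cong ⟦_⟧ (≡.sym (ℤ.neg-distribˡ-* (+ suc m) (+ n))) ⟩
    ⟦ ℤ.- (+ suc m ℤ.* + n) ⟧      ≈⟨ neg-homo (+ suc m ℤ.* + n) ⟩
    - ⟦ + suc m ℤ.* + n ⟧          ≈⟨ -‿cong (pos*pos (suc m) n) ⟩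
    - (⟦ + suc m ⟧ * ⟦ + n ⟧)      ≈⟨ -‿distribˡ-* _ _ ⟩
    - ⟦ + suc m ⟧ * ⟦ + n ⟧        ∎
  *-homo -[1+ m ] -[1+ n ] = begin
    (suc m ℕ.* suc n) · 1#                 ≈⟨ ×1-homo-* (suc m) (suc n) ⟩
    (suc m · 1#) * (suc n · 1#)            ≈⟨ -‿involutive _ ⟨
    - - ((suc m · 1#) * (suc n · 1#))      ≈⟨ -‿cong (-‿distribʳ-* _ _) ⟩
    - ((suc m · 1#) * - (suc n · 1#))      ≈⟨ -‿distribˡ-* _ _ ⟩
    - (suc m · 1#) * - (suc n · 1#)        ∎

  morphism : ℤ.+-*-rawRing -Raw-AlmostCommutative⟶ fromCommutativeRing R
  morphism = record
    { ⟦_⟧ = ⟦_⟧ ; +-homo = +-homo ; *-homo = *-homo ; -‿homo = neg-homo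
    ; 0-homo = refl ; 1-homo = +-identityʳ 1# }

  coefficient≟ : (i j : ℤ) → Maybe (⟦ i ⟧ ≈ ⟦ j ⟧)
  coefficient≟ i j with i ℤ.≟ j
  ... | yes i≡j = just (reflexive (≡.cong ⟦_⟧ i≡j))
  ... | no  _   = nothing

module Solver {c ℓ} (R : CommutativeRing c ℓ) where
  open IntegerCoefficients R
  open RingSolver ℤ.+-*-rawRing (fromCommutativeRing R) morphism coefficient≟ public
    using (solve; _:=_; _:+_; _:*_; _:-_; :-_; con)

record Algebra (K : CommutativeRing 0ℓ 0ℓ) a ℓ : Set (lsuc (a ⊔ ℓ)) where
  private module K = CommutativeRing K
  field
    commutativeRing : CommutativeRing a ℓ
  open CommutativeRing commutativeRing public
  field
    ι      : K.Carrier → Carrier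
    ι-homo : IsRingHomomorphism K.rawRing rawRing ι
  open IsRingHomomorphism ι-homo public using () renaming
    (⟦⟧-cong to ι-cong; +-homo to ι-+; *-homo to ι-*; 0#-homo to ι-0#; 1#-homo to ι-1#; -‿homo to ι-neg)

infix 4 _≅_

record AlgebraHom {K a₁ ℓ₁ a₂ ℓ₂} (A : Algebra K a₁ ℓ₁) (B : Algebra K a₂ ℓ₂)
                  : Set (a₁ ⊔ ℓ₁ ⊔ a₂ ⊔ ℓ₂) where
  private
    module K = CommutativeRing K
    module A = Algebra A
    module B = Algebra B
  field
    ⟦_⟧                : A.Carrier → B.Carrier
    isRingHomomorphism : IsRingHomomorphism A.rawRing B.rawRing ⟦_⟧
    ι-compatible       : ∀ k → ⟦ A.ι k ⟧ B.≈ B.ι k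

record _≅_ {K a₁ ℓ₁ a₂ ℓ₂} (A : Algebra K a₁ ℓ₁) (B : Algebra K a₂ ℓ₂)
           : Set (a₁ ⊔ ℓ₁ ⊔ a₂ ⊔ ℓ₂) where
  private
    module A = Algebra A
    module B = Algebra B
  field
    hom : AlgebraHom A B
  open AlgebraHom hom public
  field
    isRingIsomorphism : IsRingIsomorphism A.rawRing B.rawRing ⟦_⟧

module _ {K : CommutativeRing 0ℓ 0ℓ} {a ℓ} (A : Algebra K a ℓ) where
  open Algebra A hiding (zero)
  open RingProperties ring using (-1*x≈-x)
  open Solver commutativeRing using (solve; _:=_; _:+_; _:*_; _:-_; :-_)

  module _ {p} (G : Pred Carrier p) where

    data Generated : Pred Carrier (a ⊔ ℓ ⊔ p) where
      gen      : ∀ {x} → G x → Generated x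
      scal     : ∀ k → Generated (ι k)
      add      : ∀ {x y} → Generated x → Generated y → Generated (x + y)
      mul      : ∀ {x y} → Generated x → Generated y → Generated (x * y)
      resp     : ∀ {x y} → x ≈ y → Generated x → Generated y

    negation : ∀ {x} → Generated x → Generated (- x)
    negation {x} gx = resp (trans (*-congʳ (trans (ι-neg 1ᴷ) (-‿cong ι-1#))) (-1*x≈-x x))
                           (mul (scal (-ᴷ 1ᴷ)) gx)
      where open CommutativeRing K using () renaming (1# to 1ᴷ; -_ to -ᴷ_)

    subalgebra : Algebra K (a ⊔ ℓ ⊔ p) ℓ
    subalgebra = record
      { commutativeRing = record
        { Carrier = ∃ Generated
        ; _≈_ = λ x y → proj₁ x ≈ proj₁ y
        ; _+_ = λ (x , gx) (y , gy) → x + y , add gx gy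
        ; _*_ = λ (x , gx) (y , gy) → x * y , mul gx gy
        ; -_  = λ (x , gx) → - x , negation gx
        ; 0#  = 0# , resp ι-0# (scal _)
        ; 1#  = 1# , resp ι-1# (scal _)
        ; isCommutativeRing = record
          { isRing = record
            { +-isAbelianGroup = record
              { isGroup = record
                { isMonoid = record
                  { isSemigroup = record
                    { isMagma = record
                      { isEquivalence = record { refl = refl ; sym = sym ; trans = trans }
                      ; ∙-cong = +-cong }
                    ; assoc = λ _ _ _ → +-assoc _ _ _ }
                  ; identity = (λ _ → +-identityˡ _) , (λ _ → +-identityʳ _) }
                ; inverse = (λ _ → -‿inverseˡ _) , (λ _ → -‿inverseʳ _)
                ; ⁻¹-cong = -‿cong }
              ; comm = λ _ _ → +-comm _ _ }
            ; *-cong = *-cong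
            ; *-assoc = λ _ _ _ → *-assoc _ _ _
            ; *-identity = (λ _ → *-identityˡ _) , (λ _ → *-identityʳ _)
            ; distrib = (λ _ _ _ → distribˡ _ _ _) , (λ _ _ _ → distribʳ _ _ _) }
          ; *-comm = λ _ _ → *-comm _ _ } }
      ; ι = λ k → ι k , scal k
      ; ι-homo = record
        { isSemiringHomomorphism = record
          { isNearSemiringHomomorphism = record
            { +-isMonoidHomomorphism = record
              { isMagmaHomomorphism = record
                { isRelHomomorphism = record { cong = ι-cong } ; homo = ι-+ }
              ; ε-homo = ι-0# }
            ; *-homo = ι-* }
          ; 1#-homo = ι-1# }
        ; -‿homo = ι-neg } }

  module _ {n} (g : Fin n → Carrier) where

    data Ideal : Pred Carrier (a ⊔ ℓ) where
      gen      : ∀ i → Ideal (g i)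
      null     : Ideal 0#
      add      : ∀ {x y} → Ideal x → Ideal y → Ideal (x + y)
      mul      : ∀ x {y} → Ideal y → Ideal (x * y)
      resp     : ∀ {x y} → x ≈ y → Ideal x → Ideal y

    private
      infix 4 _~_
      _~_ : Rel Carrier (a ⊔ ℓ)
      x ~ y = Ideal (x - y)

      ≈⇒~ : ∀ {x y} → x ≈ y → x ~ y
      ≈⇒~ {x} {y} x≈y = resp (sym (trans (+-congʳ x≈y) (-‿inverseʳ y))) null

      ~-neg : ∀ {x y} → x ~ y → - x ~ - y
      ~-neg {x} {y} p = resp (trans (-1*x≈-x _) (solve 2 (λ x y → :- (x :- y) := :- x :- :- y) refl x y))
                             (mul (- 1#) p)

      ~-sym : ∀ {x y} → x ~ y → y ~ x
      ~-sym {x} {y} p = resp (trans (-1*x≈-x _) (solve 2 (λ x y → :- (x :- y) := y :- x) refl x y))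
                             (mul (- 1#) p)

      ~-trans : ∀ {x y z} → x ~ y → y ~ z → x ~ z
      ~-trans {x} {y} {z} p q =
        resp (solve 3 (λ x y z → (x :- y) :+ (y :- z) := x :- z) refl x y z) (add p q)

      ~-+ : ∀ {x x′ y y′} → x ~ x′ → y ~ y′ → x + y ~ x′ + y′
      ~-+ {x} {x′} {y} {y′} p q =
        resp (solve 4 (λ x x′ y y′ → (x :- x′) :+ (y :- y′) := (x :+ y) :- (x′ :+ y′)) refl x x′ y y′) (add p q)

      ~-* : ∀ {x x′ y y′} → x ~ x′ → y ~ y′ → x * y ~ x′ * y′
      ~-* {x} {x′} {y} {y′} p q =
        resp (solve 4 (λ x x′ y y′ → y :* (x :- x′) :+ x′ :* (y :- y′) := x :* y :- x′ :* y′) refl x x′ y y′)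
             (add (mul y p) (mul x′ q))

    quotient : Algebra K a (a ⊔ ℓ)
    quotient = record
      { commutativeRing = record
        { Carrier = Carrier
        ; _≈_ = λ x y → Ideal (x - y)
        ; _+_ = _+_
        ; _*_ = _*_
        ; -_  = -_
        ; 0#  = 0#
        ; 1#  = 1#
        ; isCommutativeRing = record
          { isRing = record
            { +-isAbelianGroup = record
              { isGroup = record
                { isMonoid = record
                  { isSemigroup = record
                    { isMagma = record
                      { isEquivalence = record { refl = ≈⇒~ refl ; sym = ~-sym ; trans = ~-trans }
                      ; ∙-cong = ~-+ }
                    ; assoc = λ x y z → ≈⇒~ (+-assoc x y z) }
                  ; identity = (λ x → ≈⇒~ (+-identityˡ x)) , (λ x → ≈⇒~ (+-identityʳ x)) }
                ; inverse = (λ x → ≈⇒~ (-‿inverseˡ x)) , (λ x → ≈⇒~ (-‿inverseʳ x))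
                ; ⁻¹-cong = ~-neg }
              ; comm = λ x y → ≈⇒~ (+-comm x y) }
            ; *-cong = ~-*
            ; *-assoc = λ x y z → ≈⇒~ (*-assoc x y z)
            ; *-identity = (λ x → ≈⇒~ (*-identityˡ x)) , (λ x → ≈⇒~ (*-identityʳ x))
            ; distrib = (λ x y z → ≈⇒~ (distribˡ x y z)) , (λ x y z → ≈⇒~ (distribʳ x y z)) }
          ; *-comm = λ x y → ≈⇒~ (*-comm x y) } }
      ; ι = ι
      ; ι-homo = record
        { isSemiringHomomorphism = record
          { isNearSemiringHomomorphism = record
            { +-isMonoidHomomorphism = record
              { isMagmaHomomorphism = record
                { isRelHomomorphism = record { cong = ≈⇒~ ∘ ι-cong } ; homo = λ x y → ≈⇒~ (ι-+ x y) }
              ; ε-homo = ≈⇒~ ι-0# }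
            ; *-homo = λ x y → ≈⇒~ (ι-* x y) }
          ; 1#-homo = ≈⇒~ ι-1# }
        ; -‿homo = λ x → ≈⇒~ (ι-neg x) } }

module Evaluation (K : CommutativeRing 0ℓ 0ℓ) where
  open CommutativeRing K renaming (Carrier to 𝕜) hiding (zero)
  open Solver K using (solve; _:=_; _:+_; _:*_; _:-_)

  evaluate : ∀ {x} {X : Set x} → (X → 𝕜) → List (𝕜 × X) → 𝕜
  evaluate h []            = 0#
  evaluate h ((c , x) ∷ f) = c * h x + evaluate h f

  module _ {x} {X : Set x} where

    evaluate-++ : ∀ (h : X → 𝕜) f g → evaluate h (f ++ g) ≈ evaluate h f + evaluate h g
    evaluate-++ h []            g = sym (+-identityˡ _)
    evaluate-++ h ((c , x) ∷ f) g = trans (+-congˡ (evaluate-++ h f g)) (sym (+-assoc _ _ _))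

    evaluate-cong : ∀ {h k : X → 𝕜} → (∀ x → h x ≈ k x) → ∀ f → evaluate h f ≈ evaluate k f
    evaluate-cong h≈k []            = refl
    evaluate-cong h≈k ((c , x) ∷ f) = +-cong (*-congˡ (h≈k x)) (evaluate-cong h≈k f)

    evaluate-+ : ∀ (h k : X → 𝕜) f → evaluate (λ x → h x + k x) f ≈ evaluate h f + evaluate k f
    evaluate-+ h k []            = sym (+-identityˡ 0#)
    evaluate-+ h k ((c , x) ∷ f) = trans (+-congˡ (evaluate-+ h k f))
      (solve 5 (λ c h k s t → c :* (h :+ k) :+ (s :+ t) := (c :* h :+ s) :+ (c :* k :+ t)) refl c (h x) (k x) _ _)

    evaluate-- : ∀ (h k : X → 𝕜) f → evaluate (λ x → h x - k x) f ≈ evaluate h f - evaluate k f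
    evaluate-- h k []            = sym (-‿inverseʳ 0#)
    evaluate-- h k ((c , x) ∷ f) = trans (+-congˡ (evaluate-- h k f))
      (solve 5 (λ c h k s t → c :* (h :- k) :+ (s :- t) := (c :* h :+ s) :- (c :* k :+ t)) refl c (h x) (k x) _ _)

    evaluate-* : ∀ a (h : X → 𝕜) f → evaluate (λ x → a * h x) f ≈ a * evaluate h f
    evaluate-* a h []            = sym (zeroʳ a)
    evaluate-* a h ((c , x) ∷ f) = trans (+-congˡ (evaluate-* a h f))
      (solve 4 (λ c a h s → c :* (a :* h) :+ a :* s := a :* (c :* h :+ s)) refl c a (h x) _)

    evaluate-0 : ∀ (f : List (𝕜 × X)) → evaluate (λ _ → 0#) f ≈ 0#
    evaluate-0 []            = refl
    evaluate-0 ((c , _) ∷ f) = trans (+-cong (zeroʳ c) (evaluate-0 f)) (+-identityʳ 0#)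

    evaluate-map : ∀ {y} {Y : Set y} (h : Y → 𝕜) (k : X → Y) f →
                   evaluate h (map (λ (c , x) → c , k x) f) ≈ evaluate (λ x → h (k x)) f
    evaluate-map h k []      = refl
    evaluate-map h k (_ ∷ f) = +-congˡ (evaluate-map h k f)

-- Finite sums Σ cᵢ xᵢ with the product extending _∙_ bilinearly, modulo a congruence.
module FormalSums (K : CommutativeRing 0ℓ 0ℓ) {x} {X : Set x} (_∙_ : X → X → X) (ε : X) where
  open CommutativeRing K renaming (Carrier to 𝕜) hiding (zero; isEquivalence)
  open RingProperties ring using (-‿distribʳ-*; -0#≈0#)
  open Evaluation K public

  FormalSum : Set x
  FormalSum = List (𝕜 × X)

  infixl 7 _⊗_ _⊛_

  _⊗_ : 𝕜 × X → 𝕜 × X → 𝕜 × X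
  (c , x) ⊗ (d , y) = c * d , x ∙ y

  _⊛_ : FormalSum → FormalSum → FormalSum
  f ⊛ g = concatMap (λ s → map (s ⊗_) g) f

  negate : FormalSum → FormalSum
  negate = map λ (c , x) → - c , x

  record IsAlgebraCongruence {ℓ} (_~_ : Rel FormalSum ℓ) : Set (x ⊔ ℓ) where
    field
      isEquivalence : IsEquivalence _~_
      ++-cong       : ∀ {f f′ g g′} → f ~ f′ → g ~ g′ → (f ++ g) ~ (f′ ++ g′)
      ++-comm       : ∀ f g → (f ++ g) ~ (g ++ f)
      coeff-cong    : ∀ {c d} x → c ≈ d → ((c , x) ∷ []) ~ ((d , x) ∷ [])
      coeff-+       : ∀ c d x → ((c + d , x) ∷ []) ~ ((c , x) ∷ (d , x) ∷ [])
      coeff-0       : ∀ x → ((0# , x) ∷ []) ~ []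
      ∙-assoc       : ∀ c x y z → ((c , (x ∙ y) ∙ z) ∷ []) ~ ((c , x ∙ (y ∙ z)) ∷ [])
      ∙-comm        : ∀ c x y → ((c , x ∙ y) ∷ []) ~ ((c , y ∙ x) ∷ [])
      ∙-identityˡ   : ∀ c x → ((c , ε ∙ x) ∷ []) ~ ((c , x) ∷ [])
      ⊗-congʳ       : ∀ t {f g} → f ~ g → map (_⊗ t) f ~ map (_⊗ t) g

    private
      open IsEquivalence isEquivalence renaming (refl to ~-refl; sym to ~-sym; trans to ~-trans)

      ++-commutativeMonoid : CommutativeMonoid x ℓ
      ++-commutativeMonoid = record
        { Carrier = FormalSum
        ; _≈_ = _~_
        ; _∙_ = _++_
        ; ε = []
        ; isCommutativeMonoid = record
          { isMonoid = record
            { isSemigroup = record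
              { isMagma = record { isEquivalence = isEquivalence ; ∙-cong = ++-cong }
              ; assoc = λ f g h → IsEquivalence.reflexive isEquivalence (List.++-assoc f g h) }
            ; identity = (λ _ → ~-refl) , λ f → IsEquivalence.reflexive isEquivalence (List.++-identityʳ f) }
          ; comm = ++-comm } }

      open CommutativeMonoid ++-commutativeMonoid using (commutativeSemigroup; identityʳ; isMonoid)
      open CommutativeSemigroupProperties commutativeSemigroup using (interchange)
      open SetoidReasoning (CommutativeMonoid.setoid ++-commutativeMonoid)

      map-cong : {k l : 𝕜 × X → 𝕜 × X} → (∀ s → (k s ∷ []) ~ (l s ∷ [])) → ∀ f → map k f ~ map l f
      map-cong k~l []      = ~-refl
      map-cong k~l (s ∷ f) = ++-cong (k~l s) (map-cong k~l f)

      concatMap-cong : {k l : 𝕜 × X → FormalSum} → (∀ s → k s ~ l s) → ∀ f → concatMap k f ~ concatMap l f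
      concatMap-cong k~l []      = ~-refl
      concatMap-cong k~l (s ∷ f) = ++-cong (k~l s) (concatMap-cong k~l f)

      concatMap-∷ : ∀ (k : 𝕜 × X → 𝕜 × X) (l : 𝕜 × X → FormalSum) g →
                    concatMap (λ t → k t ∷ l t) g ~ (map k g ++ concatMap l g)
      concatMap-∷ k l []      = ~-refl
      concatMap-∷ k l (t ∷ g) = begin
        (k t ∷ l t) ++ concatMap (λ t → k t ∷ l t) g          ≈⟨ ++-cong ~-refl (concatMap-∷ k l g) ⟩
        ((k t ∷ []) ++ l t) ++ (map k g ++ concatMap l g)     ≈⟨ interchange (k t ∷ []) (l t) (map k g) (concatMap l g) ⟩
        ((k t ∷ []) ++ map k g) ++ (l t ++ concatMap l g)     ∎

      concatMap-[] : ∀ (g : FormalSum) → concatMap (λ _ → []) g ≡ []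
      concatMap-[] []      = ≡.refl
      concatMap-[] (_ ∷ g) = concatMap-[] g

      ⊛-transpose : ∀ f g → (f ⊛ g) ~ concatMap (λ t → map (_⊗ t) f) g
      ⊛-transpose []      g = IsEquivalence.reflexive isEquivalence (≡.sym (concatMap-[] g))
      ⊛-transpose (s ∷ f) g = begin
        map (s ⊗_) g ++ (f ⊛ g)                              ≈⟨ ++-cong ~-refl (⊛-transpose f g) ⟩
        map (s ⊗_) g ++ concatMap (λ t → map (_⊗ t) f) g     ≈⟨ concatMap-∷ (s ⊗_) (λ t → map (_⊗ t) f) g ⟨
        concatMap (λ t → map (_⊗ t) (s ∷ f)) g               ∎

      ⊗-comm : ∀ s t → ((s ⊗ t) ∷ []) ~ ((t ⊗ s) ∷ [])
      ⊗-comm (c , x) (d , y) = ~-trans (coeff-cong _ (*-comm c d)) (∙-comm (d * c) x y)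

      ⊗-assoc : ∀ s t u → ((s ⊗ t ⊗ u) ∷ []) ~ ((s ⊗ (t ⊗ u)) ∷ [])
      ⊗-assoc (c , x) (d , y) (e , z) = ~-trans (coeff-cong _ (*-assoc c d e)) (∙-assoc _ x y z)

      ⊛-comm : ∀ f g → (f ⊛ g) ~ (g ⊛ f)
      ⊛-comm f g = ~-trans (⊛-transpose f g) (concatMap-cong (λ t → map-cong (λ s → ⊗-comm s t) f) g)

      ⊛-congʳ : ∀ {f f′} g → f ~ f′ → (f ⊛ g) ~ (f′ ⊛ g)
      ⊛-congʳ {f} {f′} g f~f′ = begin
        f ⊛ g                                ≈⟨ ⊛-transpose f g ⟩
        concatMap (λ t → map (_⊗ t) f) g     ≈⟨ concatMap-cong (λ t → ⊗-congʳ t f~f′) g ⟩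
        concatMap (λ t → map (_⊗ t) f′) g    ≈⟨ ⊛-transpose f′ g ⟨
        f′ ⊛ g                               ∎

      ⊛-cong : ∀ {f f′ g g′} → f ~ f′ → g ~ g′ → (f ⊛ g) ~ (f′ ⊛ g′)
      ⊛-cong {f} {f′} {g} {g′} f~f′ g~g′ =
        ~-trans (⊛-congʳ g f~f′) (~-trans (⊛-comm f′ g) (~-trans (⊛-congʳ f′ g~g′) (⊛-comm g′ f′)))

      ⊛-distribʳ : ∀ h f g → ((f ++ g) ⊛ h) ~ ((f ⊛ h) ++ (g ⊛ h))
      ⊛-distribʳ h f g = IsEquivalence.reflexive isEquivalence (List.concatMap-++ (λ s → map (s ⊗_) h) f g)

      ⊛-distribˡ : ∀ h f g → (h ⊛ (f ++ g)) ~ ((h ⊛ f) ++ (h ⊛ g))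
      ⊛-distribˡ h f g =
        ~-trans (⊛-comm h (f ++ g)) (~-trans (⊛-distribʳ h f g) (++-cong (⊛-comm f h) (⊛-comm g h)))

      map-⊗-⊛ : ∀ s g h → (map (s ⊗_) g ⊛ h) ~ map (s ⊗_) (g ⊛ h)
      map-⊗-⊛ s []      h = ~-refl
      map-⊗-⊛ s (t ∷ g) h = begin
        map (s ⊗ t ⊗_) h ++ (map (s ⊗_) g ⊛ h)                ≈⟨ ++-cong (map-cong (⊗-assoc s t) h) (map-⊗-⊛ s g h) ⟩
        map (λ u → s ⊗ (t ⊗ u)) h ++ map (s ⊗_) (g ⊛ h)       ≡⟨ ≡.cong (_++ map (s ⊗_) (g ⊛ h)) (List.map-∘ h) ⟩
        map (s ⊗_) (map (t ⊗_) h) ++ map (s ⊗_) (g ⊛ h)       ≡⟨ List.map-++ (s ⊗_) (map (t ⊗_) h) (g ⊛ h) ⟨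
        map (s ⊗_) (map (t ⊗_) h ++ (g ⊛ h))                  ∎

      ⊛-assoc : ∀ f g h → (f ⊛ g ⊛ h) ~ (f ⊛ (g ⊛ h))
      ⊛-assoc []      g h = ~-refl
      ⊛-assoc (s ∷ f) g h =
        ~-trans (⊛-distribʳ h (map (s ⊗_) g) (f ⊛ g)) (++-cong (map-⊗-⊛ s g h) (⊛-assoc f g h))

      ⊛-identityˡ : ∀ f → (((1# , ε) ∷ []) ⊛ f) ~ f
      ⊛-identityˡ f = ~-trans (identityʳ _) (~-trans
        (map-cong (λ (c , x) → ~-trans (coeff-cong _ (*-identityˡ c)) (∙-identityˡ c x)) f)
        (IsEquivalence.reflexive isEquivalence (List.map-id f)))

      negate-inverse : ∀ f → (f ++ negate f) ~ []
      negate-inverse []            = ~-refl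
      negate-inverse ((c , x) ∷ f) = begin
        (((c , x) ∷ []) ++ f) ++ (((- c , x) ∷ []) ++ negate f)   ≈⟨ interchange ((c , x) ∷ []) f ((- c , x) ∷ []) (negate f) ⟩
        ((c , x) ∷ (- c , x) ∷ []) ++ (f ++ negate f)             ≈⟨ ++-cong (coeff-+ c (- c) x) ~-refl ⟨
        ((c - c , x) ∷ []) ++ (f ++ negate f)                     ≈⟨ ++-cong (coeff-cong x (-‿inverseʳ c)) (negate-inverse f) ⟩
        ((0# , x) ∷ []) ++ []                                     ≈⟨ coeff-0 x ⟩
        []                                                        ∎

      negate-⊗ : ∀ f → negate f ~ map (_⊗ (- 1# , ε)) f
      negate-⊗ = map-cong λ (c , x) → ~-sym (begin
        (c * - 1# , x ∙ ε) ∷ []     ≈⟨ coeff-cong _ (trans (sym (-‿distribʳ-* c 1#)) (-‿cong (*-identityʳ c))) ⟩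
        (- c , x ∙ ε) ∷ []          ≈⟨ ∙-comm (- c) x ε ⟩
        (- c , ε ∙ x) ∷ []          ≈⟨ ∙-identityˡ (- c) x ⟩
        (- c , x) ∷ []              ∎)

      negate-cong : ∀ {f g} → f ~ g → negate f ~ negate g
      negate-cong {f} {g} f~g = ~-trans (negate-⊗ f) (~-trans (⊗-congʳ (- 1# , ε) f~g) (~-sym (negate-⊗ g)))

    algebra : Algebra K x ℓ
    algebra = record
      { commutativeRing = record
        { Carrier = FormalSum
        ; _≈_ = _~_
        ; _+_ = _++_
        ; _*_ = _⊛_
        ; -_  = negate
        ; 0#  = []
        ; 1#  = (1# , ε) ∷ []
        ; isCommutativeRing = record
          { isRing = record
            { +-isAbelianGroup = record
              { isGroup = record
                { isMonoid = isMonoid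
                ; inverse = (λ f → ~-trans (++-comm (negate f) f) (negate-inverse f)) , negate-inverse
                ; ⁻¹-cong = negate-cong }
              ; comm = ++-comm }
            ; *-cong = ⊛-cong
            ; *-assoc = ⊛-assoc
            ; *-identity = ⊛-identityˡ , λ f → ~-trans (⊛-comm f _) (⊛-identityˡ f)
            ; distrib = ⊛-distribˡ , ⊛-distribʳ }
          ; *-comm = ⊛-comm } }
      ; ι = λ c → (c , ε) ∷ []
      ; ι-homo = record
        { isSemiringHomomorphism = record
          { isNearSemiringHomomorphism = record
            { +-isMonoidHomomorphism = record
              { isMagmaHomomorphism = record
                { isRelHomomorphism = record { cong = coeff-cong ε }
                ; homo = λ c d → coeff-+ c d ε }
              ; ε-homo = coeff-0 ε }
            ; *-homo = λ c d → ~-sym (∙-identityˡ (c * d) ε) }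
          ; 1#-homo = ~-refl }
        ; -‿homo = λ _ → ~-refl } }

  evaluate-⊗ : ∀ h c y f → evaluate h (map (_⊗ (c , y)) f) ≈ c * evaluate (λ x → h (x ∙ y)) f
  evaluate-⊗ h c y []            = sym (zeroʳ c)
  evaluate-⊗ h c y ((d , x) ∷ f) = trans
    (+-cong (trans (*-congʳ (*-comm d c)) (*-assoc c d _)) (evaluate-⊗ h c y f)) (sym (distribˡ c _ _))

  evaluate-negate : ∀ h f → evaluate h (negate f) ≈ - evaluate h f
  evaluate-negate h []            = sym -0#≈0#
  evaluate-negate h ((c , x) ∷ f) = trans (+-cong (sym (-‿distribˡ-* c _)) (evaluate-negate h f)) (-‿+-comm _ _)
    where open RingProperties ring using (-‿distribˡ-*; -‿+-comm)

  module _ {t} {T : Set t} (χ : T → X → 𝕜) where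

    SameValues : Rel FormalSum t
    SameValues f g = ∀ t → evaluate (χ t) f ≈ evaluate (χ t) g

    sameValues-isAlgebraCongruence :
      (∀ t x y z → χ t ((x ∙ y) ∙ z) ≈ χ t (x ∙ (y ∙ z))) →
      (∀ t x y → χ t (x ∙ y) ≈ χ t (y ∙ x)) →
      (∀ t x → χ t (ε ∙ x) ≈ χ t x) →
      (∀ f y → (∀ t → evaluate (χ t) f ≈ 0#) → ∀ t → evaluate (λ x → χ t (x ∙ y)) f ≈ 0#) →
      IsAlgebraCongruence SameValues
    sameValues-isAlgebraCongruence χ-assoc χ-comm χ-identity χ-shift = record
      { isEquivalence = record
        { refl = λ _ → refl
        ; sym = λ p t → sym (p t)
        ; trans = λ p q t → trans (p t) (q t) }
      ; ++-cong = λ {f} {f′} {g} {g′} p q t →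
          trans (evaluate-++ _ f g) (trans (+-cong (p t) (q t)) (sym (evaluate-++ _ f′ g′)))
      ; ++-comm = λ f g t → trans (evaluate-++ _ f g) (trans (+-comm _ _) (sym (evaluate-++ _ g f)))
      ; coeff-cong = λ x c≈d t → +-congʳ (*-congʳ c≈d)
      ; coeff-+ = λ c d x t → trans (+-congʳ (distribʳ _ c d)) (+-assoc _ _ _)
      ; coeff-0 = λ x t → trans (+-identityʳ _) (zeroˡ _)
      ; ∙-assoc = λ c x y z t → +-congʳ (*-congˡ (χ-assoc t x y z))
      ; ∙-comm = λ c x y t → +-congʳ (*-congˡ (χ-comm t x y))
      ; ∙-identityˡ = λ c x t → +-congʳ (*-congˡ (χ-identity t x))
      ; ⊗-congʳ = λ (c , y) {f} {g} p t →
          trans (evaluate-⊗ _ c y f) (trans (*-congˡ (shift-cong f g y p t)) (sym (evaluate-⊗ _ c y g))) }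
      where
      difference : ∀ h f g → evaluate h (f ++ negate g) ≈ evaluate h f - evaluate h g
      difference h f g = trans (evaluate-++ h f (negate g)) (+-congˡ (evaluate-negate h g))

      open RingProperties ring using (x∙y⁻¹≈ε⇒x≈y)

      shift-cong : ∀ f g y → SameValues f g → ∀ t → evaluate (λ x → χ t (x ∙ y)) f ≈ evaluate (λ x → χ t (x ∙ y)) g
      shift-cong f g y p t = x∙y⁻¹≈ε⇒x≈y _ _ (trans (sym (difference _ f g))
        (χ-shift (f ++ negate g) y
          (λ s → trans (difference _ f g) (trans (+-congʳ (p s)) (-‿inverseʳ _))) t))

module Indicator (K : CommutativeRing 0ℓ 0ℓ) where
  open CommutativeRing K

  indicator : ∀ {p} {P : Set p} → Dec P → Carrier
  indicator P? = if does P? then 1# else 0#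

  indicator-yes : ∀ {p} {P : Set p} (P? : Dec P) → P → indicator P? ≈ 1#
  indicator-yes (yes _) _ = refl
  indicator-yes (no ¬p) p = contradiction p ¬p

  indicator-no : ∀ {p} {P : Set p} (P? : Dec P) → ¬ P → indicator P? ≈ 0#
  indicator-no (no _)  _  = refl
  indicator-no (yes p) ¬p = contradiction p ¬p

  indicator-cong : ∀ {p q} {P : Set p} {Q : Set q} (P? : Dec P) (Q? : Dec Q) → (P → Q) → (Q → P) →
                   indicator P? ≈ indicator Q?
  indicator-cong (yes p) Q? to from = sym (indicator-yes Q? (to p))
  indicator-cong (no ¬p) Q? to from = sym (indicator-no Q? (¬p ∘ from))

  indicator-× : ∀ {p q r} {P : Set p} {Q : Set q} {R : Set r} (P? : Dec P) (Q? : Dec Q) (R? : Dec R) →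
                (R → P × Q) → (P × Q → R) → indicator R? ≈ indicator P? * indicator Q?
  indicator-× (yes p) (yes q) R? to from = trans (indicator-yes R? (from (p , q))) (sym (*-identityˡ 1#))
  indicator-× (yes _) (no ¬q) R? to from = trans (indicator-no R? (¬q ∘ proj₂ ∘ to)) (sym (zeroʳ 1#))
  indicator-× (no ¬p) Q?      R? to from = trans (indicator-no R? (¬p ∘ proj₁ ∘ to)) (sym (zeroˡ (indicator Q?)))

-- 𝕜[X₁,…,Xₙ]: monomials are exponent vectors, and two sums of terms are equal
-- when they have the same coefficients.
module Polynomials (K : CommutativeRing 0ℓ 0ℓ) (n : ℕ) where
  open CommutativeRing K using (_≈_; refl; sym; trans; 0#; 1#) renaming (Carrier to 𝕜)
  open Indicator K

  Monomial : Set
  Monomial = Vec ℕ n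

  _∙_ : Monomial → Monomial → Monomial
  _∙_ = Vec.zipWith ℕ._+_

  one : Monomial
  one = Vec.replicate n 0

  _≟_ : (m m′ : Monomial) → Dec (m ≡ m′)
  _≟_ = Vec.≡-dec ℕ._≟_

  open FormalSums K _∙_ one public

  δ : Monomial → Monomial → 𝕜
  δ m m′ = indicator (m ≟ m′)

  coefficient : Monomial → FormalSum → 𝕜
  coefficient m = evaluate (δ m)

  private
    δ-cong : ∀ m {m′ m″} → m′ ≡ m″ → δ m m′ ≈ δ m m″
    δ-cong m ≡.refl = refl

    quotient? : ∀ {n} (m y : Vec ℕ n) → Dec (∃ λ q → m ≡ Vec.zipWith ℕ._+_ q y)
    quotient? []      []      = yes ([] , ≡.refl)
    quotient? (k ∷ m) (l ∷ y) with l ℕ.≤? k | quotient? m y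
    ... | yes l≤k | yes (q , m≡qy) = yes (k ℕ.∸ l ∷ q , ≡.cong₂ _∷_ (≡.sym (ℕ.m∸n+n≡m l≤k)) m≡qy)
    ... | no  l≰k | _              = no λ { (j ∷ q , eq) →
      l≰k (≡.subst (l ℕ.≤_) (≡.sym (Vec.∷-injectiveˡ eq)) (ℕ.m≤n+m l j)) }
    ... | _       | no ∄q          = no λ { (j ∷ q , eq) → ∄q (q , Vec.∷-injectiveʳ eq) }

    cancel : ∀ {n} (p q y : Vec ℕ n) → Vec.zipWith ℕ._+_ p y ≡ Vec.zipWith ℕ._+_ q y → p ≡ q
    cancel []      []      []      _  = ≡.refl
    cancel (j ∷ p) (k ∷ q) (l ∷ y) eq =
      ≡.cong₂ _∷_ (ℕ.+-cancelʳ-≡ l j k (Vec.∷-injectiveˡ eq)) (cancel p q y (Vec.∷-injectiveʳ eq))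

    δ-shift : ∀ f y → (∀ m → coefficient m f ≈ 0#) → ∀ m → evaluate (λ x → δ m (x ∙ y)) f ≈ 0#
    δ-shift f y f≈0 m with quotient? m y
    ... | yes (q , ≡.refl) = trans (evaluate-cong (λ x → indicator-cong ((q ∙ y) ≟ (x ∙ y)) (q ≟ x)
                               (cancel q x y) (≡.cong (_∙ y))) f) (f≈0 q)
    ... | no ∄q            = trans (evaluate-cong (λ x → indicator-no (m ≟ (x ∙ y)) λ eq → ∄q (x , eq)) f)
                               (evaluate-0 f)

  polynomials : Algebra K 0ℓ 0ℓ
  polynomials = IsAlgebraCongruence.algebra {_~_ = SameValues δ} (sameValues-isAlgebraCongruence δ
    (λ m x y z → δ-cong m (Vec.zipWith-assoc ℕ.+-assoc x y z))
    (λ m x y → δ-cong m (Vec.zipWith-comm ℕ.+-comm x y))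
    (λ m x → δ-cong m (Vec.zipWith-identityˡ (λ _ → ≡.refl) x))
    δ-shift)

  var : Fin n → FormalSum
  var i = (1# , one Vec.[ i ]≔ 1) ∷ []

-- The tensor product over K of a finite family of algebras: formal sums of pure
-- tensors modulo the smallest K-module congruence that makes
-- (vᵢ)ᵢ ↦ ⊗ᵢ vᵢ multilinear, with componentwise product.
module TensorProduct {K : CommutativeRing 0ℓ 0ℓ} {a ℓ} {d : ℕ} (A : Fin d → Algebra K a ℓ) where
  private
    module K = CommutativeRing K
    module A i = Algebra (A i)

  PureTensor : Set a
  PureTensor = ∀ i → A.Carrier i

  _∙_ : PureTensor → PureTensor → PureTensor
  (u ∙ v) i = A._*_ i (u i) (v i)

  one : PureTensor
  one i = A.1# i

  open FormalSums K _∙_ one public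

  infix 4 _≈_ _≈_off_

  _≈_off_ : PureTensor → PureTensor → Fin d → Set ℓ
  u ≈ v off i = ∀ j → j ≢ i → A._≈_ j (u j) (v j)

  data _≈_ : Rel FormalSum (a ⊔ ℓ) where
    refl       : ∀ {f} → f ≈ f
    sym        : ∀ {f g} → f ≈ g → g ≈ f
    trans      : ∀ {f g h} → f ≈ g → g ≈ h → f ≈ h
    ++-cong    : ∀ {f f′ g g′} → f ≈ f′ → g ≈ g′ → f ++ g ≈ f′ ++ g′
    ++-comm    : ∀ f g → f ++ g ≈ g ++ f
    coeff-+    : ∀ c d v → (c K.+ d , v) ∷ [] ≈ (c , v) ∷ (d , v) ∷ []
    coeff-0    : ∀ v → (K.0# , v) ∷ [] ≈ []
    pure-cong  : ∀ {c d u v} → c K.≈ d → (∀ i → A._≈_ i (u i) (v i)) → (c , u) ∷ [] ≈ (d , v) ∷ []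
    additive   : ∀ c {u v w} i → A._≈_ i (u i) (A._+_ i (v i) (w i)) → u ≈ v off i → u ≈ w off i →
                 (c , u) ∷ [] ≈ (c , v) ∷ (c , w) ∷ []
    homogeneous : ∀ c k {u v} i → A._≈_ i (u i) (A._*_ i (A.ι i k) (v i)) → u ≈ v off i →
                 (c , u) ∷ [] ≈ (c K.* k , v) ∷ []

  private
    ⊗-congʳ : ∀ t {f g} → f ≈ g → map (_⊗ t) f ≈ map (_⊗ t) g
    ⊗-congʳ t refl        = refl
    ⊗-congʳ t (sym p)     = sym (⊗-congʳ t p)
    ⊗-congʳ t (trans p q) = trans (⊗-congʳ t p) (⊗-congʳ t q)
    ⊗-congʳ t (++-cong {f} {f′} {g} {g′} p q)
      rewrite List.map-++ (_⊗ t) f g | List.map-++ (_⊗ t) f′ g′ = ++-cong (⊗-congʳ t p) (⊗-congʳ t q)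
    ⊗-congʳ t (++-comm f g)
      rewrite List.map-++ (_⊗ t) f g | List.map-++ (_⊗ t) g f = ++-comm (map (_⊗ t) f) (map (_⊗ t) g)
    ⊗-congʳ (e , _) (coeff-+ c d v) = trans (pure-cong (K.distribʳ e c d) (λ i → A.refl i)) (coeff-+ _ _ _)
    ⊗-congʳ (e , _) (coeff-0 v)     = trans (pure-cong (K.zeroˡ e) (λ i → A.refl i)) (coeff-0 _)
    ⊗-congʳ _ (pure-cong c≈d u≈v)   = pure-cong (K.*-congʳ c≈d) (λ i → A.*-congʳ i (u≈v i))
    ⊗-congʳ (e , x) (additive c i at-i off-v off-w) = additive (c K.* e) i
      (A.trans i (A.*-congʳ i at-i) (A.distribʳ i _ _ _))
      (λ j j≢i → A.*-congʳ j (off-v j j≢i)) (λ j j≢i → A.*-congʳ j (off-w j j≢i))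
    ⊗-congʳ (e , x) (homogeneous c k i at-i off-v) = trans
      (homogeneous (c K.* e) k i (A.trans i (A.*-congʳ i at-i) (A.*-assoc i _ _ _)) (λ j j≢i → A.*-congʳ j (off-v j j≢i)))
      (pure-cong (K.trans (K.*-assoc c e k) (K.trans (K.*-congˡ (K.*-comm e k)) (K.sym (K.*-assoc c k e)))) (λ i → A.refl i))

  tensorProduct : Algebra K a (a ⊔ ℓ)
  tensorProduct = IsAlgebraCongruence.algebra {_~_ = _≈_} record
    { isEquivalence = record { refl = refl ; sym = sym ; trans = trans }
    ; ++-cong = ++-cong
    ; ++-comm = ++-comm
    ; coeff-cong = λ v c≈d → pure-cong c≈d (λ i → A.refl i)
    ; coeff-+ = coeff-+
    ; coeff-0 = coeff-0
    ; ∙-assoc = λ c u v w → pure-cong K.refl (λ i → A.*-assoc i (u i) (v i) (w i))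
    ; ∙-comm = λ c u v → pure-cong K.refl (λ i → A.*-comm i (u i) (v i))
    ; ∙-identityˡ = λ c u → pure-cong K.refl (λ i → A.*-identityˡ i (u i))
    ; ⊗-congʳ = ⊗-congʳ }

open Polynomials using (polynomials; var) public
open TensorProduct using () renaming (tensorProduct to ⨂) public

-- The axioms of ℝ.  Decidability of ≤ (classically automatic) is what makes the
-- indicator function of a polyhedron a function on all of ℝᵈ.
record CompleteOrderedField : Set₁ where
  infix 4 _≤_
  field
    commutativeRing : CommutativeRing 0ℓ 0ℓ
  open CommutativeRing commutativeRing public
  field
    _≤_             : Rel Carrier 0ℓ
    isDecTotalOrder : IsDecTotalOrder _≈_ _≤_
    1≉0             : ¬ 1# ≈ 0#
    inverse         : ∀ x → ¬ x ≈ 0# → ∃ λ y → x * y ≈ 1#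
    +-monoˡ-≤       : ∀ z {x y} → x ≤ y → x + z ≤ y + z
    *-nonNegative   : ∀ {x y} → 0# ≤ x → 0# ≤ y → 0# ≤ x * y

  _IsUpperBoundOf_ : Carrier → Pred Carrier 0ℓ → Set
  u IsUpperBoundOf P = ∀ x → P x → x ≤ u

  field
    supremum : ∀ (P : Pred Carrier 0ℓ) → ∃ P → (∃ λ u → u IsUpperBoundOf P) →
               ∃ λ s → s IsUpperBoundOf P × (∀ u → u IsUpperBoundOf P → s ≤ u)

  open IsDecTotalOrder isDecTotalOrder public using (_≤?_; _≟_; total; antisym; ≤-respˡ-≈; ≤-respʳ-≈)
    renaming (refl to ≤-refl; trans to ≤-trans; reflexive to ≤-reflexive)

  decTotalOrder : DecTotalOrder 0ℓ 0ℓ 0ℓ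
  decTotalOrder = record { isDecTotalOrder = isDecTotalOrder }

  fromℕ : ℕ → Carrier
  fromℕ zero    = 0#
  fromℕ (suc n) = 1# + fromℕ n

module OrderProperties (R : CompleteOrderedField) where
  open CompleteOrderedField R
  open RingProperties ring using (-0#≈0#)
  open Solver commutativeRing

  ≤-respects : ∀ {w x y z} → w ≈ y → x ≈ z → w ≤ x → y ≤ z
  ≤-respects w≈y x≈z w≤x = ≤-respʳ-≈ x≈z (≤-respˡ-≈ w≈y w≤x)

  x≤y⇒0≤y-x : ∀ {x y} → x ≤ y → 0# ≤ y - x
  x≤y⇒0≤y-x {x} x≤y = ≤-respˡ-≈ (-‿inverseʳ x) (+-monoˡ-≤ (- x) x≤y)

  0≤y-x⇒x≤y : ∀ {x y} → 0# ≤ y - x → x ≤ y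
  0≤y-x⇒x≤y {x} {y} p = ≤-respects (+-identityˡ x) (solve 2 (λ x y → y :- x :+ x := y) refl x y) (+-monoˡ-≤ x p)

  ≤-by : ∀ {w x y z} → x - w ≈ z - y → w ≤ x → y ≤ z
  ≤-by eq w≤x = 0≤y-x⇒x≤y (≤-respʳ-≈ eq (x≤y⇒0≤y-x w≤x))

  neg-antimono : ∀ {x y} → x ≤ y → - y ≤ - x
  neg-antimono {x} {y} = ≤-by (solve 2 (λ x y → y :- x := :- x :- :- y) refl x y)

  +-mono-≤ : ∀ {w x y z} → w ≤ x → y ≤ z → w + y ≤ x + z
  +-mono-≤ {w} {x} {y} {z} p q = ≤-trans (+-monoˡ-≤ y p) (≤-respects (+-comm y x) (+-comm z x) (+-monoˡ-≤ x q))

  *-monoˡ-≤ : ∀ {c x y} → 0# ≤ c → x ≤ y → c * x ≤ c * y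
  *-monoˡ-≤ {c} {x} {y} 0≤c x≤y = 0≤y-x⇒x≤y
    (≤-respʳ-≈ (solve 3 (λ c x y → c :* (y :- x) := c :* y :- c :* x) refl c x y) (*-nonNegative 0≤c (x≤y⇒0≤y-x x≤y)))

  ≰⇒≥ : ∀ {x y} → ¬ x ≤ y → y ≤ x
  ≰⇒≥ {x} {y} x≰y with total x y
  ... | inj₁ x≤y = contradiction x≤y x≰y
  ... | inj₂ y≤x = y≤x

  x≤0⇒0≤-x : ∀ {x} → x ≤ 0# → 0# ≤ - x
  x≤0⇒0≤-x x≤0 = ≤-respˡ-≈ -0#≈0# (neg-antimono x≤0)

  0≤square : ∀ x → 0# ≤ x * x
  0≤square x with total 0# x
  ... | inj₁ 0≤x = *-nonNegative 0≤x 0≤x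
  ... | inj₂ x≤0 = ≤-respʳ-≈ (solve 1 (λ x → :- x :* :- x := x :* x) refl x) (*-nonNegative (x≤0⇒0≤-x x≤0) (x≤0⇒0≤-x x≤0))

  0≤1 : 0# ≤ 1#
  0≤1 = ≤-respʳ-≈ (*-identityˡ 1#) (0≤square 1#)

  2# : Carrier
  2# = 1# + 1#

  2≉0 : ¬ 2# ≈ 0#
  2≉0 2≈0 = 1≉0 (antisym (≤-respʳ-≈ 2≈0 (≤-respˡ-≈ (+-identityˡ 1#) (+-monoˡ-≤ 1# 0≤1))) 0≤1)

  ½ : Carrier
  ½ = proj₁ (inverse 2# 2≉0)

  -- The inverse y of x has the sign of x, since y = x * y².
  inverse-nonNegative : ∀ {x y} → x * y ≈ 1# → 0# ≤ x → 0# ≤ y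
  inverse-nonNegative {x} {y} xy≈1 0≤x = ≤-respʳ-≈
    (trans (sym (*-assoc x y y)) (trans (*-congʳ xy≈1) (*-identityˡ y))) (*-nonNegative 0≤x (0≤square y))

  ½+½ : ∀ x → ½ * x + ½ * x ≈ x
  ½+½ x = begin
    ½ * x + ½ * x       ≈⟨ solve 2 (λ h x → h :* x :+ h :* x := h :* (x :+ x)) refl ½ x ⟩
    ½ * (x + x)         ≈⟨ *-congˡ (+-cong (*-identityˡ x) (*-identityˡ x)) ⟨
    ½ * (1# * x + 1# * x)     ≈⟨ *-congˡ (distribʳ x 1# 1#) ⟨
    ½ * (2# * x)        ≈⟨ *-assoc _ _ _ ⟨
    ½ * 2# * x          ≈⟨ *-congʳ (trans (*-comm _ _) (proj₂ (inverse 2# 2≉0))) ⟩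
    1# * x              ≈⟨ *-identityˡ x ⟩
    x                   ∎
    where open SetoidReasoning setoid

  0≤½ : 0# ≤ ½
  0≤½ = inverse-nonNegative (proj₂ (inverse 2# 2≉0)) (≤-respˡ-≈ (+-identityˡ 0#) (+-mono-≤ 0≤1 0≤1))

  midpoint : Carrier → Carrier → Carrier
  midpoint x y = ½ * x + ½ * y

  ≤-midpoint : ∀ {x y} → x ≤ y → x ≤ midpoint x y
  ≤-midpoint {x} {y} x≤y = ≤-respˡ-≈ (½+½ x) (+-mono-≤ ≤-refl (*-monoˡ-≤ 0≤½ x≤y))

  midpoint-≤ : ∀ {x y} → x ≤ y → midpoint x y ≤ y
  midpoint-≤ {x} {y} x≤y = ≤-respʳ-≈ (½+½ y) (+-monoˡ-≤ _ (*-monoˡ-≤ 0≤½ x≤y))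

  midpoint≤left : ∀ {x y} → midpoint x y ≤ x → y ≤ x
  midpoint≤left {x} {y} p = ≤-respects (½+½ y) (½+½ x) (+-mono-≤ half half)
    where
    half : ½ * y ≤ ½ * x
    half = ≤-by (trans (+-congʳ (sym (½+½ x))) (solve 2 (λ a b → a :+ a :- (a :+ b) := a :- b) refl (½ * x) (½ * y))) p

  right≤midpoint : ∀ {x y} → y ≤ midpoint x y → y ≤ x
  right≤midpoint {x} {y} p = ≤-respects (½+½ y) (½+½ x) (+-mono-≤ half half)
    where
    half : ½ * y ≤ ½ * x
    half = ≤-by (trans (+-congˡ (-‿cong (sym (½+½ y)))) (solve 2 (λ a b → a :+ b :- (b :+ b) := a :- b) refl (½ * x) (½ * y))) p

module ComplexNumbers (R : CompleteOrderedField) where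
  open CompleteOrderedField R
  open Solver commutativeRing

  -- The pair (a , b) stands for a + b𝑖.
  ℂ : CommutativeRing 0ℓ 0ℓ
  ℂ = record
    { Carrier = Carrier × Carrier
    ; _≈_ = λ (a , b) (c , d) → a ≈ c × b ≈ d
    ; _+_ = λ (a , b) (c , d) → a + c , b + d
    ; _*_ = λ (a , b) (c , d) → a * c - b * d , a * d + b * c
    ; -_  = λ (a , b) → - a , - b
    ; 0#  = 0# , 0#
    ; 1#  = 1# , 0#
    ; isCommutativeRing = record
      { isRing = record
        { +-isAbelianGroup = record
          { isGroup = record
            { isMonoid = record
              { isSemigroup = record
                { isMagma = record
                  { isEquivalence = record
                    { refl = refl , refl
                    ; sym = λ (p , q) → sym p , sym q
                    ; trans = λ (p , q) (r , s) → trans p r , trans q s }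
                  ; ∙-cong = λ (p , q) (r , s) → +-cong p r , +-cong q s }
                ; assoc = λ _ _ _ → +-assoc _ _ _ , +-assoc _ _ _ }
              ; identity = (λ _ → +-identityˡ _ , +-identityˡ _) , (λ _ → +-identityʳ _ , +-identityʳ _) }
            ; inverse = (λ _ → -‿inverseˡ _ , -‿inverseˡ _) , (λ _ → -‿inverseʳ _ , -‿inverseʳ _)
            ; ⁻¹-cong = λ (p , q) → -‿cong p , -‿cong q }
          ; comm = λ _ _ → +-comm _ _ , +-comm _ _ }
        ; *-cong = λ (p , q) (r , s) →
            +-cong (*-cong p r) (-‿cong (*-cong q s)) , +-cong (*-cong p s) (*-cong q r)
        ; *-assoc = λ (a , b) (c , d) (e , f) →
            solve 6 (λ a b c d e f → (a :* c :- b :* d) :* e :- (a :* d :+ b :* c) :* f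
                                  := a :* (c :* e :- d :* f) :- b :* (c :* f :+ d :* e)) refl a b c d e f ,
            solve 6 (λ a b c d e f → (a :* c :- b :* d) :* f :+ (a :* d :+ b :* c) :* e
                                  := a :* (c :* f :+ d :* e) :+ b :* (c :* e :- d :* f)) refl a b c d e f
        ; *-identity = identityˡ , λ (a , b) → let p , q = *-comm′ (a , b) (1# , 0#) ; r , s = identityˡ (a , b)
                                               in trans p r , trans q s
        ; distrib =
            (λ (a , b) (c , d) (e , f) →
              solve 6 (λ a b c d e f → a :* (c :+ e) :- b :* (d :+ f)
                                    := (a :* c :- b :* d) :+ (a :* e :- b :* f)) refl a b c d e f ,
              solve 6 (λ a b c d e f → a :* (d :+ f) :+ b :* (c :+ e)
                                    := (a :* d :+ b :* c) :+ (a :* f :+ b :* e)) refl a b c d e f) ,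
            (λ (a , b) (c , d) (e , f) →
              solve 6 (λ a b c d e f → (c :+ e) :* a :- (d :+ f) :* b
                                    := (c :* a :- d :* b) :+ (e :* a :- f :* b)) refl a b c d e f ,
              solve 6 (λ a b c d e f → (c :+ e) :* b :+ (d :+ f) :* a
                                    := (c :* b :+ d :* a) :+ (e :* b :+ f :* a)) refl a b c d e f) }
      ; *-comm = *-comm′ } }
    where
    _≈²_ : Rel (Carrier × Carrier) 0ℓ
    (a , b) ≈² (c , d) = a ≈ c × b ≈ d

    *-comm′ : ∀ ((a , b) (c , d) : Carrier × Carrier) → (a * c - b * d , a * d + b * c) ≈² (c * a - d * b , c * b + d * a)
    *-comm′ (a , b) (c , d) = solve 4 (λ a b c d → a :* c :- b :* d := c :* a :- d :* b) refl a b c d ,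
                             solve 4 (λ a b c d → a :* d :+ b :* c := c :* b :+ d :* a) refl a b c d

    identityˡ : ∀ ((a , b) : Carrier × Carrier) → (1# * a - 0# * b , 1# * b + 0# * a) ≈² (a , b)
    identityˡ (a , b) =
      trans (+-cong (*-identityˡ a) (trans (-‿cong (zeroˡ b)) -0#≈0#)) (+-identityʳ a) ,
      trans (+-cong (*-identityˡ b) (zeroˡ a)) (+-identityʳ b)
      where open RingProperties ring using (-0#≈0#)

open ComplexNumbers using (ℂ) public

data Constraint {a} (A : Set a) : Set a where
  atMost atLeast nonNegative : A → Constraint A

mapConstraint : ∀ {a b} {A : Set a} {B : Set b} → (A → B) → Constraint A → Constraint B
mapConstraint f (atMost x)      = atMost (f x)
mapConstraint f (atLeast x)     = atLeast (f x)
mapConstraint f (nonNegative x) = nonNegative (f x)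

module Elimination {a} {A : Set a} (_⊝_ : A → A → A) where

  combine : Constraint A → Constraint A → List A
  combine (nonNegative x) _           = x ∷ []
  combine (atMost x)      (atLeast y) = (x ⊝ y) ∷ []
  combine _               _           = []

  eliminate : List (Constraint A) → List A
  eliminate L = concatMap (λ c → concatMap (combine c) L) L

  module _ {p} {P : Pred A p} where

    AllCombine : List (Constraint A) → Set _
    AllCombine L = All (λ c → All (λ c′ → All P (combine c c′)) L) L

    eliminate⁺ : ∀ L → AllCombine L → All P (eliminate L)
    eliminate⁺ L q = All.concat⁺ (All.map⁺ (All.map (All.concat⁺ ∘ All.map⁺) q))

    eliminate⁻ : ∀ L → All P (eliminate L) → AllCombine L
    eliminate⁻ L q = All.map (All.map⁻ ∘ All.concat⁻) (All.map⁻ (All.concat⁻ q))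

module Intervals (R : CompleteOrderedField) where
  open CompleteOrderedField R renaming (Carrier to ℝ) hiding (zero; refl; sym; trans)
  open OrderProperties R
  open Elimination _-_
  module ℂ = CommutativeRing (ℂ R)
  open Indicator (ℂ R)
  open Evaluation (ℂ R)

  Holds : ℝ → Constraint ℝ → Set
  Holds t (atMost u)      = t ≤ u
  Holds t (atLeast l)     = l ≤ t
  Holds t (nonNegative r) = 0# ≤ r

  holds? : ∀ t c → Dec (Holds t c)
  holds? t (atMost u)      = t ≤? u
  holds? t (atLeast l)     = l ≤? t
  holds? t (nonNegative r) = 0# ≤? r

  In : List (Constraint ℝ) → ℝ → Set
  In L t = All (Holds t) L

  in? : ∀ L t → Dec (In L t)
  in? L t = All.all? (holds? t) L

  Compatible : Constraint ℝ → Constraint ℝ → Set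
  Compatible c c′ = All (0# ≤_) (combine c c′)

  holds⇒compatible : ∀ t c c′ → Holds t c → Holds t c′ → Compatible c c′
  holds⇒compatible t (atMost u)      (atMost _)      _ _ = []
  holds⇒compatible t (atMost u)      (atLeast l)     p q = x≤y⇒0≤y-x (≤-trans q p) ∷ []
  holds⇒compatible t (atMost u)      (nonNegative _) _ _ = []
  holds⇒compatible t (atLeast _)     _               _ _ = []
  holds⇒compatible t (nonNegative r) _               p _ = p ∷ []

  compatible⇒solvable : ∀ L → AllCombine {P = 0# ≤_} L → ∃ (In L)
  compatible⇒solvable []      _ = 0# , []
  compatible⇒solvable (c ∷ L) ((self ∷ forth) ∷ rest)
    with compatible⇒solvable L (All.map All.tail rest)
  compatible⇒solvable (nonNegative r ∷ L) (((0≤r ∷ []) ∷ forth) ∷ rest) | t , t∈L = t , 0≤r ∷ t∈L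
  compatible⇒solvable (atMost u ∷ L) ((self ∷ forth) ∷ rest) | t , t∈L with t ≤? u
  ... | yes t≤u = t , t≤u ∷ t∈L
  ... | no  t≰u = u , ≤-refl ∷ All.zipWith (λ {c} (p , q) → move c p q) (t∈L , forth)
    where
    move : ∀ c → Holds t c → Compatible (atMost u) c → Holds u c
    move (atMost u′)     t≤u′ _         = ≤-trans (≰⇒≥ t≰u) t≤u′
    move (atLeast l)     _    (p ∷ [])  = 0≤y-x⇒x≤y p
    move (nonNegative r) 0≤r  _         = 0≤r
  compatible⇒solvable (atLeast l ∷ L) ((self ∷ forth) ∷ rest) | t , t∈L with l ≤? t
  ... | yes l≤t = t , l≤t ∷ t∈L
  ... | no  l≰t = l , ≤-refl ∷ All.zipWith (λ {c} (p , q) → move c p q) (t∈L , All.map All.head rest)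
    where
    move : ∀ c → Holds t c → Compatible c (atLeast l) → Holds l c
    move (atMost u)      _    (p ∷ []) = 0≤y-x⇒x≤y p
    move (atLeast l′)    l′≤t _        = ≤-trans l′≤t (≰⇒≥ l≰t)
    move (nonNegative r) 0≤r  _        = 0≤r

  solvable⇒compatible : ∀ L → ∃ (In L) → AllCombine {P = 0# ≤_} L
  solvable⇒compatible L (t , t∈L) =
    All.map (λ {c} p → All.map (λ {c′} q → holds⇒compatible t c c′ p q) t∈L) t∈L

  solvable? : ∀ L → Dec (∃ (In L))
  solvable? L = map′ (compatible⇒solvable L ∘ eliminate⁻ L) (eliminate⁺ L ∘ solvable⇒compatible L)
                     (All.all? (0# ≤?_) (eliminate L))

  -- An Euler characteristic on finite unions of closed intervals, computed at
  -- the points p , ps and at the midpoints of consecutive ones.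
  sample : (ℝ → ℂ.Carrier) → ℝ → List ℝ → ℂ.Carrier
  sample g p []       = g p
  sample g p (q ∷ ps) = g p ℂ.- g (midpoint p q) ℂ.+ sample g q ps

  module _ {x} {X : Set x} (h : ℝ → X → ℂ.Carrier) where

    evaluate-sample : ∀ f p ps → evaluate (λ x → sample (λ t → h t x) p ps) f ℂ.≈ sample (λ t → evaluate (h t) f) p ps
    evaluate-sample f p []       = ℂ.refl
    evaluate-sample f p (q ∷ ps) = ℂ.trans (evaluate-+ _ _ f)
      (ℂ.+-cong (evaluate-- (h p) (h (midpoint p q)) f) (evaluate-sample f q ps))

  sample-0 : ∀ g → (∀ t → g t ℂ.≈ ℂ.0#) → ∀ p ps → sample g p ps ℂ.≈ ℂ.0#
  sample-0 g g≈0 p []       = g≈0 p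
  sample-0 g g≈0 p (q ∷ ps) = ℂ.trans
    (ℂ.+-cong (ℂ.trans (ℂ.+-cong (g≈0 p) (ℂ.-‿cong (g≈0 _))) (ℂ.-‿inverseʳ ℂ.0#)) (sample-0 g g≈0 q ps))
    (ℂ.+-identityˡ ℂ.0#)

  endpoints : Constraint ℝ → List ℝ
  endpoints (atMost u)      = u ∷ []
  endpoints (atLeast l)     = l ∷ []
  endpoints (nonNegative _) = []

  Away : ℝ → ℝ → Constraint ℝ → Set
  Away p q c = All (λ s → s ≤ p ⊎ q ≤ s) (endpoints c)

  midpoint⁻ : ∀ {p q} c → p ≤ q → Away p q c → Holds (midpoint p q) c → Holds p c × Holds q c
  midpoint⁻ (atMost u) p≤q (inj₁ u≤p ∷ []) m≤u =
    p≤u , ≤-trans (midpoint≤left (≤-trans m≤u u≤p)) p≤u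
    where p≤u = ≤-trans (≤-midpoint p≤q) m≤u
  midpoint⁻ (atMost u)      p≤q (inj₂ q≤u ∷ []) m≤u = ≤-trans p≤q q≤u , q≤u
  midpoint⁻ (atLeast l)     p≤q (inj₁ l≤p ∷ []) l≤m = l≤p , ≤-trans l≤p p≤q
  midpoint⁻ (atLeast l)     p≤q (inj₂ q≤l ∷ []) l≤m =
    ≤-trans l≤q (right≤midpoint (≤-trans q≤l l≤m)) , l≤q
    where l≤q = ≤-trans l≤m (midpoint-≤ p≤q)
  midpoint⁻ (nonNegative r) p≤q _ 0≤r = 0≤r , 0≤r

  convex : ∀ {p q r} c → p ≤ q → q ≤ r → Holds p c → Holds r c → Holds q c
  convex (atMost u)      p≤q q≤r _   r≤u = ≤-trans q≤r r≤u
  convex (atLeast l)     p≤q q≤r l≤p _   = ≤-trans l≤p p≤q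
  convex (nonNegative r) p≤q q≤r 0≤r _   = 0≤r

  Seen : ℝ → List ℝ → Constraint ℝ → Set
  Seen p ps c = All (λ s → s ≤ p ⊎ s ∈ ps) (endpoints c)

  module _ (L : List (Constraint ℝ)) where
    private
      χ : ℝ → ℂ.Carrier
      χ t = indicator (in? L t)

      in-convex : ∀ {p q r} → p ≤ q → q ≤ r → In L p → In L r → In L q
      in-convex p≤q q≤r p∈ r∈ = All.zipWith (λ {c} (p , r) → convex c p≤q q≤r p r) (p∈ , r∈)

      in-midpoint : ∀ {p q ps} → p ≤ q → All (q ≤_) ps → All (Seen p (q ∷ ps)) L →
                    In L (midpoint p q) → In L p × In L q
      in-midpoint {p} {q} p≤q q≤ps seen m∈ =
        All.map proj₁ both , All.map proj₂ both
        where
        away : ∀ {s} → s ≤ p ⊎ s ∈ (q ∷ _) → s ≤ p ⊎ q ≤ s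
        away (inj₁ s≤p)            = inj₁ s≤p
        away (inj₂ (here ≡.refl))  = inj₂ ≤-refl
        away (inj₂ (there s∈ps))   = inj₂ (All.lookup q≤ps s∈ps)

        both : All (λ c → Holds p c × Holds q c) L
        both = All.zipWith (λ {c} (s , m) → midpoint⁻ c p≤q (All.map away s) m) (seen , m∈)

      advance : ∀ {p q ps} → p ≤ q → All (Seen p (q ∷ ps)) L → All (Seen q ps) L
      advance {p} {q} {ps} p≤q = All.map (All.map step)
        where
        step : ∀ {s} → s ≤ p ⊎ s ∈ (q ∷ ps) → s ≤ q ⊎ s ∈ ps
        step (inj₁ s≤p)           = inj₁ (≤-trans s≤p p≤q)
        step (inj₂ (here ≡.refl)) = inj₁ ≤-refl
        step (inj₂ (there s∈ps))  = inj₂ s∈ps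

    sample-none : ∀ p ps → AllPairs _≤_ (p ∷ ps) → All (Seen p ps) L → ¬ Any (In L) (p ∷ ps) →
                  sample χ p ps ℂ.≈ ℂ.0#
    sample-none p []       _ _ none = indicator-no (in? L p) (none ∘ here)
    sample-none p (q ∷ ps) ((p≤q ∷ p≤ps) ∷ sorted@(q≤ps ∷ _)) seen none = ℂ.trans
      (ℂ.+-cong (ℂ.+-cong (indicator-no (in? L p) (none ∘ here))
                          (ℂ.-‿cong (indicator-no (in? L _) (none ∘ here ∘ proj₁ ∘ in-midpoint p≤q q≤ps seen))))
                (sample-none q ps sorted (advance p≤q seen) (none ∘ there)))
      (ℂ.trans (ℂ.+-identityʳ _) (ℂ.-‿inverseʳ ℂ.0#))

    sample-some : ∀ p ps → AllPairs _≤_ (p ∷ ps) → All (Seen p ps) L → Any (In L) (p ∷ ps) →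
                  sample χ p ps ℂ.≈ ℂ.1#
    sample-some p [] _ _ (here p∈) = indicator-yes (in? L p) p∈
    sample-some p (q ∷ ps) ((p≤q ∷ p≤ps) ∷ sorted@(q≤ps ∷ _)) seen some with in? L p | in? L q
    ... | yes p∈ | yes q∈ = ℂ.trans
      (ℂ.+-cong (ℂ.trans (ℂ.+-congˡ (ℂ.-‿cong (indicator-yes (in? L _)
                  (in-convex (≤-midpoint p≤q) (midpoint-≤ p≤q) p∈ q∈)))) (ℂ.-‿inverseʳ ℂ.1#))
                (sample-some q ps sorted (advance p≤q seen) (here q∈)))
      (ℂ.+-identityˡ ℂ.1#)
    ... | yes p∈ | no q∉ = ℂ.trans
      (ℂ.+-cong (ℂ.+-congˡ (ℂ.-‿cong (indicator-no (in? L _) (q∉ ∘ proj₂ ∘ in-midpoint p≤q q≤ps seen))))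
                (sample-none q ps sorted (advance p≤q seen) beyond))
      (ℂ.trans (ℂ.+-identityʳ _) (ℂ.trans (ℂ.+-congˡ -ℂ0) (ℂ.+-identityʳ ℂ.1#)))
      where
      open RingProperties ℂ.ring using () renaming (-0#≈0# to -ℂ0)

      beyond : ¬ Any (In L) (q ∷ ps)
      beyond (here q∈)         = q∉ q∈
      beyond (there later)     = let r , r∈ps , r∈ = find later in q∉ (in-convex p≤q (All.lookup q≤ps r∈ps) p∈ r∈)
    ... | no p∉ | _ = ℂ.trans
      (ℂ.+-cong (ℂ.+-congˡ (ℂ.-‿cong (indicator-no (in? L _) (p∉ ∘ proj₁ ∘ in-midpoint p≤q q≤ps seen))))
                (sample-some q ps sorted (advance p≤q seen) (later some)))
      (ℂ.trans (ℂ.+-congʳ (ℂ.-‿inverseʳ ℂ.0#)) (ℂ.+-identityˡ ℂ.1#))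
      where
      later : Any (In L) (p ∷ q ∷ ps) → Any (In L) (q ∷ ps)
      later (here p∈)  = contradiction p∈ p∉
      later (there q∈) = q∈

  Nearest : ℝ → List ℝ → ℝ → Set
  Nearest t ps q = (q ≤ t × All (λ s → s ≤ t → s ≤ q) ps) ⊎ (All (λ s → ¬ s ≤ t × q ≤ s) ps)

  nearest : ∀ t p ps → ∃ λ q → q ∈ (p ∷ ps) × Nearest t (p ∷ ps) q
  nearest t p [] with p ≤? t
  ... | yes p≤t = p , here ≡.refl , inj₁ (p≤t , (λ _ → ≤-refl) ∷ [])
  ... | no  p≰t = p , here ≡.refl , inj₂ ((p≰t , ≤-refl) ∷ [])
  nearest t p (p′ ∷ ps) with p ≤? t | nearest t p′ ps
  ... | no p≰t | q , q∈ , inj₁ (q≤t , below) = q , there q∈ , inj₁ (q≤t , (λ p≤t → contradiction p≤t p≰t) ∷ below)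
  ... | yes p≤t | q , q∈ , inj₂ above = p , here ≡.refl ,
    inj₁ (p≤t , (λ _ → ≤-refl) ∷ All.map (λ (s≰t , _) s≤t → contradiction s≤t s≰t) above)
  ... | yes p≤t | q , q∈ , inj₁ (q≤t , below) with total p q
  ...   | inj₁ p≤q = q , there q∈ , inj₁ (q≤t , (λ _ → p≤q) ∷ below)
  ...   | inj₂ q≤p = p , here ≡.refl , inj₁ (p≤t , (λ _ → ≤-refl) ∷ All.map (λ k s≤t → ≤-trans (k s≤t) q≤p) below)
  nearest t p (p′ ∷ ps) | no p≰t | q , q∈ , inj₂ above with total p q
  ...   | inj₁ p≤q = p , here ≡.refl , inj₂ ((p≰t , ≤-refl) ∷ All.map (λ (s≰t , q≤s) → s≰t , ≤-trans p≤q q≤s) above)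
  ...   | inj₂ q≤p = q , there q∈ , inj₂ ((p≰t , q≤p) ∷ above)

  nearest-holds : ∀ {t ps q} c → Nearest t ps q → All (_∈ ps) (endpoints c) → Holds t c → Holds q c
  nearest-holds (atMost u)      (inj₁ (q≤t , _))   _          t≤u = ≤-trans q≤t t≤u
  nearest-holds (atMost u)      (inj₂ above)       (u∈ ∷ [])  t≤u = proj₂ (All.lookup above u∈)
  nearest-holds (atLeast l)     (inj₁ (_ , below)) (l∈ ∷ [])  l≤t = All.lookup below l∈ l≤t
  nearest-holds (atLeast l)     (inj₂ above)       (l∈ ∷ [])  l≤t = contradiction l≤t (proj₁ (All.lookup above l∈))
  nearest-holds (nonNegative r) _                  _          0≤r = 0≤r

  sample≈solvable : ∀ L p ps → AllPairs _≤_ (p ∷ ps) → All (λ c → All (_∈ (p ∷ ps)) (endpoints c)) L →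
                    (S? : Dec (∃ (In L))) → sample (λ t → indicator (in? L t)) p ps ℂ.≈ indicator S?
  sample≈solvable L p ps sorted ends (yes (t , t∈)) = sample-some L p ps sorted (All.map (All.map seen) ends)
    (let q , q∈ , near = nearest t p ps
     in lose q∈ (All.zipWith (λ {c} (e , h) → nearest-holds c near e h) (ends , t∈)))
    where
    seen : ∀ {s} → s ∈ (p ∷ ps) → s ≤ p ⊎ s ∈ ps
    seen (here ≡.refl) = inj₁ ≤-refl
    seen (there s∈)    = inj₂ s∈
  sample≈solvable L p ps sorted ends (no unsolvable) = sample-none L p ps sorted (All.map (All.map seen) ends)
    (λ some → let q , _ , q∈ = find some in unsolvable (q , q∈))
    where
    seen : ∀ {s} → s ∈ (p ∷ ps) → s ≤ p ⊎ s ∈ ps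
    seen (here ≡.refl) = inj₁ ≤-refl
    seen (there s∈)    = inj₂ s∈

  private
    allEndpoints : List (ℂ.Carrier × List (Constraint ℝ)) → List ℝ
    allEndpoints = concatMap (concatMap endpoints ∘ proj₂)

    endpoints-∈ : ∀ {pts} L → (∀ {s} → s ∈ concatMap endpoints L → s ∈ pts) →
                  All (λ c → All (_∈ pts) (endpoints c)) L
    endpoints-∈ []      inc = []
    endpoints-∈ (c ∷ L) inc = All.tabulate (inc ∘ ∈-++⁺ˡ) ∷ endpoints-∈ L (inc ∘ ∈-++⁺ʳ (endpoints c))

    evaluate-sample≈solvable : ∀ f p ps → AllPairs _≤_ (p ∷ ps) → (∀ {s} → s ∈ allEndpoints f → s ∈ (p ∷ ps)) →
      evaluate (λ L → sample (λ t → indicator (in? L t)) p ps) f ℂ.≈ evaluate (indicator ∘ solvable?) f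
    evaluate-sample≈solvable []            p ps sorted inc = ℂ.refl
    evaluate-sample≈solvable ((c , L) ∷ f) p ps sorted inc = ℂ.+-cong
      (ℂ.*-congˡ {c} (sample≈solvable L p ps sorted (endpoints-∈ L (inc ∘ ∈-++⁺ˡ)) (solvable? L)))
      (evaluate-sample≈solvable f p ps sorted (inc ∘ ∈-++⁺ʳ (concatMap endpoints L)))

  solvable-linear : ∀ f → (∀ t → evaluate (λ L → indicator (in? L t)) f ℂ.≈ ℂ.0#) →
                    evaluate (indicator ∘ solvable?) f ℂ.≈ ℂ.0#
  solvable-linear f f≈0 with sort (0# ∷ allEndpoints f) | sort-↗ (0# ∷ allEndpoints f) | sort-↭ (0# ∷ allEndpoints f)
    where open Sort decTotalOrder
  ... | []     | _      | perm = contradiction (∈-resp-↭ (↭-sym perm) (here ≡.refl)) λ ()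
  ... | p ∷ ps | sorted | perm = ℂ.trans
    (ℂ.sym (evaluate-sample≈solvable f p ps (Linked⇒AllPairs ≤-trans sorted) (∈-resp-↭ (↭-sym perm) ∘ there)))
    (ℂ.trans (evaluate-sample (λ t L → indicator (in? L t)) f p ps) (sample-0 _ f≈0 p ps))

module Vectors (R : CompleteOrderedField) where
  open CompleteOrderedField R renaming (Carrier to ℝ) hiding (zero)
  open RingProperties ring using (-0#≈0#)
  open Solver commutativeRing

  infix 4 _≋_
  infixl 7 _·_

  _≋_ : ∀ {d} → Rel (Vector ℝ d) 0ℓ
  v ≋ w = ∀ i → v i ≈ w i

  _·_ : ∀ {d} → Vector ℝ d → Vector ℝ d → ℝ
  v · w = ∑ +-rawMonoid (λ i → v i * w i)

  -ᵛ_ : ∀ {d} → Vector ℝ d → Vector ℝ d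
  (-ᵛ v) i = - v i

  e : ∀ {d} → Fin d → Vector ℝ d
  e i j = if does (j Fin.≟ i) then 1# else 0#

  ·-cong : ∀ {d} {u v w x : Vector ℝ d} → u ≋ v → w ≋ x → u · w ≈ v · x
  ·-cong {zero}  p q = refl
  ·-cong {suc d} p q = +-cong (*-cong (p zero) (q zero)) (·-cong (p ∘ suc) (q ∘ suc))

  ·-zeroˡ : ∀ {d} (w : Vector ℝ d) → (λ _ → 0#) · w ≈ 0#
  ·-zeroˡ {zero}  w = refl
  ·-zeroˡ {suc d} w = trans (+-cong (zeroˡ _) (·-zeroˡ (w ∘ suc))) (+-identityʳ 0#)

  ·-scaleˡ : ∀ {d} a (v w : Vector ℝ d) → (λ i → a * v i) · w ≈ a * (v · w)
  ·-scaleˡ {zero}  a v w = sym (zeroʳ a)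
  ·-scaleˡ {suc d} a v w = trans (+-congˡ (·-scaleˡ a (v ∘ suc) (w ∘ suc)))
    (solve 4 (λ a v w s → a :* v :* w :+ a :* s := a :* (v :* w :+ s)) refl a (v zero) (w zero) _)

  ·-negˡ : ∀ {d} (v w : Vector ℝ d) → (-ᵛ v) · w ≈ - (v · w)
  ·-negˡ {zero}  v w = sym -0#≈0#
  ·-negˡ {suc d} v w = trans (+-congˡ (·-negˡ (v ∘ suc) (w ∘ suc)))
    (solve 3 (λ v w s → :- v :* w :+ :- s := :- (v :* w :+ s)) refl (v zero) (w zero) _)

  ·-subˡ : ∀ {d} (u v w : Vector ℝ d) → (λ i → u i - v i) · w ≈ u · w - v · w
  ·-subˡ {zero}  u v w = sym (-‿inverseʳ 0#)
  ·-subˡ {suc d} u v w = trans (+-congˡ (·-subˡ (u ∘ suc) (v ∘ suc) (w ∘ suc)))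
    (solve 5 (λ u v w s t → (u :- v) :* w :+ (s :- t) := (u :* w :+ s) :- (v :* w :+ t)) refl (u zero) (v zero) (w zero) _ _)

  ·-subʳ : ∀ {d} (u v w : Vector ℝ d) → u · (λ i → v i - w i) ≈ u · v - u · w
  ·-subʳ {zero}  u v w = sym (-‿inverseʳ 0#)
  ·-subʳ {suc d} u v w = trans (+-congˡ (·-subʳ (u ∘ suc) (v ∘ suc) (w ∘ suc)))
    (solve 5 (λ u v w s t → u :* (v :- w) :+ (s :- t) := (u :* v :+ s) :- (u :* w :+ t)) refl (u zero) (v zero) (w zero) _ _)

  e-· : ∀ {d} i (w : Vector ℝ d) → e i · w ≈ w i
  e-· zero    w = trans (+-cong (*-identityˡ _) (·-zeroˡ (w ∘ suc))) (+-identityʳ _)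
  e-· (suc i) w = trans (+-cong (zeroˡ _) (trans (·-cong e-suc (λ _ → refl)) (e-· i (w ∘ suc)))) (+-identityˡ _)
    where
    e-suc : e (suc i) ∘ suc ≋ e i
    e-suc j with j Fin.≟ i
    ... | yes _ = refl
    ... | no  _ = refl

module Projection (R : CompleteOrderedField) where
  open CompleteOrderedField R renaming (Carrier to ℝ) hiding (zero)
  open RingProperties ring using (-0#≈0#)
  open OrderProperties R
  open Vectors R
  open Intervals R hiding (module ℂ)
  open Elimination
  open Solver commutativeRing
  open Indicator (ℂ R)
  open Evaluation (ℂ R)
  private module ℂ = CommutativeRing (ℂ R)

  -- Affine functions of (x , z) ∈ ℝⁿ × ℝᵐ, where x is to be eliminated.
  record Affine (n m : ℕ) : Set where
    constructor affine
    field
      constant : ℝ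
      inner    : Vector ℝ n
      outer    : Vector ℝ m

  open Affine

  value : ∀ {n m} → Vector ℝ n → Vector ℝ m → Affine n m → ℝ
  value x z α = constant α + (inner α · x + outer α · z)

  _⊝_ : ∀ {n m} → Affine n m → Affine n m → Affine n m
  α ⊝ β = affine (constant α - constant β) (λ i → inner α i - inner β i) (λ i → outer α i - outer β i)

  value-⊝ : ∀ {n m} (x : Vector ℝ n) (z : Vector ℝ m) α β → value x z (α ⊝ β) ≈ value x z α - value x z β
  value-⊝ x z α β = trans (+-congˡ (+-cong (·-subˡ (inner α) (inner β) x) (·-subˡ (outer α) (outer β) z)))
    (solve 6 (λ a b c d e f → (a :- b) :+ ((c :- d) :+ (e :- f)) := (a :+ (c :+ e)) :- (b :+ (d :+ f)))
      refl (constant α) (constant β) _ _ _ _)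

  scale : ∀ {n m} → ℝ → Affine n m → Affine n m
  scale c α = affine (c * constant α) (λ i → c * inner α i) (λ i → c * outer α i)

  value-scale : ∀ {n m} (x : Vector ℝ n) (z : Vector ℝ m) c α → value x z (scale c α) ≈ c * value x z α
  value-scale x z c α = trans (+-congˡ (+-cong (·-scaleˡ c (inner α) x) (·-scaleˡ c (outer α) z)))
    (solve 4 (λ c a s t → c :* a :+ (c :* s :+ c :* t) := c :* (a :+ (s :+ t))) refl c (constant α) _ _)

  forget : ∀ {n m} → Affine (suc n) m → Affine n m
  forget α = affine (constant α) (inner α ∘ suc) (outer α)

  slope : ∀ {n m} → Affine (suc n) m → ℝ
  slope α = inner α zero

  value-split : ∀ {n m} (x : Vector ℝ (suc n)) (z : Vector ℝ m) α →
                value x z α ≈ slope α * x zero + value (x ∘ suc) z (forget α)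
  value-split x z α = solve 4 (λ b a s t → b :+ ((a :+ s) :+ t) := a :+ (b :+ (s :+ t)))
    refl (constant α) (slope α * x zero) _ _

  -- The inequality 0 ≤ α(t , x , z), solved for its first variable t.
  isolate : ∀ {n m} → Affine (suc n) m → Constraint (Affine n m)
  isolate α with slope α ≟ 0# | 0# ≤? slope α
  ... | yes _  | _     = nonNegative (forget α)
  ... | no a≉0 | yes _ = atLeast (scale (- proj₁ (inverse (slope α) a≉0)) (forget α))
  ... | no a≉0 | no _  = atMost (scale (- proj₁ (inverse (slope α) a≉0)) (forget α))

  private
    root : ∀ {n m} (x : Vector ℝ (suc n)) (z : Vector ℝ m) α y → slope α * y ≈ 1# →
           value x z α ≈ slope α * (x zero - value (x ∘ suc) z (scale (- y) (forget α)))
    root x z α y ay≈1 = begin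
      value x z α                        ≈⟨ value-split x z α ⟩
      a * t + β                          ≈⟨ +-congˡ (trans (*-congʳ ay≈1) (*-identityˡ β)) ⟨
      a * t + a * y * β                  ≈⟨ solve 4 (λ a t y β → a :* t :+ a :* y :* β := a :* (t :- :- y :* β)) refl a t y β ⟩
      a * (t - - y * β)                  ≈⟨ *-congˡ (+-congˡ (-‿cong (value-scale (x ∘ suc) z (- y) (forget α)))) ⟨
      a * (t - value (x ∘ suc) z (scale (- y) (forget α))) ∎
      where
      open SetoidReasoning setoid
      a = slope α
      t = x zero
      β = value (x ∘ suc) z (forget α)

    cancel-positive : ∀ {a y u} → a * y ≈ 1# → 0# ≤ a → 0# ≤ a * u → 0# ≤ u
    cancel-positive {a} {y} {u} ay≈1 0≤a 0≤au = ≤-respʳ-≈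
      (trans (solve 3 (λ a y u → y :* (a :* u) := a :* y :* u) refl a y u) (trans (*-congʳ ay≈1) (*-identityˡ u)))
      (*-nonNegative (inverse-nonNegative ay≈1 0≤a) 0≤au)

  module _ {n m} (x : Vector ℝ (suc n)) (z : Vector ℝ m) where

    IsolateHolds : Affine (suc n) m → Set
    IsolateHolds α = Holds (x zero) (mapConstraint (value (x ∘ suc) z) (isolate α))

    isolate-spec : ∀ α → 0# ≤ value x z α ⇔ IsolateHolds α
    isolate-spec α with slope α ≟ 0# | 0# ≤? slope α
    ... | yes a≈0 | _ = mk⇔ (≤-respʳ-≈ flat) (≤-respʳ-≈ (sym flat))
      where
      flat : value x z α ≈ value (x ∘ suc) z (forget α)
      flat = trans (value-split x z α) (trans (+-congʳ (trans (*-congʳ a≈0) (zeroˡ _))) (+-identityˡ _))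
    ... | no a≉0 | yes 0≤a = mk⇔
      (λ p → 0≤y-x⇒x≤y (cancel-positive ay≈1 0≤a (≤-respʳ-≈ (root x z α _ ay≈1) p)))
      (λ p → ≤-respʳ-≈ (sym (root x z α _ ay≈1)) (*-nonNegative 0≤a (x≤y⇒0≤y-x p)))
      where ay≈1 = proj₂ (inverse (slope α) a≉0)
    ... | no a≉0 | no 0≰a = mk⇔
      (λ p → 0≤y-x⇒x≤y (cancel-positive (trans (solve 2 (λ a y → :- a :* :- y := a :* y) refl _ _) ay≈1) 0≤-a
               (≤-respʳ-≈ (trans (root x z α _ ay≈1) flip) p)))
      (λ p → ≤-respʳ-≈ (sym (trans (root x z α _ ay≈1) flip)) (*-nonNegative 0≤-a (x≤y⇒0≤y-x p)))
      where
      ay≈1 = proj₂ (inverse (slope α) a≉0)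
      0≤-a = x≤0⇒0≤-x (≰⇒≥ 0≰a)

      flip : ∀ {a t s} → a * (t - s) ≈ - a * (s - t)
      flip {a} {t} {s} = solve 3 (λ a t s → a :* (t :- s) := :- a :* (s :- t)) refl a t s

  Satisfies : ∀ {n m} → List (Affine n m) → Vector ℝ n → Vector ℝ m → Set
  Satisfies S x z = All (λ α → 0# ≤ value x z α) S

  satisfies? : ∀ {n m} (S : List (Affine n m)) x z → Dec (Satisfies S x z)
  satisfies? S x z = All.all? (λ α → 0# ≤? value x z α) S

  project₁ : ∀ {n m} → List (Affine (suc n) m) → List (Affine n m)
  project₁ S = eliminate _⊝_ (map isolate S)

  module _ {n m} (x : Vector ℝ n) (z : Vector ℝ m) where

    fibre : List (Affine (suc n) m) → List (Constraint ℝ)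
    fibre S = map (mapConstraint (value x z) ∘ isolate) S

    private
      combine-value : ∀ c c′ →
        All (λ α → 0# ≤ value x z α) (combine _⊝_ c c′) ⇔
        Compatible (mapConstraint (value x z) c) (mapConstraint (value x z) c′)
      combine-value (atMost α)  (atMost β)      = mk⇔ (λ _ → []) (λ _ → [])
      combine-value (atMost α)  (atLeast β)     = mk⇔ (λ { (p ∷ []) → ≤-respʳ-≈ (value-⊝ x z α β) p ∷ [] })
                                                      (λ { (p ∷ []) → ≤-respʳ-≈ (sym (value-⊝ x z α β)) p ∷ [] })
      combine-value (atMost α)  (nonNegative β) = mk⇔ (λ _ → []) (λ _ → [])
      combine-value (atLeast α) _               = mk⇔ (λ _ → []) (λ _ → [])
      combine-value (nonNegative α) _           = mk⇔ (λ { (p ∷ []) → p ∷ [] }) (λ { (p ∷ []) → p ∷ [] })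

      module C c c′ = Equivalence (combine-value c c′)

    in-fibre : ∀ S t → In (fibre S) t ⇔ Satisfies S (t Vector.∷ x) z
    in-fibre S t = mk⇔
      (All.map (λ {α} → Equivalence.from (isolate-spec (t Vector.∷ x) z α)) ∘ All.map⁻)
      (All.map⁺ ∘ All.map (λ {α} → Equivalence.to (isolate-spec (t Vector.∷ x) z α)))

    project₁-spec : ∀ S → Satisfies (project₁ S) x z ⇔ ∃ λ t → Satisfies S (t Vector.∷ x) z
    project₁-spec S = mk⇔
      (λ p → let t , t∈ = compatible⇒solvable (fibre S) (All.map⁺ (All.map
                   (λ {α} → All.map⁺ ∘ All.map (λ {β} → C.to (isolate α) (isolate β)) ∘ All.map⁻)
                   (All.map⁻ (eliminate⁻ _⊝_ (map isolate S) p))))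
             in t , Equivalence.to (in-fibre S t) t∈)
      (λ (t , p) → eliminate⁺ _⊝_ (map isolate S) (All.map⁺ (All.map
        (λ {α} → All.map⁺ ∘ All.map (λ {β} → C.from (isolate α) (isolate β)) ∘ All.map⁻)
        (All.map⁻ (solvable⇒compatible (fibre S) (t , Equivalence.from (in-fibre S t) p))))))

    -- A linear relation between indicator functions survives taking images under
    -- a coordinate projection: on each fibre, the Euler characteristic of a
    -- nonempty closed interval is 1.
    project₁-linear : ∀ f → (∀ t → evaluate (λ S → indicator (satisfies? S (t Vector.∷ x) z)) f ℂ.≈ ℂ.0#) →
                      evaluate (λ S → indicator (satisfies? (project₁ S) x z)) f ℂ.≈ ℂ.0#
    project₁-linear f f≈0 = ℂ.trans (evaluate-cong agree f) (ℂ.trans (ℂ.sym (evaluate-map _ fibre f))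
      (solvable-linear (map (λ (c , S) → c , fibre S) f) λ t → ℂ.trans (evaluate-map _ fibre f)
        (ℂ.trans (evaluate-cong (λ S → indicator-cong (in? (fibre S) t) (satisfies? S (t Vector.∷ x) z)
                                         (Equivalence.to (in-fibre S t)) (Equivalence.from (in-fibre S t))) f)
                 (f≈0 t))))
      where
      agree : ∀ S → indicator (satisfies? (project₁ S) x z) ℂ.≈ indicator (solvable? (fibre S))
      agree S = indicator-cong (satisfies? (project₁ S) x z) (solvable? (fibre S))
        (λ p → let t , q = Equivalence.to (project₁-spec S) p in t , Equivalence.from (in-fibre S t) q)
        (λ (t , t∈) → Equivalence.from (project₁-spec S) (t , Equivalence.to (in-fibre S t) t∈))

  project : ∀ n {m} → List (Affine n m) → List (Affine 0 m)
  project zero    S = S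
  project (suc n) S = project n (project₁ S)

  module _ {m} (z : Vector ℝ m) where

    project-spec : ∀ n S → Satisfies (project n S) (λ ()) z ⇔ ∃ λ x → Satisfies S x z
    project-spec zero    S = mk⇔ (λ p → (λ ()) , p) proj₂
    project-spec (suc n) S = mk⇔
      (λ p → let x , q = Equivalence.to (project-spec n (project₁ S)) p
                 t , r = Equivalence.to (project₁-spec x z S) q
             in t Vector.∷ x , r)
      (λ (x , p) → Equivalence.from (project-spec n (project₁ S))
        (x ∘ suc , Equivalence.from (project₁-spec (x ∘ suc) z S) (x zero , p)))

    project-linear : ∀ n f → (∀ x → evaluate (λ S → indicator (satisfies? S x z)) f ℂ.≈ ℂ.0#) →
                     evaluate (λ S → indicator (satisfies? (project n S) (λ ()) z)) f ℂ.≈ ℂ.0#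
    project-linear zero    f f≈0 = f≈0 (λ ())
    project-linear (suc n) f f≈0 = ℂ.trans (ℂ.sym (evaluate-map _ project₁ f))
      (project-linear n (map (λ (c , S) → c , project₁ S) f) λ x → ℂ.trans (evaluate-map _ project₁ f)
        (project₁-linear x z f (λ t → f≈0 (t Vector.∷ x))))

module MinkowskiRing (R : CompleteOrderedField) where
  open CompleteOrderedField R renaming (Carrier to ℝ) hiding (zero)
  open OrderProperties R
  open Vectors R
  open Projection R
  open Solver commutativeRing
  open Indicator (ℂ R)
  private module ℂ = CommutativeRing (ℂ R)

  record HalfSpace (d : ℕ) : Set where
    constructor halfSpace
    field
      normal : Vector ℝ d
      offset : ℝ

  open HalfSpace

  _∈ᴴ_ : ∀ {d} → Vector ℝ d → HalfSpace d → Set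
  w ∈ᴴ H = normal H · w ≤ offset H

  -- A set together with a presentation of it as a finite intersection of closed
  -- half-spaces; the empty set is included, which only adds [∅] = 0 below.
  record Polyhedron (d : ℕ) : Set₁ where
    field
      points     : Pred (Vector ℝ d) 0ℓ
      halfSpaces : List (HalfSpace d)
      described  : points ≐ λ w → All (w ∈ᴴ_) halfSpaces

  open Polyhedron public

  module _ {d} (P : Polyhedron d) where

    member? : ∀ w → Dec (points P w)
    member? w = map′ (proj₂ (described P)) (proj₁ (described P)) (All.all? (λ H → normal H · w ≤? offset H) (halfSpaces P))

    points-resp : ∀ {v w} → v ≋ w → points P v → points P w
    points-resp v≋w p = proj₂ (described P)
      (All.map (λ {H} → ≤-respˡ-≈ (·-cong {u = normal H} (λ _ → refl) v≋w)) (proj₁ (described P) p))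

    χ : Vector ℝ d → ℂ.Carrier
    χ w = indicator (member? w)

  InBox : ∀ {d} → Vector ℝ d → Vector ℝ d → Pred (Vector ℝ d) 0ℓ
  InBox a b w = ∀ i → a i ≤ w i × w i ≤ b i

  box : ∀ {d} → Vector ℝ d → Vector ℝ d → Polyhedron d
  box {d} a b = record
    { points     = InBox a b
    ; halfSpaces = concatMap sides (allFin d)
    ; described  =
        (λ p → All.concat⁺ (All.map⁺ {xs = allFin d} (All.tabulate λ {i} _ → to i (p i)))) ,
        (λ q i → from i (All.lookup (All.map⁻ {f = sides} (All.concat⁻ {xss = map sides (allFin d)} q)) (∈-allFin i))) }
    where
    sides : Fin d → List (HalfSpace d)
    sides i = halfSpace (-ᵛ e i) (- a i) ∷ halfSpace (e i) (b i) ∷ []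

    lower : ∀ i w → (-ᵛ e i) · w ≈ - w i
    lower i w = trans (·-negˡ (e i) w) (-‿cong (e-· i w))

    to : ∀ i {w} → a i ≤ w i × w i ≤ b i → All (w ∈ᴴ_) (sides i)
    to i {w} (a≤w , w≤b) = ≤-respˡ-≈ (sym (lower i w)) (neg-antimono a≤w) ∷ ≤-respˡ-≈ (sym (e-· i w)) w≤b ∷ []

    from : ∀ i {w} → All (w ∈ᴴ_) (sides i) → a i ≤ w i × w i ≤ b i
    from i {w} (p ∷ q ∷ []) =
      ≤-by (solve 2 (λ w a → :- a :- :- w := w :- a) refl (w i) (a i)) (≤-respˡ-≈ (lower i w) p) ,
      ≤-respˡ-≈ (e-· i w) q

  withPoints : ∀ {d} (P : Polyhedron d) (S : Pred (Vector ℝ d) 0ℓ) → S ≐ points P → Polyhedron d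
  withPoints P S (S⊆P , P⊆S) = record
    { points     = S
    ; halfSpaces = halfSpaces P
    ; described  = (λ s → proj₁ (described P) (S⊆P s)) , (λ h → P⊆S (proj₂ (described P) h)) }

  singleton : ∀ {d} → Vector ℝ d → Polyhedron d
  singleton v = withPoints (box v v) (_≋ v)
    ((λ w≋v i → ≤-reflexive (sym (w≋v i)) , ≤-reflexive (w≋v i)) , (λ p i → antisym (proj₂ (p i)) (proj₁ (p i))))

  origin : ∀ {d} → Vector ℝ d
  origin _ = 0#

  π : ∀ {d} → Fin d → Vector ℝ d → Vector ℝ d
  π i x j = x i * e i j

  UnitCube : ∀ d → Pred (Vector ℝ d) 0ℓ
  UnitCube d = InBox (λ _ → 0#) (λ _ → 1#)

  projectedCube : ∀ {d} → Fin d → Polyhedron d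
  projectedCube {d} i = withPoints (box origin (e i)) (λ w → ∃ λ x → UnitCube d x × w ≋ π i x) (to , from)
    where
    e-bounds : ∀ j → 0# ≤ e i j × e i j ≤ 1#
    e-bounds j with j Fin.≟ i
    ... | yes _ = 0≤1 , ≤-refl
    ... | no  _ = ≤-refl , 0≤1

    to : ∀ {w} → (∃ λ x → UnitCube d x × w ≋ π i x) → InBox origin (e i) w
    to (x , cube , w≋πx) j =
      ≤-respʳ-≈ (sym (w≋πx j)) (*-nonNegative (proj₁ (cube i)) 0≤e) ,
      ≤-respects (trans (*-comm _ _) (sym (w≋πx j))) (*-identityʳ _) (*-monoˡ-≤ 0≤e (proj₂ (cube i)))
      where 0≤e = proj₁ (e-bounds j)

    from : ∀ {w} → InBox origin (e i) w → ∃ λ x → UnitCube d x × w ≋ π i x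
    from {w} p = w , (λ j → proj₁ (p j) , ≤-trans (proj₂ (p j)) (proj₂ (e-bounds j))) , on
      where
      on : ∀ j → w j ≈ w i * e i j
      on j with j Fin.≟ i | proj₂ (p j)
      ... | yes ≡.refl | _    = sym (*-identityʳ _)
      ... | no  _      | w≤0  = trans (antisym w≤0 (proj₁ (p j))) (sym (zeroʳ _))

  private
    minkowskiSystem : ∀ {d} → Polyhedron d → Polyhedron d → List (Affine d d)
    minkowskiSystem {d} A B = map first (halfSpaces A) ++ map second (halfSpaces B)
      where
      first second : HalfSpace d → Affine d d
      first  H = affine (offset H) (-ᵛ normal H) (λ _ → 0#)
      second H = affine (offset H) (normal H) (-ᵛ normal H)

    _-ᵛ_ : ∀ {d} → Vector ℝ d → Vector ℝ d → Vector ℝ d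
    (z -ᵛ x) i = z i - x i

    minkowskiSystem-spec : ∀ {d} (A B : Polyhedron d) x z →
      Satisfies (minkowskiSystem A B) x z ⇔ (points A x × points B (z -ᵛ x))
    minkowskiSystem-spec A B x z = mk⇔
      (λ p → let q , r = All.++⁻ (map _ (halfSpaces A)) p in
             proj₂ (described A) (All.map (λ {H} s → 0≤y-x⇒x≤y (≤-respʳ-≈ (first H) s)) (All.map⁻ q)) ,
             proj₂ (described B) (All.map (λ {H} s → 0≤y-x⇒x≤y (≤-respʳ-≈ (second H) s)) (All.map⁻ r)))
      (λ (q , r) → All.++⁺
        (All.map⁺ (All.map (λ {H} s → ≤-respʳ-≈ (sym (first H)) (x≤y⇒0≤y-x s)) (proj₁ (described A) q)))
        (All.map⁺ (All.map (λ {H} s → ≤-respʳ-≈ (sym (second H)) (x≤y⇒0≤y-x s)) (proj₁ (described B) r))))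
      where
      first : ∀ H → offset H + ((-ᵛ normal H) · x + (λ _ → 0#) · z) ≈ offset H - normal H · x
      first H = +-congˡ (trans (+-cong (·-negˡ (normal H) x) (·-zeroˡ z)) (+-identityʳ _))

      second : ∀ H → offset H + (normal H · x + (-ᵛ normal H) · z) ≈ offset H - normal H · (z -ᵛ x)
      second H = +-congˡ (trans (+-congˡ (·-negˡ (normal H) z))
        (trans (solve 2 (λ s t → s :+ :- t := :- (t :- s)) refl (normal H · x) (normal H · z))
               (-‿cong (sym (·-subʳ (normal H) z x)))))

    toHalfSpace : ∀ {d} → Affine 0 d → HalfSpace d
    toHalfSpace (affine c _ o) = halfSpace (-ᵛ o) c

    toHalfSpace-spec : ∀ {d} (z : Vector ℝ d) α → 0# ≤ value (λ ()) z α ⇔ z ∈ᴴ toHalfSpace α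
    toHalfSpace-spec z (affine c _ o) = mk⇔
      (λ p → 0≤y-x⇒x≤y (≤-respʳ-≈ eq p)) (λ p → ≤-respʳ-≈ (sym eq) (x≤y⇒0≤y-x p))
      where
      eq : c + (0# + o · z) ≈ c - (-ᵛ o) · z
      eq = +-congˡ (trans (+-identityˡ _) (trans (solve 1 (λ s → s := :- :- s) refl (o · z)) (-‿cong (sym (·-negˡ o z)))))

  MinkowskiSum : ∀ {d} → Pred (Vector ℝ d) 0ℓ → Pred (Vector ℝ d) 0ℓ → Pred (Vector ℝ d) 0ℓ
  MinkowskiSum A B z = ∃₂ λ a b → A a × B b × z ≋ (λ i → a i + b i)

  private
    system⇔sum : ∀ {d} (A B : Polyhedron d) z →
      (∃ λ x → Satisfies (minkowskiSystem A B) x z) ⇔ MinkowskiSum (points A) (points B) z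
    system⇔sum A B z = mk⇔
      (λ (x , p) → let a∈ , b∈ = Equivalence.to (minkowskiSystem-spec A B x z) p in
        x , (z -ᵛ x) , a∈ , b∈ , λ i → solve 2 (λ z x → z := x :+ (z :- x)) refl (z i) (x i))
      (λ (a , b , a∈ , b∈ , z≋) → a , Equivalence.from (minkowskiSystem-spec A B a z)
        (a∈ , points-resp B (λ i → trans (solve 2 (λ a b → b := a :+ b :- a) refl (a i) (b i)) (+-congʳ (sym (z≋ i)))) b∈))

  infixl 6 _⊕_

  _⊕_ : ∀ {d} → Polyhedron d → Polyhedron d → Polyhedron d
  _⊕_ {d} A B = record
    { points     = MinkowskiSum (points A) (points B)
    ; halfSpaces = map toHalfSpace S
    ; described  =
        (λ {z} p → All.map⁺ (All.map (λ {α} → Equivalence.to (toHalfSpace-spec z α))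
          (Equivalence.from (project-spec z d (minkowskiSystem A B)) (Equivalence.from (system⇔sum A B z) p)))) ,
        (λ {z} q → Equivalence.to (system⇔sum A B z) (Equivalence.to (project-spec z d (minkowskiSystem A B))
          (All.map (λ {α} → Equivalence.from (toHalfSpace-spec z α)) (All.map⁻ q)))) }
    where
    S : List (Affine 0 d)
    S = project d (minkowskiSystem A B)

  module _ (d : ℕ) where
    open FormalSums (ℂ R) (_⊕_ {d}) (singleton origin)

    private
      χ-cong : ∀ (A B : Polyhedron d) w → (points A w → points B w) → (points B w → points A w) → χ A w ℂ.≈ χ B w
      χ-cong A B w = indicator-cong (member? A w) (member? B w)

      χ-shift : ∀ f B → (∀ w → evaluate (λ A → χ A w) f ℂ.≈ ℂ.0#) → ∀ z → evaluate (λ A → χ (A ⊕ B) z) f ℂ.≈ ℂ.0#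
      χ-shift f B f≈0 z = ℂ.trans (evaluate-cong projected f)
        (ℂ.trans (ℂ.sym (evaluate-map _ (λ A → minkowskiSystem A B) f))
          (project-linear z d (map (λ (c , A) → c , minkowskiSystem A B) f) λ x →
            ℂ.trans (evaluate-map _ (λ A → minkowskiSystem A B) f)
              (ℂ.trans (evaluate-cong (factor x) f)
                (ℂ.trans (evaluate-* _ (λ A → χ A x) f)
                  (ℂ.trans (ℂ.*-congˡ {χ B (z -ᵛ x)} (f≈0 x)) (ℂ.zeroʳ (χ B (z -ᵛ x))))))))
        where
        projected : ∀ A → χ (A ⊕ B) z ℂ.≈ indicator (satisfies? (project d (minkowskiSystem A B)) (λ ()) z)
        projected A = indicator-cong (member? (A ⊕ B) z) (satisfies? (project d (minkowskiSystem A B)) (λ ()) z)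
          (λ p → Equivalence.from (project-spec z d (minkowskiSystem A B)) (Equivalence.from (system⇔sum A B z) p))
          (λ p → Equivalence.to (system⇔sum A B z) (Equivalence.to (project-spec z d (minkowskiSystem A B)) p))

        factor : ∀ x A → indicator (satisfies? (minkowskiSystem A B) x z) ℂ.≈ χ B (z -ᵛ x) ℂ.* χ A x
        factor x A = ℂ.trans
          (indicator-× (member? A x) (member? B (z -ᵛ x)) (satisfies? (minkowskiSystem A B) x z)
            (Equivalence.to (minkowskiSystem-spec A B x z)) (Equivalence.from (minkowskiSystem-spec A B x z)))
          (ℂ.*-comm (χ A x) (χ B (z -ᵛ x)))

    -- An element is a finite sum Σ cᵢ[Pᵢ], and two elements are equal when they
    -- are equal as functions w ↦ Σ cᵢ[Pᵢ](w).  That [A]·[B] = [A ⊕ B] respects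
    -- this equality is χ-shift.
    M𝓟 : Algebra (ℂ R) (lsuc 0ℓ) 0ℓ
    M𝓟 = IsAlgebraCongruence.algebra {_~_ = SameValues (λ w A → χ A w)} (sameValues-isAlgebraCongruence _
      (λ w A B C → χ-cong ((A ⊕ B) ⊕ C) (A ⊕ (B ⊕ C)) w
        (λ (u , c , (a , b , a∈ , b∈ , u≋) , c∈ , w≋) →
          a , _ , a∈ , (b , c , b∈ , c∈ , λ _ → refl) , λ i → trans (w≋ i) (trans (+-congʳ (u≋ i)) (+-assoc _ _ _)))
        (λ (a , u , a∈ , (b , c , b∈ , c∈ , u≋) , w≋) →
          _ , c , (a , b , a∈ , b∈ , λ _ → refl) , c∈ , λ i → trans (w≋ i) (trans (+-congˡ (u≋ i)) (sym (+-assoc _ _ _)))))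
      (λ w A B → χ-cong (A ⊕ B) (B ⊕ A) w
        (λ (a , b , a∈ , b∈ , w≋) → b , a , b∈ , a∈ , λ i → trans (w≋ i) (+-comm _ _))
        (λ (b , a , b∈ , a∈ , w≋) → a , b , a∈ , b∈ , λ i → trans (w≋ i) (+-comm _ _)))
      (λ w A → χ-cong (singleton origin ⊕ A) A w
        (λ (o , a , o≋0 , a∈ , w≋) → points-resp A (λ i → sym (trans (w≋ i) (trans (+-congʳ (o≋0 i)) (+-identityˡ _)))) a∈)
        (λ a∈ → origin , w , (λ _ → refl) , a∈ , λ _ → sym (+-identityˡ _)))
      χ-shift)

  [_] : ∀ {d} → Polyhedron d → Algebra.Carrier (M𝓟 d)
  [ P ] = (ℂ.1# , P) ∷ []

  Generators : ∀ {d ℓ} → Pred (Polyhedron d) ℓ → Pred (Algebra.Carrier (M𝓟 d)) (lsuc 0ℓ ⊔ ℓ)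
  Generators 𝒟 f = ∃ λ P → 𝒟 P × f ≡ [ P ]

  M : ∀ {d ℓ} → Pred (Polyhedron d) ℓ → Algebra (ℂ R) (lsuc 0ℓ ⊔ ℓ) 0ℓ
  M {d} 𝒟 = subalgebra (M𝓟 d) (Generators 𝒟)

  _∈M_ : ∀ {d ℓ} → Algebra.Carrier (M𝓟 d) → Pred (Polyhedron d) ℓ → Set (lsuc 0ℓ ⊔ ℓ)
  f ∈M 𝒟 = Generated (M𝓟 _) (Generators 𝒟) f

  finite : ∀ {d} → List (Polyhedron d) → Pred (Polyhedron d) (lsuc 0ℓ)
  finite Ps P = Any (λ Q → points P ≐ points Q) Ps

  𝓑⁺ : ∀ d → Pred (Polyhedron d) 0ℓ
  𝓑⁺ d P = ∃₂ λ (a b : Vector ℕ d) → (∀ i → a i ℕ.≤ b i) × points P ≐ InBox (fromℕ ∘ a) (fromℕ ∘ b)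

  module BoxPresentation (d : ℕ) where
    ℂ[x,y] : Algebra (ℂ R) 0ℓ 0ℓ
    ℂ[x,y] = polynomials (ℂ R) (d ℕ.+ d)

    open Algebra ℂ[x,y] using () renaming (Carrier to Polynomial; _-_ to _∸_; _*_ to _∙_; 1# to one)

    x y : Fin d → Polynomial
    x i = var (ℂ R) (d ℕ.+ d) (i Fin.↑ˡ d)
    y i = var (ℂ R) (d ℕ.+ d) (d Fin.↑ʳ i)

    relation : Fin d → Polynomial
    relation i = (y i ∸ one) ∙ (y i ∸ x i)

{-# OPTIONS --safe #-}

-- A monomial x^α y^β goes to the box ∏ [αᵢ , αᵢ + βᵢ], both in M(𝓑⁺ d) (the map φ) and,
-- factor by factor, in a tensor power of the one-dimensional ring (the map ψ).  Both
-- maps are surjective, and the kernels coincide because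
--
--   (relations) ⊆ ker ψ ⊆ ker φ ⊆ (relations).
--
-- The first inclusion is [0,2] + [{1}] = [0,1] + [1,2] in one variable.  The second
-- holds since the value of a box at w is the product of the values of its sides at wᵢ,
-- which is a functional on the tensor power.  For the third, modulo the relations every
-- polynomial is a combination of monomials with all βᵢ ≤ 1; the corresponding boxes
-- have points and unit intervals as sides, and their indicators are linearly
-- independent because products of one-dimensional combinations of point evaluations at
-- integers and half-integers are dual to them.
module Submission where

open import Defs
open import Algebra.Bundles using (CommutativeRing)
open import Algebra.Morphism.Structures using (IsRingHomomorphism)
import Algebra.Properties.CommutativeMonoid.Sum as Sum
open import Algebra.Properties.CommutativeSemigroup using (interchange)
import Algebra.Properties.Ring as RingProperties
open import Data.Fin.Base as Fin using (Fin; zero; suc; punchIn)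
import Data.Fin.Properties as Fin
open import Data.List.Base using (List; []; _∷_; _++_; map; filter; length)
import Data.List.Properties as List
open import Data.List.Relation.Unary.All as All using (All; []; _∷_)
import Data.List.Relation.Unary.All.Properties as All
open import Data.List.Relation.Unary.Any using (here; there)
open import Data.Nat.Base as ℕ using (ℕ; zero; suc; _≤_; z≤n; s≤s)
import Data.Nat.Properties as ℕ
open import Data.Product.Base using (_×_; _,_; proj₁; proj₂; ∃; ∃₂; Σ-syntax)
open import Data.Sum.Base using (inj₁; inj₂)
open import Data.Vec.Base as Vec using (Vec; []; _∷_)
open import Data.Vec.Functional as Vector using (Vector)
import Data.Vec.Properties as Vec
open import Function.Base using (_∘_)
open import Function.Bundles using (_⇔_; mk⇔)
open import Function.Definitions using (Surjective)
open import Level using (0ℓ; _⊔_) renaming (suc to lsuc)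
open import Relation.Binary.PropositionalEquality as ≡ using (_≡_; _≢_)
open import Relation.Nullary using (¬_; Dec; yes; no; contradiction)
open import Relation.Nullary.Decidable using (_×-dec_; ¬?)
open import Relation.Unary using (Pred; _≐_; _⊆_)
open import Relation.Unary.Properties using (≐-refl; ≐-sym; ≐-trans)

-- Opened without arguments: applying a module copies its definitions, and to identify
-- two copies of an algebra Agda would compare all of their fields.
open MinkowskiRing using () renaming (M to MRing; M𝓟 to M𝓟Ring; 𝓑⁺ to Boxes)
open MinkowskiRing.BoxPresentation using () renaming (ℂ[x,y] to BoxPolynomials; relation to boxRelation)

-- The two target rings are good at opposite tasks. In a tensor power each relation concerns a
-- single factor, so it is easy to verify, but equality is an inductively generated congruence, so
-- inequality is hard to see. In M(𝓑⁺ d) equality is equality of functions, so elements are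
-- separated by points. The meeting ground is the vanishing of all values `cellSum w p`, stated
-- without either ring; the circle of inclusions then gives every kernel at once, with no basis and
-- no universal property of the tensor product. All isomorphisms come from one principle: two
-- surjections with the same kernel have isomorphic targets.
--
-- Half-integers are unavoidable among the test points: at integers [0,1] takes the same values as
-- {0} together with {1}. The bound βᵢ ≤ 1 is where the relation stops applying, since it rewrites
-- yᵢ².

-- Algebra homomorphisms, their kernels and images.

module _ {K : CommutativeRing 0ℓ 0ℓ} {a₁ ℓ₁ a₂ ℓ₂} (A : Algebra K a₁ ℓ₁) (B : Algebra K a₂ ℓ₂) where
  private
    module K = CommutativeRing K
    module A = Algebra A
    module B = Algebra B
  open RingProperties B.ring using (+-inverseˡ-unique)

  -- 0 and 1 are scalars, so compatibility with `ι` preserves them; negation follows because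
  -- additive inverses are unique.
  algebraHom : (f : A.Carrier → B.Carrier) →
    (∀ {x y} → x A.≈ y → f x B.≈ f y) →
    (∀ x y → f (x A.+ y) B.≈ f x B.+ f y) →
    (∀ x y → f (x A.* y) B.≈ f x B.* f y) →
    (∀ k → f (A.ι k) B.≈ B.ι k) → AlgebraHom A B
  algebraHom f f-cong f-+ f-* f-ι = record
    { ⟦_⟧ = f
    ; isRingHomomorphism = record
      { isSemiringHomomorphism = record
        { isNearSemiringHomomorphism = record
          { +-isMonoidHomomorphism = record
            { isMagmaHomomorphism = record { isRelHomomorphism = record { cong = f-cong } ; homo = f-+ }
            ; ε-homo = f-0 }
          ; *-homo = f-* }
        ; 1#-homo = B.trans (f-cong (A.sym A.ι-1#)) (B.trans (f-ι _) B.ι-1#) }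
      ; -‿homo = λ x → +-inverseˡ-unique _ _
          (B.trans (B.sym (f-+ (A.- x) x)) (B.trans (f-cong (A.-‿inverseˡ x)) f-0)) }
    ; ι-compatible = f-ι }
    where
    f-0 : f A.0# B.≈ B.0#
    f-0 = B.trans (f-cong (A.sym A.ι-0#)) (B.trans (f-ι K.0#) B.ι-0#)

module Hom {K : CommutativeRing 0ℓ 0ℓ} {a₁ ℓ₁ a₂ ℓ₂} {A : Algebra K a₁ ℓ₁} {B : Algebra K a₂ ℓ₂}
           (φ : AlgebraHom A B) where
  private
    module K = CommutativeRing K
    module A = Algebra A
    module B = Algebra B
  open AlgebraHom φ public
  open IsRingHomomorphism isRingHomomorphism public
    using (+-homo; *-homo; 0#-homo; 1#-homo; -‿homo) renaming (⟦⟧-cong to cong)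

  -‿homo₂ : ∀ x y → ⟦ x A.- y ⟧ B.≈ ⟦ x ⟧ B.- ⟦ y ⟧
  -‿homo₂ x y = B.trans (+-homo x (A.- y)) (B.+-congˡ (-‿homo y))

  -- Used for ψ and for the inclusions of the tensor factors, to move a relation of the polynomial
  -- ring into one factor.
  relation-homo : ∀ x y → ⟦ (y A.- A.1#) A.* (y A.- x) ⟧ B.≈ (⟦ y ⟧ B.- B.1#) B.* (⟦ y ⟧ B.- ⟦ x ⟧)
  relation-homo x y = B.trans (*-homo _ _) (B.*-cong
    (B.trans (-‿homo₂ y A.1#) (B.+-congˡ (B.-‿cong 1#-homo))) (-‿homo₂ y x))

  Kernel : Pred A.Carrier ℓ₂
  Kernel x = ⟦ x ⟧ B.≈ B.0#

  Image : Pred B.Carrier (a₁ ⊔ ℓ₂)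
  Image y = ∃ λ x → ⟦ x ⟧ B.≈ y

  image-resp : ∀ {y z} → y B.≈ z → Image y → Image z
  image-resp y≈z (x , p) = x , B.trans p y≈z

  image-ι : ∀ k → Image (B.ι k)
  image-ι k = A.ι k , ι-compatible k

  image-+ : ∀ {y z} → Image y → Image z → Image (y B.+ z)
  image-+ (u , p) (v , q) = u A.+ v , B.trans (+-homo u v) (B.+-cong p q)

  image-* : ∀ {y z} → Image y → Image z → Image (y B.* z)
  image-* (u , p) (v , q) = u A.* v , B.trans (*-homo u v) (B.*-cong p q)

  surjective : (∀ y → Image y) → Surjective A._≈_ B._≈_ ⟦_⟧
  surjective image y = let x , p = image y in x , λ z≈x → B.trans (cong z≈x) p

  ideal⊆kernel : ∀ {n} (g : Fin n → A.Carrier) → (∀ i → Kernel (g i)) → Ideal A g ⊆ Kernel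
  ideal⊆kernel g g≈0 (gen i)      = g≈0 i
  ideal⊆kernel g g≈0 null         = 0#-homo
  ideal⊆kernel g g≈0 (add p q)    = B.trans (+-homo _ _)
    (B.trans (B.+-cong (ideal⊆kernel g g≈0 p) (ideal⊆kernel g g≈0 q)) (B.+-identityˡ B.0#))
  ideal⊆kernel g g≈0 (mul x p)    = B.trans (*-homo _ _)
    (B.trans (B.*-congˡ (ideal⊆kernel g g≈0 p)) (B.zeroʳ _))
  ideal⊆kernel g g≈0 (resp x≈y p) = B.trans (cong (A.sym x≈y)) (ideal⊆kernel g g≈0 p)

module _ {K : CommutativeRing 0ℓ 0ℓ} {a₁ ℓ₁ a₂ ℓ₂ a₃ ℓ₃}
         {A : Algebra K a₁ ℓ₁} {B : Algebra K a₂ ℓ₂} {C : Algebra K a₃ ℓ₃}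
         (φ : AlgebraHom A B) (ψ : AlgebraHom A C) where
  private
    module A = Algebra A
    module B = Algebra B
    module C = Algebra C
    module φ = Hom φ
    module ψ = Hom ψ
    module Bᵣ = RingProperties B.ring
    module Cᵣ = RingProperties C.ring

  -- Both targets are the quotient of `A` by `I`. The map applies ψ to a chosen φ-preimage;
  -- `transfer` and `reflect` say that φ and ψ identify the same elements, as differences pass
  -- through `I`, so the choice is immaterial.
  commonKernel⇒≅ : ∀ {p} (I : Pred A.Carrier p) → (∀ y → φ.Image y) → (∀ z → ψ.Image z) →
                   φ.Kernel ≐ I → ψ.Kernel ≐ I → B ≅ C
  commonKernel⇒≅ I φ-image ψ-image (φ⊆I , I⊆φ) (ψ⊆I , I⊆ψ) = record
    { hom = hom
    ; isRingIsomorphism = record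
      { isRingMonomorphism = record
        { isRingHomomorphism = AlgebraHom.isRingHomomorphism hom
        ; injective = λ {y} {z} p → B.trans (B.sym (lifts y)) (B.trans (reflect p) (lifts z)) }
      ; surjective = λ z → let x , p = ψ-image z in
          φ.⟦ x ⟧ , λ {y} y≈ → C.trans (transfer (B.trans (lifts y) y≈)) p } }
    where
    choose : B.Carrier → A.Carrier
    choose y = proj₁ (φ-image y)

    lifts : ∀ y → φ.⟦ choose y ⟧ B.≈ y
    lifts y = proj₂ (φ-image y)

    transfer : ∀ {x x′} → φ.⟦ x ⟧ B.≈ φ.⟦ x′ ⟧ → ψ.⟦ x ⟧ C.≈ ψ.⟦ x′ ⟧
    transfer {x} {x′} p = Cᵣ.x∙y⁻¹≈ε⇒x≈y _ _ (C.trans (C.sym (ψ.-‿homo₂ x x′))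
      (I⊆ψ (φ⊆I (B.trans (φ.-‿homo₂ x x′) (Bᵣ.x≈y⇒x∙y⁻¹≈ε p)))))

    reflect : ∀ {x x′} → ψ.⟦ x ⟧ C.≈ ψ.⟦ x′ ⟧ → φ.⟦ x ⟧ B.≈ φ.⟦ x′ ⟧
    reflect {x} {x′} p = Bᵣ.x∙y⁻¹≈ε⇒x≈y _ _ (B.trans (B.sym (φ.-‿homo₂ x x′))
      (I⊆φ (ψ⊆I (C.trans (ψ.-‿homo₂ x x′) (Cᵣ.x≈y⇒x∙y⁻¹≈ε p)))))

    hom : AlgebraHom B C
    hom = algebraHom B C (λ y → ψ.⟦ choose y ⟧)
      (λ p → transfer (B.trans (lifts _) (B.trans p (B.sym (lifts _)))))
      (λ x y → C.trans (transfer (B.trans (lifts _) (B.sym (B.trans (φ.+-homo _ _) (B.+-cong (lifts x) (lifts y))))))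
                       (ψ.+-homo _ _))
      (λ x y → C.trans (transfer (B.trans (lifts _) (B.sym (B.trans (φ.*-homo _ _) (B.*-cong (lifts x) (lifts y))))))
                       (ψ.*-homo _ _))
      (λ k → C.trans (transfer (B.trans (lifts _) (B.sym (φ.ι-compatible k)))) (ψ.ι-compatible k))

module _ {K : CommutativeRing 0ℓ 0ℓ} {a ℓ} (A : Algebra K a ℓ) where
  private module A = Algebra A

  generated-⊆ : ∀ {p q} {G : Pred A.Carrier p} {H : Pred A.Carrier q} →
                G ⊆ Generated A H → Generated A G ⊆ Generated A H
  generated-⊆ f (gen g)      = f g
  generated-⊆ f (scal k)     = scal k
  generated-⊆ f (add p q)    = add (generated-⊆ f p) (generated-⊆ f q)
  generated-⊆ f (mul p q)    = mul (generated-⊆ f p) (generated-⊆ f q)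
  generated-⊆ f (resp x≈y p) = resp x≈y (generated-⊆ f p)

  quotientHom : ∀ {n} (g : Fin n → A.Carrier) → AlgebraHom A (quotient A g)
  quotientHom g = algebraHom A (quotient A g) (λ x → x)
    (λ {x} x≈y → resp (A.sym (A.trans (A.+-congʳ x≈y) (A.-‿inverseʳ _))) null)
    (λ _ _ → Q.refl) (λ _ _ → Q.refl) (λ _ → Q.refl)
    where module Q = Algebra (quotient A g)

  quotientHom-kernel : ∀ {n} (g : Fin n → A.Carrier) → Hom.Kernel (quotientHom g) ≐ Ideal A g
  quotientHom-kernel g = resp (x-0≈x _) , resp (A.sym (x-0≈x _))
    where
    x-0≈x : ∀ x → x A.- A.0# A.≈ x
    x-0≈x x = A.trans (A.+-congˡ (RingProperties.-0#≈0# A.ring)) (A.+-identityʳ x)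

-- Linearity only: the value at a point is not multiplicative for the Minkowski product.
record LinearFunctional {K : CommutativeRing 0ℓ 0ℓ} {a ℓ} (A : Algebra K a ℓ) : Set (a ⊔ ℓ) where
  private
    module K = CommutativeRing K
    module A = Algebra A
  field
    ⟨_⟩    : A.Carrier → K.Carrier
    ⟨⟩-cong : ∀ {x y} → x A.≈ y → ⟨_⟩ x K.≈ ⟨_⟩ y
    ⟨⟩-+    : ∀ x y → ⟨_⟩ (x A.+ y) K.≈ ⟨_⟩ x K.+ ⟨_⟩ y
    ⟨⟩-*    : ∀ c x → ⟨_⟩ (A.ι c A.* x) K.≈ c K.* ⟨_⟩ x

  ⟨⟩-0 : ⟨_⟩ A.0# K.≈ K.0#
  ⟨⟩-0 = K.trans (⟨⟩-cong (A.sym (A.zeroʳ (A.ι K.0#)))) (K.trans (⟨⟩-* K.0# A.0#) (K.zeroˡ _))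

-- Linear maps and homomorphisms out of a polynomial ring.

module Lift (K : CommutativeRing 0ℓ 0ℓ) (n : ℕ) {a ℓ} (A : Algebra K a ℓ) where
  private
    module K = CommutativeRing K
    module A = Algebra A
    module P = Algebra (polynomials K n)
  open Polynomials K n hiding (polynomials; var)
  open Indicator K
  open RingProperties A.ring using (-‿distribˡ-*; -‿+-comm; -0#≈0#; x∙y⁻¹≈ε⇒x≈y)
  open Solver A.commutativeRing using (solve; _:=_; _:+_; _:*_)

  private
    remove : Monomial → FormalSum → FormalSum
    remove m = filter (λ (_ , m′) → ¬? (m ≟ m′))

  module _ (h : Monomial → A.Carrier) where

    linear : FormalSum → A.Carrier
    linear []            = A.0#
    linear ((c , m) ∷ f) = A.ι c A.* h m A.+ linear f

    linear-++ : ∀ f g → linear (f ++ g) A.≈ linear f A.+ linear g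
    linear-++ []      g = A.sym (A.+-identityˡ _)
    linear-++ (_ ∷ f) g = A.trans (A.+-congˡ (linear-++ f g)) (A.sym (A.+-assoc _ _ _))

    linear-negate : ∀ f → linear (negate f) A.≈ A.- linear f
    linear-negate []            = A.sym -0#≈0#
    linear-negate ((c , m) ∷ f) = A.trans
      (A.+-cong (A.trans (A.*-congʳ (A.ι-neg c)) (A.sym (-‿distribˡ-* _ _))) (linear-negate f)) (-‿+-comm _ _)

    private
      linear-remove : ∀ m f → linear f A.≈ A.ι (coefficient m f) A.* h m A.+ linear (remove m f)
      linear-remove m [] = A.sym (A.trans (A.+-identityʳ _) (A.trans (A.*-congʳ A.ι-0#) (A.zeroˡ _)))
      linear-remove m ((c , m′) ∷ f) with m ≟ m′
      ... | yes ≡.refl = A.trans (A.+-congˡ (linear-remove m f)) (A.trans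
        (solve 4 (λ c k x r → c :* x :+ (k :* x :+ r) := (c :+ k) :* x :+ r) A.refl _ _ _ _)
        (A.+-congʳ (A.*-congʳ (A.sym (A.trans (A.ι-+ _ _) (A.+-congʳ (A.ι-cong (K.*-identityʳ c))))))))
      ... | no  _      = A.trans (A.+-congˡ (linear-remove m f)) (A.trans
        (solve 4 (λ c k x r → c :+ (k :* x :+ r) := k :* x :+ (c :+ r)) A.refl _ _ _ _)
        (A.+-congʳ (A.*-congʳ (A.ι-cong (K.sym (K.trans (K.+-congʳ (K.zeroʳ c)) (K.+-identityˡ _)))))))

      coefficient-remove : ∀ m f → coefficient m (remove m f) K.≈ K.0#
      coefficient-remove m [] = K.refl
      coefficient-remove m ((c , m′) ∷ f) with m ≟ m′
      ... | yes _   = coefficient-remove m f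
      ... | no m≢m′ = K.trans (K.+-cong (K.trans (K.*-congˡ (indicator-no (m ≟ m′) m≢m′)) (K.zeroʳ c))
                                        (coefficient-remove m f)) (K.+-identityˡ _)

      coefficient-remove-≢ : ∀ {m k} → k ≢ m → ∀ f → coefficient k (remove m f) K.≈ coefficient k f
      coefficient-remove-≢ k≢m [] = K.refl
      coefficient-remove-≢ {m} {k} k≢m ((c , m′) ∷ f) with m ≟ m′
      ... | yes ≡.refl = K.trans (coefficient-remove-≢ k≢m f) (K.sym (K.trans
        (K.+-congʳ (K.trans (K.*-congˡ (indicator-no (k ≟ m) k≢m)) (K.zeroʳ c))) (K.+-identityˡ _)))
      ... | no _ = K.+-congˡ (coefficient-remove-≢ k≢m f)

      remove-head : ∀ m c f → remove m ((c , m) ∷ f) ≡ remove m f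
      remove-head m c f with m ≟ m
      ... | yes _  = ≡.refl
      ... | no m≢m = contradiction ≡.refl m≢m

      -- Induction on the length, removing all terms with the same monomial at once.
      vanishing : ∀ s f → length f ≤ s → (∀ m → coefficient m f K.≈ K.0#) → linear f A.≈ A.0#
      vanishing s       []                  _         _   = A.refl
      vanishing (suc s) F@((c , m) ∷ f) (s≤s f≤s) F≈0 = A.trans (linear-remove m F) (A.trans
        (A.+-cong (A.trans (A.*-congʳ (A.trans (A.ι-cong (F≈0 m)) A.ι-0#)) (A.zeroˡ _))
                  (≡.subst (λ g → linear g A.≈ A.0#) (≡.sym (remove-head m c f))
                    (vanishing s (remove m f) (ℕ.≤-trans (List.length-filter _ f) f≤s) rest)))
        (A.+-identityʳ _))
        where
        rest : ∀ k → coefficient k (remove m f) K.≈ K.0#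
        rest k with k ≟ m
        ... | yes ≡.refl = coefficient-remove m f
        ... | no k≢m     = K.trans (K.reflexive (≡.cong (coefficient k) (≡.sym (remove-head m c f))))
                             (K.trans (coefficient-remove-≢ k≢m F) (F≈0 k))

    -- Equal polynomials may list repeated, permuted or cancelling terms, so a recursion on lists
    -- does not respect equality by itself; the difference is handled by `vanishing`.
    linear-cong : ∀ {f g} → f P.≈ g → linear f A.≈ linear g
    linear-cong {f} {g} f≈g = x∙y⁻¹≈ε⇒x≈y _ _ (A.trans
      (A.sym (A.trans (linear-++ f (negate g)) (A.+-congˡ (linear-negate g))))
      (vanishing _ (f ++ negate g) ℕ.≤-refl (RingProperties.x≈y⇒x∙y⁻¹≈ε P.ring {f} {g} f≈g)))

    linear-functional : (F : LinearFunctional A) → let open LinearFunctional F in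
                        ∀ f → ⟨ linear f ⟩ K.≈ evaluate (⟨_⟩ ∘ h) f
    linear-functional F []            = LinearFunctional.⟨⟩-0 F
    linear-functional F ((c , m) ∷ f) = K.trans (⟨⟩-+ _ _) (K.+-cong (⟨⟩-* c (h m)) (linear-functional F f))
      where open LinearFunctional F

    module _ (h-one : h one A.≈ A.1#) (h-∙ : ∀ m m′ → h (m ∙ m′) A.≈ h m A.* h m′) where

      private
        linear-map-⊗ : ∀ c m g → linear (map ((c , m) ⊗_) g) A.≈ A.ι c A.* h m A.* linear g
        linear-map-⊗ c m []             = A.sym (A.zeroʳ _)
        linear-map-⊗ c m ((c′ , m′) ∷ g) = A.trans
          (A.+-cong (A.*-cong (A.ι-* c c′) (h-∙ m m′)) (linear-map-⊗ c m g))
          (solve 5 (λ c d x y r → (c :* d) :* (x :* y) :+ c :* x :* r := c :* x :* (d :* y :+ r)) A.refl _ _ _ _ _)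

        linear-⊛ : ∀ f g → linear (f ⊛ g) A.≈ linear f A.* linear g
        linear-⊛ []            g = A.sym (A.zeroˡ _)
        linear-⊛ ((c , m) ∷ f) g = A.trans (linear-++ (map ((c , m) ⊗_) g) (f ⊛ g))
          (A.trans (A.+-cong (linear-map-⊗ c m g) (linear-⊛ f g)) (A.sym (A.distribʳ _ _ _)))

      lift : AlgebraHom (polynomials K n) A
      lift = algebraHom (polynomials K n) A linear (λ {f} {g} → linear-cong {f} {g}) linear-++ linear-⊛
        (λ k → A.trans (A.+-identityʳ _) (A.trans (A.*-congˡ h-one) (A.*-identityʳ _)))

      lift-monomial : ∀ m → AlgebraHom.⟦_⟧ lift ((K.1# , m) ∷ []) A.≈ h m
      lift-monomial m = A.trans (A.+-identityʳ _) (A.trans (A.*-congʳ A.ι-1#) (A.*-identityˡ _))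

module _ (K : CommutativeRing 0ℓ 0ℓ) where
  open CommutativeRing K

  -- A scalar acts by multiplication with a multiple of `ε`, and `ε ∙ x` need not be literally `x`:
  -- adding the origin to a polyhedron yields another presentation of it. Hence the hypothesis on
  -- `h`.
  evaluate-ι-⊛ : ∀ {x} {X : Set x} (_∙_ : X → X → X) (ε : X) →
    let open FormalSums K _∙_ ε in
    (h : X → Carrier) → (∀ x → h (ε ∙ x) ≈ h x) →
    ∀ c f → evaluate h (((c , ε) ∷ []) ⊛ f) ≈ c * evaluate h f
  evaluate-ι-⊛ _∙_ ε h h-ε c []            = sym (zeroʳ c)
  evaluate-ι-⊛ _∙_ ε h h-ε c ((d , x) ∷ f) = trans
    (+-cong (trans (*-congˡ (h-ε x)) (*-assoc c d _)) (evaluate-ι-⊛ _∙_ ε h h-ε c f)) (sym (distribˡ c _ _))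

-- Finite products, multilinearity and integration coordinate by coordinate.

module Products {c ℓ} (R : CommutativeRing c ℓ) where
  open CommutativeRing R
  open Sum *-commutativeMonoid public using ()
    renaming (sum to ∏; sum-cong-≋ to ∏-cong; sum-remove to ∏-remove; sum-replicate-zero to ∏-ones)

  ∏-single : ∀ {n} (f : Vector Carrier n) i → (∀ j → j ≢ i → f j ≈ 1#) → ∏ f ≈ f i
  ∏-single {suc n} f i f≈1 = trans (∏-remove f) (trans (*-congˡ (trans
    (∏-cong {x = Vector.removeAt f i} {y = λ _ → 1#} (λ j → f≈1 (punchIn i j) (Fin.punchInᵢ≢i i j))) (∏-ones n))) (*-identityʳ _))

  private
    ∏-off : ∀ {n} (f g : Vector Carrier (suc n)) i → (∀ j → j ≢ i → f j ≈ g j) →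
            ∏ (Vector.removeAt f i) ≈ ∏ (Vector.removeAt g i)
    ∏-off f g i f≈g = ∏-cong {x = Vector.removeAt f i} {y = Vector.removeAt g i}
      (λ j → f≈g (punchIn i j) (Fin.punchInᵢ≢i i j))

  -- Together with `∏-homogeneous`, this is multilinearity in the very shape of the constructors
  -- `additive` and `homogeneous` of the tensor product.
  ∏-additive : ∀ {n} (f g h : Vector Carrier n) i → f i ≈ g i + h i →
    (∀ j → j ≢ i → f j ≈ g j) → (∀ j → j ≢ i → f j ≈ h j) → ∏ f ≈ ∏ g + ∏ h
  ∏-additive {suc n} f g h i at f≈g f≈h = trans (∏-remove f) (trans (*-congʳ at) (trans (distribʳ _ _ _)
    (+-cong (trans (*-congˡ (∏-off f g i f≈g)) (sym (∏-remove g)))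
            (trans (*-congˡ (∏-off f h i f≈h)) (sym (∏-remove h))))))

  ∏-homogeneous : ∀ {n} k (f g : Vector Carrier n) i → f i ≈ k * g i →
    (∀ j → j ≢ i → f j ≈ g j) → ∏ f ≈ k * ∏ g
  ∏-homogeneous {suc n} k f g i at f≈g = trans (∏-remove f) (trans (*-congʳ at) (trans (*-assoc _ _ _)
    (*-congˡ (trans (*-congˡ (∏-off f g i f≈g)) (sym (∏-remove g))))))

module IndicatorProducts (K : CommutativeRing 0ℓ 0ℓ) where
  open CommutativeRing K hiding (zero)
  open Indicator K
  open Products K

  ∏-indicator : ∀ {n p q} {P : Fin n → Set p} {Q : Set q} (P? : ∀ i → Dec (P i)) (Q? : Dec Q) →
    (Q → ∀ i → P i) → ((∀ i → P i) → Q) → ∏ (λ i → indicator (P? i)) ≈ indicator Q?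
  ∏-indicator {zero}  P? Q? to from = sym (indicator-yes Q? (from λ ()))
  ∏-indicator {suc n} P? Q? to from = trans
    (*-congˡ (∏-indicator (P? ∘ suc) (Fin.all? (P? ∘ suc)) (λ p → p) (λ p → p)))
    (sym (indicator-× (P? zero) (Fin.all? (P? ∘ suc)) Q? (λ q → to q zero , to q ∘ suc)
      λ { (p , ps) → from λ { zero → p ; (suc i) → ps i } }))

module _ (K : CommutativeRing 0ℓ 0ℓ) where
  open CommutativeRing K hiding (zero)
  open Evaluation K
  open Products K
  open Solver K using (solve; _:=_; _:+_; _:*_)

  private
    -- The induction step of `evaluate-∏`: `k` collects the coordinates already integrated, `P`
    -- those still evaluated at points.
    evaluate-first : ∀ {x t} {X : Set x} {T : Set t} (k P : X → Carrier) (g : X → T → Carrier) l f →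
      (∀ s → evaluate (λ x → k x * (g x s * P x)) f ≈ 0#) →
      evaluate (λ x → (k x * evaluate (g x) l) * P x) f ≈ 0#
    evaluate-first k P g []            f f≈0 =
      trans (evaluate-cong (λ x → trans (*-congʳ (zeroʳ _)) (zeroˡ _)) f) (evaluate-0 f)
    evaluate-first k P g ((c , s) ∷ l) f f≈0 = trans
      (evaluate-cong (λ x → solve 5 (λ k c g e p → (k :* (c :* g :+ e)) :* p := c :* (k :* (g :* p)) :+ (k :* e) :* p)
        refl (k x) c (g x s) (evaluate (g x) l) (P x)) f)
      (trans (evaluate-+ _ _ f) (trans
        (+-cong (trans (evaluate-* c _ f) (trans (*-congˡ (f≈0 s)) (zeroʳ c))) (evaluate-first k P g l f f≈0))
        (+-identityˡ 0#)))

  -- A relation between product functions persists when each variable is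
  -- integrated against a finitely supported measure.
  evaluate-∏ : ∀ {x t} {X : Set x} {T : Set t} n (k : X → Carrier) (g : X → Fin n → T → Carrier)
    (L : Fin n → List (Carrier × T)) f →
    (∀ (t : Vector T n) → evaluate (λ x → k x * ∏ (λ i → g x i (t i))) f ≈ 0#) →
    evaluate (λ x → k x * ∏ (λ i → evaluate (g x i) (L i))) f ≈ 0#
  evaluate-∏ zero    k g L f f≈0 = f≈0 (λ ())
  evaluate-∏ (suc n) k g L f f≈0 = trans
    (evaluate-cong (λ x → sym (*-assoc (k x) _ _)) f)
    (evaluate-∏ n (λ x → k x * evaluate (g x zero) (L zero)) (λ x → g x ∘ suc) (L ∘ suc) f λ t →
      evaluate-first k (λ x → ∏ (λ i → g x (suc i) (t i))) (λ x → g x zero) (L zero) f λ s → f≈0 (s Vector.∷ t))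

  module _ {t} {T : Set t} (h : T → Carrier) where
    open RingProperties ring using (-1*x≈-x)

    evaluate-unit : ∀ s → evaluate h ((1# , s) ∷ []) ≈ h s
    evaluate-unit s = trans (+-identityʳ _) (*-identityˡ _)

    evaluate-difference : ∀ s t → evaluate h ((1# , s) ∷ (- 1# , t) ∷ []) ≈ h s - h t
    evaluate-difference s t = +-cong (*-identityˡ _) (trans (+-identityʳ _) (-1*x≈-x _))

    evaluate-difference₂ : ∀ s t u → evaluate h ((1# , s) ∷ (- 1# , t) ∷ (- 1# , u) ∷ []) ≈ h s - h t - h u
    evaluate-difference₂ s t u = trans
      (+-cong (*-identityˡ _) (+-cong (-1*x≈-x _) (trans (+-identityʳ _) (-1*x≈-x _)))) (sym (+-assoc _ _ _))

-- Tensor factors, pure tensors and products of functionals.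

module Tensors {K : CommutativeRing 0ℓ 0ℓ} {a ℓ} {d : ℕ} (A : Fin d → Algebra K a ℓ) where
  private
    module K = CommutativeRing K
    module A i = Algebra (A i)
    module ⨂A = Algebra (⨂ A)
  open TensorProduct A hiding (tensorProduct; _≈_; sym; trans; refl)

  at : ∀ i → A.Carrier i → PureTensor
  at i x j with j Fin.≟ i
  ... | yes ≡.refl = x
  ... | no  _      = A.1# j

  at-on : ∀ i x → A._≈_ i (at i x i) x
  at-on i x with i Fin.≟ i
  ... | yes ≡.refl = A.refl i
  ... | no i≢i     = contradiction ≡.refl i≢i

  at-off : ∀ {i j} x → j ≢ i → A._≈_ j (at i x j) (A.1# j)
  at-off {i} {j} x j≢i with j Fin.≟ i
  ... | yes j≡i = contradiction j≡i j≢i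
  ... | no  _   = A.refl j

  at-unique : ∀ {i x} {u : PureTensor} → A._≈_ i (u i) x → (∀ j → j ≢ i → A._≈_ j (u j) (A.1# j)) →
              ∀ j → A._≈_ j (at i x j) (u j)
  at-unique {i} on off j with j Fin.≟ i
  ... | yes ≡.refl = A.sym i on
  ... | no  j≢i    = A.sym j (off j j≢i)

  opaque
    inclusion : ∀ i → AlgebraHom (A i) (⨂ A)
    inclusion i = algebraHom (A i) (⨂ A) (λ x → (K.1# , at i x) ∷ [])
      (λ {x} {y} x≈y → pure-cong K.refl
        (at-unique (A.trans i (at-on i y) (A.sym i x≈y)) (λ j j≢i → at-off y j≢i)))
      (λ x y → additive K.1# i
        (A.trans i (at-on i _) (A.sym i (A.+-cong i (at-on i x) (at-on i y))))
        (λ j j≢i → A.trans j (at-off _ j≢i) (A.sym j (at-off x j≢i)))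
        (λ j j≢i → A.trans j (at-off _ j≢i) (A.sym j (at-off y j≢i))))
      (λ x y → pure-cong (K.sym (K.*-identityˡ K.1#)) (at-unique
        (A.*-cong i (at-on i x) (at-on i y))
        (λ j j≢i → A.trans j (A.*-cong j (at-off x j≢i) (at-off y j≢i)) (A.*-identityˡ j _))))
      (λ k → ⨂A.trans
        (homogeneous K.1# k {v = one} i
          (A.trans i (at-on i _) (A.sym i (A.*-identityʳ i _))) (λ j j≢i → at-off _ j≢i))
        (pure-cong (K.*-identityˡ k) (λ j → A.refl j)))

    inclusion-unique : ∀ {i x} (u : PureTensor) → A._≈_ i (u i) x → (∀ j → j ≢ i → A._≈_ j (u j) (A.1# j)) →
                       AlgebraHom.⟦_⟧ (inclusion i) x ⨂A.≈ (K.1# , u) ∷ []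
    inclusion-unique u on off = pure-cong K.refl (at-unique on off)

    -- A pure tensor is the product over `j` of the tensors `at j (v j)`: in place `i` all factors
    -- but the `i`-th are 1. So a property closed under products need only be checked on single
    -- factors.
    pure-∏ : ∀ {q} (Q : Pred FormalSum q) → (∀ {f g} → f ⨂A.≈ g → Q f → Q g) →
      Q ⨂A.1# → (∀ {f g} → Q f → Q g → Q (f ⊛ g)) →
      ∀ v → (∀ i → Q (AlgebraHom.⟦_⟧ (inclusion i) (v i))) → Q ((K.1# , v) ∷ [])
    pure-∏ Q Q-resp Q-1 Q-* v Qv = Q-resp
      (pure-cong K.refl λ i → A.trans i
        (Products.∏-single (A.commutativeRing i) (λ j → at j (v j) i) i (λ j j≢i → at-off (v j) (j≢i ∘ ≡.sym)))
        (at-on i (v i)))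
      (products (λ j → at j (v j)) Qv)
      where
      products : ∀ {n} (g : Fin n → PureTensor) → (∀ j → Q ((K.1# , g j) ∷ [])) →
                 Q ((K.1# , λ i → Products.∏ (A.commutativeRing i) (λ j → g j i)) ∷ [])
      products {zero}  g Qg = Q-1
      products {suc n} g Qg = Q-resp (pure-cong (K.*-identityˡ K.1#) (λ i → A.refl i))
        (Q-* (Qg zero) (products (g ∘ suc) (Qg ∘ suc)))

  module _ (F : ∀ i → LinearFunctional (A i)) where
    private module F i = LinearFunctional (F i)
    open Products K

    private
      onPure : PureTensor → K.Carrier
      onPure v = ∏ (λ i → F.⟨_⟩ i (v i))

      onPure-cong : ∀ {u v} → (∀ i → A._≈_ i (u i) (v i)) → onPure u K.≈ onPure v
      onPure-cong u≈v = ∏-cong (λ i → F.⟨⟩-cong i (u≈v i))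

      -- The congruence is the smallest one, so each constructor is checked; only the last two use
      -- that the value on pure tensors is multilinear.
      onSums-cong : ∀ {f g} → f ⨂A.≈ g → evaluate onPure f K.≈ evaluate onPure g
      onSums-cong TensorProduct.refl        = K.refl
      onSums-cong (TensorProduct.sym p)     = K.sym (onSums-cong p)
      onSums-cong (TensorProduct.trans p q) = K.trans (onSums-cong p) (onSums-cong q)
      onSums-cong (TensorProduct.++-cong {f} {f′} {g} {g′} p q) = K.trans (evaluate-++ onPure f g)
        (K.trans (K.+-cong (onSums-cong p) (onSums-cong q)) (K.sym (evaluate-++ onPure f′ g′)))
      onSums-cong (TensorProduct.++-comm f g) = K.trans (evaluate-++ onPure f g)
        (K.trans (K.+-comm _ _) (K.sym (evaluate-++ onPure g f)))
      onSums-cong (TensorProduct.coeff-+ c d v) = K.trans (K.+-congʳ (K.distribʳ _ c d)) (K.+-assoc _ _ _)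
      onSums-cong (TensorProduct.coeff-0 v)     = K.trans (K.+-identityʳ _) (K.zeroˡ _)
      onSums-cong (TensorProduct.pure-cong c≈d u≈v) = K.+-congʳ (K.*-cong c≈d (onPure-cong u≈v))
      onSums-cong (TensorProduct.additive c {u} {v} {w} i on off-v off-w) = K.trans
        (K.+-congʳ (K.trans (K.*-congˡ (∏-additive _ _ _ i
          (K.trans (F.⟨⟩-cong i on) (F.⟨⟩-+ i _ _))
          (λ j j≢i → F.⟨⟩-cong j (off-v j j≢i)) (λ j j≢i → F.⟨⟩-cong j (off-w j j≢i)))) (K.distribˡ c _ _)))
        (K.+-assoc _ _ _)
      onSums-cong (TensorProduct.homogeneous c k {u} {v} i on off) = K.+-congʳ (K.trans
        (K.*-congˡ (∏-homogeneous k _ _ i (K.trans (F.⟨⟩-cong i on) (F.⟨⟩-* i k _)) (λ j j≢i → F.⟨⟩-cong j (off j j≢i))))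
        (K.sym (K.*-assoc c k _)))

    productFunctional : LinearFunctional (⨂ A)
    productFunctional = record
      { ⟨_⟩     = evaluate onPure
      ; ⟨⟩-cong = onSums-cong
      ; ⟨⟩-+    = evaluate-++ onPure
      ; ⟨⟩-*    = evaluate-ι-⊛ K _∙_ one onPure (λ v → onPure-cong (λ i → A.*-identityˡ i (v i))) }

    productFunctional-pure : ∀ v → LinearFunctional.⟨_⟩ productFunctional ((K.1# , v) ∷ []) K.≈ onPure v
    productFunctional-pure v = K.trans (K.+-identityʳ _) (K.*-identityˡ _)

-- Boxes with integer corners and their indicator functions.

module Cells (R : CompleteOrderedField) where
  open CompleteOrderedField R renaming (Carrier to ℝ; _≤_ to _≤ᴿ_) hiding (zero)
  open OrderProperties R
  open Vectors R using (_≋_; e)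
  open MinkowskiRing R hiding (M; M𝓟; 𝓑⁺; module BoxPresentation)
  open Indicator (ℂ R)
  open Evaluation (ℂ R)
  private
    module ℂ = CommutativeRing (ℂ R)
    module 𝓟 {d} = Algebra (M𝓟Ring R d)

  fromℕ-+ : ∀ m n → fromℕ (m ℕ.+ n) ≈ fromℕ m + fromℕ n
  fromℕ-+ zero    n = sym (+-identityˡ _)
  fromℕ-+ (suc m) n = trans (+-congˡ (fromℕ-+ m n)) (sym (+-assoc _ _ _))

  0≤fromℕ : ∀ n → 0# ≤ᴿ fromℕ n
  0≤fromℕ zero    = ≤-refl
  0≤fromℕ (suc n) = ≤-respˡ-≈ (+-identityˡ 0#) (+-mono-≤ 0≤1 (0≤fromℕ n))

  fromℕ-mono : ∀ {m n} → m ≤ n → fromℕ m ≤ᴿ fromℕ n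
  fromℕ-mono {n = n} z≤n = 0≤fromℕ n
  fromℕ-mono (s≤s m≤n)   = +-mono-≤ ≤-refl (fromℕ-mono m≤n)

  fromℕ-suc-≰ : ∀ n → ¬ fromℕ (suc n) ≤ᴿ fromℕ n
  fromℕ-suc-≰ n p = 1≉0 (antisym (≤-by (difference) p) 0≤1)
    where
    open Solver commutativeRing
    difference : fromℕ n - (1# + fromℕ n) ≈ 0# - 1#
    difference = trans (solve 2 (λ x y → y :- (x :+ y) := :- x) refl 1# (fromℕ n)) (sym (+-identityˡ _))

  fromℕ-reflects : ∀ {m n} → fromℕ m ≤ᴿ fromℕ n → m ≤ n
  fromℕ-reflects {m} {n} p with m ℕ.≤? n
  ... | yes m≤n = m≤n
  ... | no  m≰n = contradiction (≤-trans (fromℕ-mono (ℕ.≰⇒> m≰n)) p) (fromℕ-suc-≰ n)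

  halfway : ℕ → ℝ
  halfway n = midpoint (fromℕ n) (fromℕ (suc n))

  fromℕ≤halfway : ∀ {m n} → m ≤ n → fromℕ m ≤ᴿ halfway n
  fromℕ≤halfway {m} {n} m≤n = ≤-trans (fromℕ-mono m≤n) (≤-midpoint (fromℕ-mono (ℕ.n≤1+n n)))

  halfway≤fromℕ : ∀ {m n} → suc n ≤ m → halfway n ≤ᴿ fromℕ m
  halfway≤fromℕ {m} {n} n<m = ≤-trans (midpoint-≤ (fromℕ-mono (ℕ.n≤1+n n))) (fromℕ-mono n<m)

  -- Otherwise `m` is at least `suc n`, the midpoint is at least its own right end, and `suc n`
  -- would be at most `n`. The next lemma is the mirror image.
  fromℕ≤halfway⁻ : ∀ {m n} → fromℕ m ≤ᴿ halfway n → m ≤ n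
  fromℕ≤halfway⁻ {m} {n} p with m ℕ.≤? n
  ... | yes m≤n = m≤n
  ... | no  m≰n = contradiction (right≤midpoint (≤-trans (fromℕ-mono (ℕ.≰⇒> m≰n)) p)) (fromℕ-suc-≰ n)

  halfway≤fromℕ⁻ : ∀ {m n} → halfway n ≤ᴿ fromℕ m → suc n ≤ m
  halfway≤fromℕ⁻ {m} {n} p with suc n ℕ.≤? m
  ... | yes n<m = n<m
  ... | no  n≮m = contradiction (midpoint≤left (≤-trans p (fromℕ-mono (ℕ.s≤s⁻¹ (ℕ.≰⇒> n≮m))))) (fromℕ-suc-≰ n)

  χ-cong : ∀ {d} (P Q : Polyhedron d) → points P ≐ points Q → ∀ w → χ P w ℂ.≈ χ Q w
  χ-cong P Q (P⊆Q , Q⊆P) w = indicator-cong (member? P w) (member? Q w) P⊆Q Q⊆P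

  []-cong : ∀ {d} (P Q : Polyhedron d) → points P ≐ points Q → [ P ] 𝓟.≈ [ Q ]
  []-cong P Q P≐Q w = ℂ.+-congʳ {ℂ.0#} (ℂ.*-congˡ {ℂ.1#} (χ-cong P Q P≐Q w))

  origin-⊕ : ∀ {d} (P : Polyhedron d) → points (singleton origin ⊕ P) ≐ points P
  origin-⊕ P =
    (λ (o , a , o≋0 , a∈ , w≋) → points-resp P (λ i → sym (trans (w≋ i) (trans (+-congʳ (o≋0 i)) (+-identityˡ _)))) a∈) ,
    (λ {w} w∈ → origin , w , (λ _ → refl) , w∈ , λ _ → sym (+-identityˡ _))

  pointValue : ∀ {d ℓ} (𝒟 : Pred (Polyhedron d) ℓ) → Vector ℝ d → LinearFunctional (MRing R 𝒟)
  pointValue {d} 𝒟 w = record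
    { ⟨_⟩     = λ (f , _) → evaluate (λ P → χ P w) f
    ; ⟨⟩-cong = λ f≈g → f≈g w
    ; ⟨⟩-+    = λ (f , _) (g , _) → evaluate-++ _ f g
    ; ⟨⟩-*    = λ c (f , _) → evaluate-ι-⊛ (ℂ R) _⊕_ (singleton origin) (λ P → χ P w)
        (λ P → χ-cong (singleton origin ⊕ P) P (origin-⊕ P) w) c f }

  pointValue-[] : ∀ {d} (P : Polyhedron d) w → evaluate (λ Q → χ Q w) [ P ] ℂ.≈ χ P w
  pointValue-[] P w = ℂ.trans (ℂ.+-identityʳ (ℂ.1# ℂ.* χ P w)) (ℂ.*-identityˡ (χ P w))

  -- Lower corner and side lengths instead of two corners: every pair of exponent vectors then gives
  -- a nonempty box, and Minkowski sum becomes addition of exponents.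
  cell : ∀ {d} → Vector ℕ d → Vector ℕ d → Polyhedron d
  cell α β = box (fromℕ ∘ α) (λ i → fromℕ (α i ℕ.+ β i))

  interval : ℕ → ℕ → Polyhedron 1
  interval a k = cell (λ _ → a) (λ _ → k)

  cell-cong : ∀ {d} {α α′ β β′ : Vector ℕ d} → (∀ i → α i ≡ α′ i) → (∀ i → β i ≡ β′ i) →
              points (cell α β) ≐ points (cell α′ β′)
  cell-cong α≡ β≡ =
    (λ p i → ≡.subst₂ (λ a b → fromℕ a ≤ᴿ _ × _ ≤ᴿ fromℕ (a ℕ.+ b)) (α≡ i) (β≡ i) (p i)) ,
    (λ p i → ≡.subst₂ (λ a b → fromℕ a ≤ᴿ _ × _ ≤ᴿ fromℕ (a ℕ.+ b)) (≡.sym (α≡ i)) (≡.sym (β≡ i)) (p i))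

  cell-origin : ∀ {d} → points (cell {d} (λ _ → 0) (λ _ → 0)) ≐ points (singleton {d} origin)
  cell-origin = (λ p i → antisym (proj₂ (p i)) (proj₁ (p i))) ,
                (λ w≋0 i → ≤-reflexive (sym (w≋0 i)) , ≤-reflexive (w≋0 i))

  private
    -- A point of the sum interval is decomposed greedily: the second summand stays at its minimum
    -- `a′` as long as the first can absorb the rest; otherwise the first is set to its maximum `b`.
    split : ∀ {a b a′ b′ w} → a ≤ᴿ b → a′ ≤ᴿ b′ → a + a′ ≤ᴿ w → w ≤ᴿ b + b′ →
            ∃₂ λ u u′ → (a ≤ᴿ u × u ≤ᴿ b) × (a′ ≤ᴿ u′ × u′ ≤ᴿ b′) × w ≈ u + u′
    split {a} {b} {a′} {b′} {w} a≤b a′≤b′ lower upper with w - a′ ≤? b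
    ... | yes w-a′≤b = w - a′ , a′ ,
      (≤-by (solve 3 (λ a a′ w → w :- (a :+ a′) := w :- a′ :- a) refl a a′ w) lower , w-a′≤b) , (≤-refl , a′≤b′) ,
      solve 2 (λ w a′ → w := w :- a′ :+ a′) refl w a′
      where open Solver commutativeRing
    ... | no  w-a′≰b = b , w - b , (a≤b , ≤-refl) ,
      (≤-by (solve 3 (λ a′ b w → w :- a′ :- b := w :- b :- a′) refl a′ b w) (≰⇒≥ w-a′≰b) ,
       ≤-by (solve 3 (λ b b′ w → b :+ b′ :- w := b′ :- (w :- b)) refl b b′ w) upper) ,
      solve 2 (λ w b → w := b :+ (w :- b)) refl w b
      where open Solver commutativeRing

  cell-⊕ : ∀ {d} (α β α′ β′ : Vector ℕ d) →
    points (cell α β ⊕ cell α′ β′) ≐ points (cell (λ i → α i ℕ.+ α′ i) (λ i → β i ℕ.+ β′ i))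
  cell-⊕ α β α′ β′ =
    (λ (u , u′ , u∈ , u′∈ , w≋) i →
      ≤-respects (sym (fromℕ-+ (α i) (α′ i))) (sym (w≋ i)) (+-mono-≤ (proj₁ (u∈ i)) (proj₁ (u′∈ i))) ,
      ≤-respects (sym (w≋ i)) (sym (upper i)) (+-mono-≤ (proj₂ (u∈ i)) (proj₂ (u′∈ i)))) ,
    (λ w∈ → let s i = split (fromℕ-mono (ℕ.m≤m+n (α i) (β i))) (fromℕ-mono (ℕ.m≤m+n (α′ i) (β′ i)))
                        (≤-respˡ-≈ (fromℕ-+ (α i) (α′ i)) (proj₁ (w∈ i))) (≤-respʳ-≈ (upper i) (proj₂ (w∈ i)))
            in (λ i → proj₁ (s i)) , (λ i → proj₁ (proj₂ (s i))) ,
               (λ i → proj₁ (proj₂ (proj₂ (s i)))) , (λ i → proj₁ (proj₂ (proj₂ (proj₂ (s i))))) ,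
               (λ i → proj₂ (proj₂ (proj₂ (proj₂ (s i))))))
    where
    upper : ∀ i → fromℕ ((α i ℕ.+ α′ i) ℕ.+ (β i ℕ.+ β′ i)) ≈ fromℕ (α i ℕ.+ β i) + fromℕ (α′ i ℕ.+ β′ i)
    upper i = trans (reflexive (≡.cong fromℕ (interchange ℕ.+-commutativeSemigroup (α i) (α′ i) (β i) (β′ i)))) (fromℕ-+ (α i ℕ.+ β i) _)

  [cell]-* : ∀ {d} (α β α′ β′ : Vector ℕ d) →
    [ cell (λ i → α i ℕ.+ α′ i) (λ i → β i ℕ.+ β′ i) ] 𝓟.≈ [ cell α β ] 𝓟.* [ cell α′ β′ ]
  [cell]-* α β α′ β′ w = ℂ.+-congʳ {ℂ.0#} (ℂ.*-cong {ℂ.1#} {ℂ.1# ℂ.* ℂ.1#} (ℂ.sym (ℂ.*-identityˡ ℂ.1#))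
    (ℂ.sym (χ-cong (cell α β ⊕ cell α′ β′) (cell (λ i → α i ℕ.+ α′ i) (λ i → β i ℕ.+ β′ i)) (cell-⊕ α β α′ β′) w)))

  cell∈𝓑⁺ : ∀ {d} (α β : Vector ℕ d) → Boxes R d (cell α β)
  cell∈𝓑⁺ α β = α , (λ i → α i ℕ.+ β i) , (λ i → ℕ.m≤m+n (α i) (β i)) , (λ p → p) , (λ p → p)

  𝓑⁺⇒cell : ∀ {d} (P : Polyhedron d) → Boxes R d P → ∃₂ λ α β → points P ≐ points (cell α β)
  𝓑⁺⇒cell P (a , b , a≤b , P⊆ , ⊆P) = a , (λ i → b i ℕ.∸ a i) ,
    (λ p i → ≡.subst (λ c → fromℕ (a i) ≤ᴿ _ × _ ≤ᴿ fromℕ c) (≡.sym (ℕ.m+[n∸m]≡n (a≤b i))) (P⊆ p i)) ,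
    (λ p → ⊆P (λ i → ≡.subst (λ c → fromℕ (a i) ≤ᴿ _ × _ ≤ᴿ fromℕ c) (ℕ.m+[n∸m]≡n (a≤b i)) (p i)))

  𝓑⁺⇒interval : ∀ (P : Polyhedron 1) → Boxes R 1 P → ∃₂ λ a k → points P ≐ points (interval a k)
  𝓑⁺⇒interval P P∈ = let α , β , P⊆ , ⊆P = 𝓑⁺⇒cell P P∈
                         ⊆c , c⊆ = cell-cong {α = α} {λ _ → α zero} {β} {λ _ → β zero} (λ { zero → ≡.refl }) (λ { zero → ≡.refl })
                     in α zero , β zero , (λ p → ⊆c (P⊆ p)) , (λ p → ⊆P (c⊆ p))

  private
    module Agreement (w : Vector ℝ 1) where
      agree : ∀ a k a′ k′ → let I = interval a k ; J = interval a′ k′ ; t = w zero in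
        (fromℕ a ≤ᴿ t → t ≤ᴿ fromℕ (a ℕ.+ k) → fromℕ a′ ≤ᴿ t × t ≤ᴿ fromℕ (a′ ℕ.+ k′)) →
        (fromℕ a′ ≤ᴿ t → t ≤ᴿ fromℕ (a′ ℕ.+ k′) → fromℕ a ≤ᴿ t × t ≤ᴿ fromℕ (a ℕ.+ k)) →
        ℂ.1# ℂ.* χ I w ℂ.≈ ℂ.1# ℂ.* χ J w
      agree a k a′ k′ to from = ℂ.*-congˡ {ℂ.1#} (indicator-cong (member? (interval a k) w) (member? (interval a′ k′) w)
        (λ p → λ { zero → to (proj₁ (p zero)) (proj₂ (p zero)) })
        (λ p → λ { zero → from (proj₁ (p zero)) (proj₂ (p zero)) }))

  -- On either side of 1, two of the four indicators agree with the other two.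
  interval-split : [ interval 0 2 ] 𝓟.+ [ interval 1 0 ] 𝓟.≈ [ interval 0 1 ] 𝓟.+ [ interval 1 1 ]
  interval-split w with total (w zero) (fromℕ 1)
  ... | inj₁ w≤1 = ℂ.+-cong (agree 0 2 0 1
      (λ 0≤w _ → 0≤w , w≤1) (λ 0≤w _ → 0≤w , w≤2))
    (ℂ.+-congʳ (agree 1 0 1 1 (λ 1≤w _ → 1≤w , w≤2) (λ 1≤w _ → 1≤w , w≤1)))
    where
    w≤2 = ≤-trans w≤1 (fromℕ-mono {1} {2} (s≤s z≤n))
    open Agreement w
  ... | inj₂ 1≤w = ℂ.trans (ℂ.+-cong (agree 0 2 1 1 (λ _ w≤2 → 1≤w , w≤2) (λ _ w≤2 → 0≤w , w≤2))
    (ℂ.+-congʳ (agree 1 0 0 1 (λ _ w≤1 → 0≤w , w≤1) (λ _ w≤1 → 1≤w , w≤1))))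
    (ℂ-solve 3 (λ x y o → x :+ (y :+ o) := y :+ (x :+ o)) ℂ.refl
      (ℂ.1# ℂ.* χ (interval 1 1) w) (ℂ.1# ℂ.* χ (interval 0 1) w) ℂ.0#)
    where
    0≤w = ≤-trans (0≤fromℕ 1) 1≤w
    open Agreement w
    open Solver (ℂ R) using (_:=_; _:+_) renaming (solve to ℂ-solve)

-- Dual functionals in dimension one.

module Probes (R : CompleteOrderedField) where
  open CompleteOrderedField R using (fromℕ) renaming (Carrier to ℝ)
  open MinkowskiRing R hiding (M; M𝓟; 𝓑⁺; module BoxPresentation)
  open Cells R
  open Indicator (ℂ R)
  open Evaluation (ℂ R)
  open CommutativeRing (ℂ R) hiding (zero)
  open RingProperties ring using (-0#≈0#)

  private
    χ-on : ℕ → ℕ → ℝ → Carrier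
    χ-on a k t = χ (interval a k) (λ _ → t)

    =? : ℕ → ℕ → Carrier
    =? m n = indicator (m ℕ.≟ n)

  χ-fromℕ : ∀ a k n → χ-on a k (fromℕ n) ≈ indicator ((a ℕ.≤? n) ×-dec (n ℕ.≤? a ℕ.+ k))
  χ-fromℕ a k n = indicator-cong (member? (interval a k) _) ((a ℕ.≤? n) ×-dec (n ℕ.≤? a ℕ.+ k))
    (λ p → fromℕ-reflects (proj₁ (p zero)) , fromℕ-reflects (proj₂ (p zero)))
    (λ (p , q) _ → fromℕ-mono p , fromℕ-mono q)

  χ-halfway : ∀ a k n → χ-on a k (halfway n) ≈ indicator ((a ℕ.≤? n) ×-dec (suc n ℕ.≤? a ℕ.+ k))
  χ-halfway a k n = indicator-cong (member? (interval a k) _) ((a ℕ.≤? n) ×-dec (suc n ℕ.≤? a ℕ.+ k))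
    (λ p → fromℕ≤halfway⁻ (proj₁ (p zero)) , halfway≤fromℕ⁻ (proj₂ (p zero)))
    (λ (p , q) _ → fromℕ≤halfway p , halfway≤fromℕ q)

  -- Functionals dual to the indicators of the points [ a , a ] and the unit
  -- intervals [ a , a + 1 ].
  probe : ℕ → ℕ → List (Carrier × ℝ)
  probe 0             zero    = (1# , fromℕ 0) ∷ (- 1# , halfway 0) ∷ []
  probe 0             (suc a) = (1# , fromℕ (suc a)) ∷ (- 1# , halfway a) ∷ (- 1# , halfway (suc a)) ∷ []
  probe 1             a       = (1# , halfway a) ∷ []
  probe (suc (suc _)) a       = []

  private
    point-fromℕ : ∀ a n → χ-on a 0 (fromℕ n) ≈ =? n a
    point-fromℕ a n = trans (χ-fromℕ a 0 n) (indicator-cong ((a ℕ.≤? n) ×-dec (n ℕ.≤? a ℕ.+ 0)) (n ℕ.≟ a)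
      (λ (a≤n , n≤a) → ℕ.≤-antisym (ℕ.≤-trans n≤a (ℕ.≤-reflexive (ℕ.+-identityʳ a))) a≤n)
      (λ { ≡.refl → ℕ.≤-refl , ℕ.m≤m+n n 0 }))

    point-halfway : ∀ a n → χ-on a 0 (halfway n) ≈ 0#
    point-halfway a n = trans (χ-halfway a 0 n) (indicator-no ((a ℕ.≤? n) ×-dec (suc n ℕ.≤? a ℕ.+ 0))
      (λ (a≤n , n<a) → ℕ.<-irrefl ≡.refl (ℕ.≤-trans n<a (ℕ.≤-trans (ℕ.≤-reflexive (ℕ.+-identityʳ a)) a≤n))))

    n≤a+1 : ∀ {a n} → n ≤ a ℕ.+ 1 → n ≤ suc a
    n≤a+1 {a} p = ℕ.≤-trans p (ℕ.≤-reflexive (ℕ.+-comm a 1))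

    unit-halfway : ∀ a n → χ-on a 1 (halfway n) ≈ =? n a
    unit-halfway a n = trans (χ-halfway a 1 n) (indicator-cong ((a ℕ.≤? n) ×-dec (suc n ℕ.≤? a ℕ.+ 1)) (n ℕ.≟ a)
      (λ (a≤n , n<a+1) → ℕ.≤-antisym (ℕ.s≤s⁻¹ (n≤a+1 n<a+1)) a≤n)
      (λ { ≡.refl → ℕ.≤-refl , ℕ.≤-reflexive (ℕ.+-comm 1 n) }))

    unit-zero : ∀ a → χ-on a 1 (fromℕ 0) ≈ =? 0 a
    unit-zero a = trans (χ-fromℕ a 1 0) (indicator-cong ((a ℕ.≤? 0) ×-dec (0 ℕ.≤? a ℕ.+ 1)) (0 ℕ.≟ a)
      (λ (a≤0 , _) → ≡.sym (ℕ.n≤0⇒n≡0 a≤0)) (λ { ≡.refl → z≤n , z≤n }))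

    -- A positive integer is a common endpoint of two unit intervals, the ones starting at `n` and
    -- at `suc n`; 0 belongs only to the one starting there.
    unit-suc : ∀ a n → χ-on a 1 (fromℕ (suc n)) ≈ =? n a + =? (suc n) a
    unit-suc a n = trans (χ-fromℕ a 1 (suc n)) (cases (n ℕ.≟ a) (suc n ℕ.≟ a))
      where
      D = (a ℕ.≤? suc n) ×-dec (suc n ℕ.≤? a ℕ.+ 1)

      cases : (p : Dec (n ≡ a)) (q : Dec (suc n ≡ a)) → indicator D ≈ indicator p + indicator q
      cases (yes ≡.refl) (no _)       = trans (indicator-yes D (ℕ.n≤1+n n , ℕ.≤-reflexive (ℕ.+-comm 1 n))) (sym (+-identityʳ 1#))
      cases (no _)       (yes ≡.refl) = trans (indicator-yes D (ℕ.≤-refl , ℕ.m≤m+n (suc n) 1)) (sym (+-identityˡ 1#))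
      cases (no n≢a)     (no n+1≢a)   = trans (indicator-no D λ (a≤n+1 , n<a+1) →
        n≢a (ℕ.≤-antisym (ℕ.s≤s⁻¹ (n≤a+1 n<a+1)) (ℕ.s≤s⁻¹ (ℕ.≤∧≢⇒< a≤n+1 (n+1≢a ∘ ≡.sym))))) (sym (+-identityʳ 0#))

    subtract-0 : ∀ {x y z} → x ≈ z → y ≈ 0# → x - y ≈ z
    subtract-0 {x} {y} {z} x≈z y≈0 = trans (+-cong x≈z (trans (-‿cong {y} {0#} y≈0) -0#≈0#)) (+-identityʳ z)

    =?-× : ∀ a a′ k {k′} → k ≡ k′ → =? a a′ ≈ indicator ((a ℕ.≟ a′) ×-dec (k ℕ.≟ k′))
    =?-× a a′ k {k′} k≡k′ = indicator-cong (a ℕ.≟ a′) ((a ℕ.≟ a′) ×-dec (k ℕ.≟ k′)) (_, k≡k′) proj₁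

    =?-≢ : ∀ a a′ k k′ → k ≢ k′ → 0# ≈ indicator ((a ℕ.≟ a′) ×-dec (k ℕ.≟ k′))
    =?-≢ a a′ k k′ k≢k′ = sym (indicator-no ((a ℕ.≟ a′) ×-dec (k ℕ.≟ k′)) (k≢k′ ∘ proj₂))

  -- A midpoint sees exactly one unit interval and no integer point. An integer sees its own point
  -- and the adjacent unit intervals, which the values at their midpoints cancel; at 0 there is none
  -- to the left.
  probe-χ : ∀ k a {k′} a′ → k′ ≤ 1 →
    evaluate (λ t → χ (interval a′ k′) (λ _ → t)) (probe k a) ≈ indicator ((a ℕ.≟ a′) ×-dec (k ℕ.≟ k′))
  probe-χ 0 zero {zero} a′ _ = trans (evaluate-difference (ℂ R) (χ-on a′ 0) _ _)
    (trans (subtract-0 (point-fromℕ a′ 0) (point-halfway a′ 0)) (=?-× 0 a′ 0 ≡.refl))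
  probe-χ 0 zero a′ (s≤s z≤n) = trans (evaluate-difference (ℂ R) (χ-on a′ 1) _ _)
    (trans (trans (+-cong (unit-zero a′) (-‿cong (unit-halfway a′ 0))) (-‿inverseʳ (=? 0 a′))) (=?-≢ 0 a′ 0 1 λ ()))
  probe-χ 0 (suc a) {zero} a′ _ = trans (evaluate-difference₂ (ℂ R) (χ-on a′ 0) _ _ _)
    (trans (subtract-0 (subtract-0 (point-fromℕ a′ (suc a)) (point-halfway a′ a)) (point-halfway a′ (suc a)))
           (=?-× (suc a) a′ 0 ≡.refl))
  probe-χ 0 (suc a) a′ (s≤s z≤n) = trans (evaluate-difference₂ (ℂ R) (χ-on a′ 1) _ _ _)
    (trans (+-cong (+-cong (unit-suc a′ a) (-‿cong (unit-halfway a′ a))) (-‿cong (unit-halfway a′ (suc a))))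
      (trans (solve 2 (λ x y → x :+ y :- x :- y := x :- x) refl (=? a a′) (=? (suc a) a′))
        (trans (-‿inverseʳ (=? a a′)) (=?-≢ (suc a) a′ 0 1 λ ()))))
    where open Solver (ℂ R)
  probe-χ 1 a {zero} a′ _ = trans (evaluate-unit (ℂ R) (χ-on a′ 0) _)
    (trans (point-halfway a′ a) (=?-≢ a a′ 1 0 λ ()))
  probe-χ 1 a a′ (s≤s z≤n) = trans (evaluate-unit (ℂ R) (χ-on a′ 1) _)
    (trans (unit-halfway a′ a) (=?-× a a′ 1 ≡.refl))
  -- The coefficients tested later belong to arbitrary monomials, so lengths above 1 occur on the
  -- probe side; the empty combination is correct there because `k′` is at most 1.
  probe-χ (suc (suc k)) a {k′} a′ k′≤1 =
    =?-≢ a a′ (suc (suc k)) k′ λ { ≡.refl → ℕ.<⇒≱ (s≤s (s≤s z≤n)) k′≤1 }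

-- Exponent vectors and normal monomials.

module Exponents (n : ℕ) where
  infixl 7 _∙_

  _∙_ : Vec ℕ n → Vec ℕ n → Vec ℕ n
  _∙_ = Vec.zipWith ℕ._+_

  one : Vec ℕ n
  one = Vec.replicate n 0

  unit : Fin n → Vec ℕ n
  unit k = one Vec.[ k ]≔ 1

  lookup-∙ : ∀ k m m′ → Vec.lookup (m ∙ m′) k ≡ Vec.lookup m k ℕ.+ Vec.lookup m′ k
  lookup-∙ = Vec.lookup-zipWith ℕ._+_

  lookup-one : ∀ k → Vec.lookup one k ≡ 0
  lookup-one k = Vec.lookup-replicate k 0

  lookup-unit : ∀ k → Vec.lookup (unit k) k ≡ 1
  lookup-unit k = Vec.lookup∘update k one 1

  lookup-unit-≢ : ∀ {k l} → l ≢ k → Vec.lookup (unit k) l ≡ 0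
  lookup-unit-≢ {l = l} l≢k = ≡.trans (Vec.lookup∘update′ l≢k one 1) (lookup-one l)

  lookup-ext : ∀ {m m′ : Vec ℕ n} → (∀ k → Vec.lookup m k ≡ Vec.lookup m′ k) → m ≡ m′
  lookup-ext {m} {m′} eq =
    ≡.trans (≡.sym (Vec.tabulate∘lookup m)) (≡.trans (Vec.tabulate-cong eq) (Vec.tabulate∘lookup m′))

module _ where
  open Exponents using (one; unit)

  monomial-induction : ∀ {n q} (Q : Vec ℕ n → Set q) → Q (one n) →
    (∀ k m → Q m → Q (Vec.zipWith ℕ._+_ (unit n k) m)) → ∀ m → Q m
  monomial-induction Q q₁ q× []      = q₁
  monomial-induction Q q₁ q× (a ∷ m) = raise a
    where
    -- The tail is built first, under head exponent 0; then the head variable is multiplied in `a`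
    -- times.
    raise : ∀ a → Q (a ∷ m)
    raise zero    = monomial-induction (λ m → Q (0 ∷ m)) q₁ (λ k m → q× (suc k) (0 ∷ m)) m
    raise (suc a) = ≡.subst (λ m → Q (suc a ∷ m)) (Vec.zipWith-identityˡ (λ _ → ≡.refl) m) (q× zero (a ∷ m) (raise a))

module PairedExponents (d : ℕ) where
  open Exponents (d ℕ.+ d) public

  X Y : Vec ℕ (d ℕ.+ d) → Vector ℕ d
  X m i = Vec.lookup m (i Fin.↑ˡ d)
  Y m i = Vec.lookup m (d Fin.↑ʳ i)

  ↑ˡ≢↑ʳ : ∀ {i j : Fin d} → i Fin.↑ˡ d ≢ d Fin.↑ʳ j
  ↑ˡ≢↑ʳ {i} {j} eq with () ← ≡.trans (≡.sym (Fin.splitAt-↑ˡ d i d)) (≡.trans (≡.cong (Fin.splitAt d) eq) (Fin.splitAt-↑ʳ d d j))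

  ↑-elim : ∀ {q} (Q : Fin (d ℕ.+ d) → Set q) → (∀ i → Q (i Fin.↑ˡ d)) → (∀ i → Q (d Fin.↑ʳ i)) → ∀ k → Q k
  ↑-elim Q left right k with Fin.splitAt d k in eq
  ... | inj₁ i = ≡.subst Q (Fin.splitAt⁻¹-↑ˡ eq) (left i)
  ... | inj₂ i = ≡.subst Q (Fin.splitAt⁻¹-↑ʳ eq) (right i)

  XY-ext : ∀ {m m′} → (∀ i → X m i ≡ X m′ i) → (∀ i → Y m i ≡ Y m′ i) → m ≡ m′
  XY-ext X≡ Y≡ = lookup-ext (↑-elim _ X≡ Y≡)

  X-unit-x : ∀ i → X (unit (i Fin.↑ˡ d)) i ≡ 1
  X-unit-x i = lookup-unit (i Fin.↑ˡ d)

  X-unit-x-≢ : ∀ {i j} → j ≢ i → X (unit (i Fin.↑ˡ d)) j ≡ 0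
  X-unit-x-≢ j≢i = lookup-unit-≢ (j≢i ∘ Fin.↑ˡ-injective d _ _)

  Y-unit-x : ∀ i j → Y (unit (i Fin.↑ˡ d)) j ≡ 0
  Y-unit-x i j = lookup-unit-≢ (↑ˡ≢↑ʳ ∘ ≡.sym)

  X-unit-y : ∀ i j → X (unit (d Fin.↑ʳ i)) j ≡ 0
  X-unit-y i j = lookup-unit-≢ ↑ˡ≢↑ʳ

  Y-unit-y : ∀ i → Y (unit (d Fin.↑ʳ i)) i ≡ 1
  Y-unit-y i = lookup-unit (d Fin.↑ʳ i)

  Y-unit-y-≢ : ∀ {i j} → j ≢ i → Y (unit (d Fin.↑ʳ i)) j ≡ 0
  Y-unit-y-≢ j≢i = lookup-unit-≢ (j≢i ∘ Fin.↑ʳ-injective d _ _)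

  Normal : Vec ℕ (d ℕ.+ d) → Set
  Normal m = ∀ i → Y m i ≤ 1

  normal-x : ∀ i {m} → Normal m → Normal (unit (i Fin.↑ˡ d) ∙ m)
  normal-x i {m} nm j = ℕ.≤-trans
    (ℕ.≤-reflexive (≡.trans (lookup-∙ _ (unit (i Fin.↑ˡ d)) m) (≡.cong (ℕ._+ Y m j) (Y-unit-x i j)))) (nm j)

  normal-y : ∀ i {m} → Normal m → Y m i ≡ 0 → Normal (unit (d Fin.↑ʳ i) ∙ m)
  normal-y i {m} nm Y≡0 j = ℕ.≤-trans (ℕ.≤-reflexive (lookup-∙ _ (unit (d Fin.↑ʳ i)) m)) sum≤1
    where
    sum≤1 : Y (unit (d Fin.↑ʳ i)) j ℕ.+ Y m j ≤ 1
    sum≤1 with j Fin.≟ i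
    ... | yes ≡.refl = ℕ.≤-reflexive (≡.cong₂ ℕ._+_ (Y-unit-y i) Y≡0)
    ... | no  j≢i    = ℕ.≤-trans (ℕ.≤-reflexive (≡.cong (ℕ._+ Y m j) (Y-unit-y-≢ j≢i))) (nm j)

  lower : Fin d → Vec ℕ (d ℕ.+ d) → Vec ℕ (d ℕ.+ d)
  lower i m = m Vec.[ d Fin.↑ʳ i ]≔ 0

  normal-lower : ∀ i {m} → Normal m → Normal (lower i m)
  normal-lower i {m} nm j with j Fin.≟ i
  ... | yes ≡.refl = ℕ.≤-trans (ℕ.≤-reflexive (Vec.lookup∘update (d Fin.↑ʳ i) m 0)) z≤n
  ... | no  j≢i    = ℕ.≤-trans (ℕ.≤-reflexive (Vec.lookup∘update′ (j≢i ∘ Fin.↑ʳ-injective d _ _) m 0)) (nm j)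

  -- Splits off the one factor yᵢ, so that the relation can be applied once a second factor yᵢ
  -- arrives.
  unit-∙-lower : ∀ i m → Y m i ≡ 1 → m ≡ unit (d Fin.↑ʳ i) ∙ lower i m
  unit-∙-lower i m Y≡1 = lookup-ext eq
    where
    eq : ∀ k → Vec.lookup m k ≡ Vec.lookup (unit (d Fin.↑ʳ i) ∙ lower i m) k
    eq k with k Fin.≟ (d Fin.↑ʳ i)
    ... | yes ≡.refl = ≡.trans Y≡1 (≡.sym (≡.trans (lookup-∙ k (unit k) (lower i m))
                         (≡.cong₂ ℕ._+_ (lookup-unit k) (Vec.lookup∘update k m 0))))
    ... | no  k≢     = ≡.sym (≡.trans (lookup-∙ k (unit (d Fin.↑ʳ i)) (lower i m))
                         (≡.cong₂ ℕ._+_ (lookup-unit-≢ k≢) (Vec.lookup∘update′ k≢ m 0)))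

-- The relations and normal forms modulo them.

module _ {c ℓ} (R : CommutativeRing c ℓ) where
  open CommutativeRing R
  open Solver R using (solve; _:=_; _:+_; _:*_; _:-_)

  -- A multiple of the relation, written as leading term minus replacement: modulo the ideal, y²z
  -- becomes yz + xyz - xz.
  relation-* : ∀ x y z → z * ((y - 1#) * (y - x)) ≈ y * (y * z) - (y * z + x * (y * z) - x * z)
  relation-* x y z = trans
    -- The identity holds with any `o` in place of 1; the factors 1 it leaves behind are removed
    -- afterwards.
    (solve 4 (λ x y z o → z :* ((y :- o) :* (y :- x)) := y :* (y :* z) :- (o :* (y :* z) :+ x :* (y :* z) :- o :* (x :* z)))
      refl x y z 1#)
    (+-congˡ (-‿cong (+-cong (+-congʳ (*-identityˡ _)) (-‿cong (*-identityˡ _)))))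

  -- The subtraction-free form y² + x = y + xy, which for y = [0,1] and x = {1} is `interval-split`.
  relation-expanded : ∀ x y → (y - 1#) * (y - x) ≈ (y * y + x) - (y + x * y)
  relation-expanded x y = trans
    (solve 3 (λ x y o → (y :- o) :* (y :- x) := (y :* y :+ o :* x) :- (o :* y :+ x :* y)) refl x y 1#)
    (+-cong (+-congˡ (*-identityˡ x)) (-‿cong (+-congʳ (*-identityˡ y))))

module NormalForms (R : CompleteOrderedField) (d : ℕ) where
  open MinkowskiRing R hiding (M; M𝓟; 𝓑⁺; module BoxPresentation)
  open MinkowskiRing.BoxPresentation R d using (x; y)
  open PairedExponents d
  open FormalSums (ℂ R) _∙_ one using (FormalSum)
  private
    module ℂ = CommutativeRing (ℂ R)
    module P = Algebra (BoxPolynomials R d)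
    module Q = Algebra (quotient (BoxPolynomials R d) (boxRelation R d))
    module toQ = Hom (quotientHom (BoxPolynomials R d) (boxRelation R d))

  HasNormalForm : FormalSum → Set
  HasNormalForm f = ∃ λ g → All (Normal ∘ proj₂) g × f Q.≈ g

  private
    hnf-resp : ∀ {f g} → f Q.≈ g → HasNormalForm g → HasNormalForm f
    hnf-resp {f} {g} f≈g (h , normal , g≈h) = h , normal , Q.trans {f} {g} {h} f≈g g≈h

    hnf-normal : ∀ {f} → All (Normal ∘ proj₂) f → HasNormalForm f
    hnf-normal {f} normal = f , normal , Q.refl {f}

    hnf-++ : ∀ {f g} → HasNormalForm f → HasNormalForm g → HasNormalForm (f ++ g)
    hnf-++ {f} {g} (f′ , nf , f≈f′) (g′ , ng , g≈g′) = f′ ++ g′ , All.++⁺ nf ng , Q.+-cong {f} {f′} {g} {g′} f≈f′ g≈g′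

    var-* : ∀ k c m → var (ℂ R) (d ℕ.+ d) k P.* ((c , m) ∷ []) P.≈ (c , unit k ∙ m) ∷ []
    var-* k c m t = ℂ.+-congʳ {ℂ.0#} (ℂ.*-congʳ (ℂ.*-identityˡ c))

    y²-reduces : ∀ i z → y i P.* (y i P.* z) Q.≈ y i P.* z P.+ x i P.* (y i P.* z) P.- x i P.* z
    y²-reduces i z = resp {x = z P.* boxRelation R d i} (relation-* P.commutativeRing (x i) (y i) z) (mul z (gen i))

    hnf-negate : ∀ {f} → HasNormalForm f → HasNormalForm (P.- f)
    hnf-negate {f} (f′ , normal , f≈f′) = P.- f′ , All.map⁺ normal , Q.-‿cong {f} {f′} f≈f′

    hnf-var-normal : ∀ k {g} → All (λ (_ , m) → Normal (unit k ∙ m)) g → HasNormalForm (var (ℂ R) (d ℕ.+ d) k P.* g)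
    hnf-var-normal k {g} normal = hnf-normal (All.++⁺ (All.map⁺ normal) [])

    hnf-y² : ∀ i z → All (λ (_ , m) → Normal (unit (d Fin.↑ʳ i) ∙ m)) z → All (Normal ∘ proj₂) z →
             HasNormalForm (y i P.* (y i P.* z))
    hnf-y² i z n n′ = hnf-resp {y i P.* (y i P.* z)} {y i P.* z P.+ x i P.* (y i P.* z) P.- x i P.* z} (y²-reduces i z)
      (hnf-++ {y i P.* z P.+ x i P.* (y i P.* z)} {P.- (x i P.* z)}
        (hnf-++ {y i P.* z} {x i P.* (y i P.* z)} (hnf-var-normal (d Fin.↑ʳ i) n)
          (hnf-var-normal (i Fin.↑ˡ d) {y i P.* z} (All.++⁺ (All.map⁺ (All.map (normal-x i) n)) [])))
        (hnf-negate {x i P.* z} (hnf-var-normal (i Fin.↑ˡ d) (All.map (normal-x i) n′))))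

    var-*-var : ∀ k c m → (c , unit k ∙ (unit k ∙ m)) ∷ [] P.≈
      var (ℂ R) (d ℕ.+ d) k P.* (var (ℂ R) (d ℕ.+ d) k P.* ((c , m) ∷ []))
    var-*-var k c m t =
      ℂ.+-congʳ {ℂ.0#} (ℂ.*-congʳ (ℂ.sym (ℂ.trans (ℂ.*-identityˡ (ℂ.1# ℂ.* c)) (ℂ.*-identityˡ c))))

    -- A normal monomial times yᵢ has exponent at most 2 in yᵢ. One use of the relation then
    -- suffices, because yz, xyz and xz are normal when z is normal and free of yᵢ. Multiplying in
    -- one variable at a time thus needs no termination measure for the rewriting.
    hnf-y : ∀ i c {m} → Normal m → HasNormalForm ((c , unit (d Fin.↑ʳ i) ∙ m) ∷ [])
    hnf-y i c {m} nm = cases (Y m i) ≡.refl (nm i)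
      where
      u = unit (d Fin.↑ʳ i)
      z = (c , lower i m) ∷ []

      cases : ∀ k → Y m i ≡ k → k ≤ 1 → HasNormalForm ((c , u ∙ m) ∷ [])
      cases 0 eq _         = hnf-normal (normal-y i nm eq ∷ [])
      cases 1 eq (s≤s z≤n) = ≡.subst (λ m′ → HasNormalForm ((c , u ∙ m′) ∷ [])) (≡.sym (unit-∙-lower i m eq))
        (hnf-resp {(c , u ∙ (u ∙ lower i m)) ∷ []} {y i P.* (y i P.* z)}
          (toQ.cong {(c , u ∙ (u ∙ lower i m)) ∷ []} {y i P.* (y i P.* z)} (var-*-var (d Fin.↑ʳ i) c (lower i m)))
          (hnf-y² i z (≡.subst Normal (unit-∙-lower i m eq) nm ∷ []) (normal-lower i {m} nm ∷ [])))

    hnf-var-term : ∀ k c {m} → Normal m → HasNormalForm ((c , unit k ∙ m) ∷ [])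
    hnf-var-term = ↑-elim _ (λ i c nm → hnf-normal (normal-x i nm ∷ [])) hnf-y

    hnf-var-* : ∀ k {g} → All (Normal ∘ proj₂) g → HasNormalForm (var (ℂ R) (d ℕ.+ d) k P.* g)
    hnf-var-* k []                     = hnf-normal []
    hnf-var-* k {(c , m) ∷ g} (n ∷ ns) = hnf-++ (hnf-var-term k (ℂ.1# ℂ.* c) n) (hnf-var-* k ns)

    hnf-var : ∀ k {f} → HasNormalForm f → HasNormalForm (var (ℂ R) (d ℕ.+ d) k P.* f)
    hnf-var k {f} (g , normal , f≈g) = hnf-resp {v P.* f} {v P.* g} (Q.*-congˡ {v} {f} {g} f≈g) (hnf-var-* k normal)
      where v = var (ℂ R) (d ℕ.+ d) k

    hnf-term : ∀ m c → HasNormalForm ((c , m) ∷ [])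
    hnf-term = monomial-induction _
      (λ c → hnf-normal ((λ i → ℕ.≤-trans (ℕ.≤-reflexive (lookup-one (d Fin.↑ʳ i))) z≤n) ∷ []))
      λ k m hnf c → hnf-resp {(c , unit k ∙ m) ∷ []} {var (ℂ R) (d ℕ.+ d) k P.* ((c , m) ∷ [])}
        (toQ.cong {(c , unit k ∙ m) ∷ []} {var (ℂ R) (d ℕ.+ d) k P.* ((c , m) ∷ [])}
          (P.sym {var (ℂ R) (d ℕ.+ d) k P.* ((c , m) ∷ [])} {(c , unit k ∙ m) ∷ []} (var-* k c m)))
        (hnf-var k (hnf c))

  normalForm : ∀ f → HasNormalForm f
  normalForm []            = hnf-normal []
  normalForm ((c , m) ∷ f) = hnf-++ (hnf-term m c) (normalForm f)

-- Linear independence of the boxes of normal monomials.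

module Separation (R : CompleteOrderedField) (d : ℕ) where
  open CompleteOrderedField R using () renaming (Carrier to ℝ)
  open MinkowskiRing R hiding (M; M𝓟; 𝓑⁺; module BoxPresentation)
  open PairedExponents d
  open Cells R
  open Probes R
  open Indicator (ℂ R)
  open IndicatorProducts (ℂ R)
  open Products (ℂ R)
  open Evaluation (ℂ R)
  open CommutativeRing (ℂ R) hiding (zero)
  open NormalForms R d using (normalForm)
  open Polynomials (ℂ R) (d ℕ.+ d) using (FormalSum; δ; coefficient; _≟_)
  private
    module P = Algebra (BoxPolynomials R d)
    module Pᵣ = RingProperties P.ring

  χ-cell : ∀ {n} (α β : Vector ℕ n) w → χ (cell α β) w ≈ ∏ (λ i → χ (interval (α i) (β i)) (λ _ → w i))
  χ-cell α β w = sym (∏-indicator (λ i → member? (interval (α i) (β i)) (λ _ → w i)) (member? (cell α β) w)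
    (λ p i _ → p i) (λ p i → p i zero))

  cellSum : Vector ℝ d → FormalSum → Carrier
  cellSum w = evaluate (λ m → χ (cell (X m) (Y m)) w)

  private
    evaluate-cong-All : ∀ {h k : Vec ℕ (d ℕ.+ d) → Carrier} {f} →
      All (λ (_ , m) → h m ≈ k m) f → evaluate h f ≈ evaluate k f
    evaluate-cong-All []                          = refl
    evaluate-cong-All {f = (c , m) ∷ f} (p ∷ ps)  = +-cong (*-congˡ {c} p) (evaluate-cong-All ps)

    -- Monomials are compared coordinate by coordinate, so the coefficient functional of `m` is, on
    -- normal monomials, the product of the probes dual to its sides. The factor `1#` is the initial
    -- `k` of `evaluate-∏`.
    probe-normal : ∀ m {m′} → Normal m′ →
      δ m m′ ≈ 1# * ∏ (λ i → evaluate (λ t → χ (interval (X m′ i) (Y m′ i)) (λ _ → t)) (probe (Y m i) (X m i)))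
    probe-normal m {m′} normal = sym (trans (*-identityˡ _) (trans
      (∏-cong (λ i → probe-χ (Y m i) (X m i) (X m′ i) (normal i)))
      (∏-indicator (λ i → (X m i ℕ.≟ X m′ i) ×-dec (Y m i ℕ.≟ Y m′ i)) (m ≟ m′)
        (λ { ≡.refl i → ≡.refl , ≡.refl }) (λ eq → XY-ext (proj₁ ∘ eq) (proj₂ ∘ eq)))))

    -- The coefficient of `m` is the integral of `w ↦ cellSum w g` against the product of the probes
    -- of `m`, so it vanishes with that function.
    normal-independent : ∀ g → All (Normal ∘ proj₂) g → (∀ w → cellSum w g ≈ 0#) → ∀ m → coefficient m g ≈ 0#
    normal-independent g normal g≈0 m = trans
      (evaluate-cong-All (All.map (λ {(_ , m′)} n → probe-normal m {m′} n) normal))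
      (evaluate-∏ (ℂ R) d (λ _ → 1#) (λ m′ i t → χ (interval (X m′ i) (Y m′ i)) (λ _ → t)) (λ i → probe (Y m i) (X m i)) g
        λ t → trans (evaluate-cong (λ m′ → trans (*-identityˡ _) (sym (χ-cell (X m′) (Y m′) t))) g) (g≈0 t))

  -- Let g be a normal form of p. Since p - g lies in the ideal, its values vanish, hence so do
  -- those of g; by independence g is the zero polynomial, and p equals p - g. The hypothesis is
  -- supplied later by way of ψ.
  vanishing⇒ideal : (∀ {p} → Ideal (BoxPolynomials R d) (boxRelation R d) p → ∀ w → cellSum w p ≈ 0#) →
                    ∀ p → (∀ w → cellSum w p ≈ 0#) → Ideal (BoxPolynomials R d) (boxRelation R d) p
  vanishing⇒ideal ideal⇒vanishing p p≈0 =
    let g , normal , p≈g = normalForm p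
        cellSum-difference : ∀ w → cellSum w (p P.- g) ≈ cellSum w p - cellSum w g
        cellSum-difference w = trans (evaluate-++ _ p (P.- g)) (+-congˡ (FormalSums.evaluate-negate (ℂ R) _∙_ one _ g))
        g≈0 : ∀ w → cellSum w g ≈ 0#
        g≈0 w = trans (sym (Kᵣ.x∙y⁻¹≈ε⇒x≈y _ _ (trans (sym (cellSum-difference w)) (ideal⇒vanishing p≈g w)))) (p≈0 w)
    in resp {x = p P.- g} {y = p} (P.trans {p P.- g} {p P.- P.0#} {p}
         (P.+-congˡ {p} {P.- g} {P.- P.0#} (P.-‿cong {g} {P.0#} (normal-independent g normal g≈0)))
         (P.+-identityʳ p)) p≈g
    where module Kᵣ = RingProperties ring

-- The map φ.

module BoxMap (R : CompleteOrderedField) (d : ℕ) where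
  open MinkowskiRing R hiding (M; M𝓟; 𝓑⁺; module BoxPresentation)
  open MinkowskiRing.BoxPresentation R d using (x; y)
  open PairedExponents d
  open Vectors R using (e)
  open Cells R
  open Separation R d using (cellSum)
  private
    module R = CompleteOrderedField R
    module ℂ = CommutativeRing (ℂ R)
    module 𝓟 = Algebra (M𝓟Ring R d)
    module MB = Algebra (MRing R (Boxes R d))

    monomialBox : Vec ℕ (d ℕ.+ d) → Polyhedron d
    monomialBox m = cell (X m) (Y m)

    boxElement : Vec ℕ (d ℕ.+ d) → MB.Carrier
    boxElement m = [ monomialBox m ] , gen (monomialBox m , cell∈𝓑⁺ (X m) (Y m) , ≡.refl)

    boxElement-one : boxElement one MB.≈ MB.1#
    boxElement-one = []-cong (monomialBox one) (singleton origin)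
      ( (λ p → proj₁ cell-origin (proj₁ zeros p)) , (λ p → proj₂ zeros (proj₂ cell-origin p)))
      where
      zeros = cell-cong {d} {X one} {λ _ → 0} {Y one} {λ _ → 0}
        (λ i → lookup-one (i Fin.↑ˡ d)) (λ i → lookup-one (d Fin.↑ʳ i))

    boxElement-∙ : ∀ m m′ → boxElement (m ∙ m′) MB.≈ boxElement m MB.* boxElement m′
    boxElement-∙ m m′ = 𝓟.trans {[ monomialBox (m ∙ m′) ]} {[ B ]} {[ monomialBox m ] 𝓟.* [ monomialBox m′ ]}
      ([]-cong (monomialBox (m ∙ m′)) B (cell-cong {α = X (m ∙ m′)} {_} {Y (m ∙ m′)}
        (λ i → lookup-∙ (i Fin.↑ˡ d) m m′) (λ i → lookup-∙ (d Fin.↑ʳ i) m m′)))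
      ([cell]-* (X m) (Y m) (X m′) (Y m′))
      where
      B = cell (λ i → X m i ℕ.+ X m′ i) (λ i → Y m i ℕ.+ Y m′ i)

  open Lift (ℂ R) (d ℕ.+ d) (MRing R (Boxes R d))

  φ : AlgebraHom (BoxPolynomials R d) (MRing R (Boxes R d))
  φ = lift boxElement boxElement-one boxElement-∙

  private module φ = Hom φ

  φ-value : ∀ w p → LinearFunctional.⟨_⟩ (pointValue (Boxes R d) w) φ.⟦ p ⟧ ℂ.≈ cellSum w p
  φ-value w p = ℂ.trans (linear-functional boxElement (pointValue (Boxes R d) w) p)
    (Evaluation.evaluate-cong (ℂ R) (λ m → pointValue-[] (monomialBox m) w) p)

  φ-x : ∀ i → proj₁ φ.⟦ x i ⟧ 𝓟.≈ [ singleton (e i) ]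
  φ-x i = 𝓟.trans {proj₁ φ.⟦ x i ⟧} {[ monomialBox u ]} {[ singleton (e i) ]}
    (lift-monomial boxElement boxElement-one boxElement-∙ u)
    ([]-cong (monomialBox u) (singleton (e i))
      ((λ p j → R.antisym (R.≤-respʳ-≈ (right j) (proj₂ (p j))) (R.≤-respˡ-≈ (left j) (proj₁ (p j)))) ,
       (λ w≋e j → R.≤-reflexive (R.trans (left j) (R.sym (w≋e j))) , R.≤-reflexive (R.trans (w≋e j) (R.sym (right j))))))
    where
    u = unit (i Fin.↑ˡ d)

    left : ∀ j → R.fromℕ (X u j) R.≈ e i j
    left j with j Fin.≟ i
    ... | yes ≡.refl = R.trans (R.reflexive (≡.cong R.fromℕ (X-unit-x j))) (R.+-identityʳ R.1#)
    ... | no  j≢i    = R.reflexive (≡.cong R.fromℕ (X-unit-x-≢ j≢i))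

    right : ∀ j → R.fromℕ (X u j ℕ.+ Y u j) R.≈ e i j
    right j = R.trans (R.reflexive (≡.cong R.fromℕ
      (≡.trans (≡.cong (X u j ℕ.+_) (Y-unit-x i j)) (ℕ.+-identityʳ (X u j))))) (left j)

  φ-y : ∀ i → proj₁ φ.⟦ y i ⟧ 𝓟.≈ [ projectedCube i ]
  φ-y i = 𝓟.trans {proj₁ φ.⟦ y i ⟧} {[ monomialBox u ]} {[ projectedCube i ]}
    (lift-monomial boxElement boxElement-one boxElement-∙ u)
    ([]-cong (monomialBox u) (projectedCube i)
      ((λ p → proj₂ (described (projectedCube i)) (proj₁ (described (box origin (e i)))
          (λ j → R.≤-respˡ-≈ (left j) (proj₁ (p j)) , R.≤-respʳ-≈ (right j) (proj₂ (p j))))) ,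
       (λ p j → let q = proj₂ (described (box origin (e i))) (proj₁ (described (projectedCube i)) p) j in
          R.≤-respˡ-≈ (R.sym (left j)) (proj₁ q) , R.≤-respʳ-≈ (R.sym (right j)) (proj₂ q))))
    where
    u = unit (d Fin.↑ʳ i)

    left : ∀ j → R.fromℕ (X u j) R.≈ R.0#
    left j = R.reflexive (≡.cong R.fromℕ (X-unit-y i j))

    right : ∀ j → R.fromℕ (X u j ℕ.+ Y u j) R.≈ e i j
    right j with j Fin.≟ i
    ... | yes ≡.refl = R.trans (R.reflexive (≡.cong R.fromℕ (≡.cong₂ ℕ._+_ (X-unit-y j j) (Y-unit-y j)))) (R.+-identityʳ R.1#)
    ... | no  j≢i    = R.reflexive (≡.cong R.fromℕ (≡.cong₂ ℕ._+_ (X-unit-y i j) (Y-unit-y-≢ j≢i)))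

  -- An element carries a witness of its generation, so a preimage is found by recursion on it; a
  -- box with corners a and b comes from the monomial with exponents a and b - a.
  φ-image : ∀ f → φ.Image f
  φ-image (f , f∈) = image f∈
    where
    image : ∀ {f} (f∈ : f ∈M Boxes R d) → φ.Image (f , f∈)
    image (gen (P , P∈ , ≡.refl)) =
      let α , β , P⊆ , ⊆P = 𝓑⁺⇒cell P P∈
          m = Vec.tabulate α Vec.++ Vec.tabulate β
          c⊆ , ⊆c = cell-cong {d} {X m} {α} {Y m} {β}
            (λ i → ≡.trans (Vec.lookup-++ˡ (Vec.tabulate α) (Vec.tabulate β) i) (Vec.lookup∘tabulate α i))
            (λ i → ≡.trans (Vec.lookup-++ʳ (Vec.tabulate α) (Vec.tabulate β) i) (Vec.lookup∘tabulate β i))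
      in (ℂ.1# , m) ∷ [] , 𝓟.trans {proj₁ φ.⟦ (ℂ.1# , m) ∷ [] ⟧} {[ monomialBox m ]} {[ P ]}
           (lift-monomial boxElement boxElement-one boxElement-∙ m)
           ([]-cong (monomialBox m) P ((λ p → ⊆P (c⊆ p)) , (λ p → ⊆c (P⊆ p))))
    image (scal k)           = φ.image-ι k
    image (add f∈ g∈)        = φ.image-+ {_ , f∈} {_ , g∈} (image f∈) (image g∈)
    image (mul f∈ g∈)        = φ.image-* {_ , f∈} {_ , g∈} (image f∈) (image g∈)
    image (resp {f} {g} f≈g f∈) = φ.image-resp {f , f∈} {g , resp f≈g f∈} f≈g (image f∈)

-- Generators in dimension one.

module PointAndInterval (R : CompleteOrderedField) where
  open MinkowskiRing R hiding (M; M𝓟; 𝓑⁺; module BoxPresentation)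
  open Cells R
  private
    module R = CompleteOrderedField R
    module ℂ = CommutativeRing (ℂ R)
    module 𝓟 = Algebra (M𝓟Ring R 1)

  -- The intermediary between the two generating families of the theorem. Its two elements
  -- correspond to x and y, so that induction over it also yields surjectivity of ψ.
  data Basic : Pred 𝓟.Carrier 0ℓ where
    point   : Basic [ interval 1 0 ]
    segment : Basic [ interval 0 1 ]

  point-and-interval : Pred (Polyhedron 1) (lsuc 0ℓ)
  point-and-interval = finite (singleton (λ _ → R.1#) ∷ box origin (λ _ → R.1#) ∷ [])

  private
    1# = R.+-identityʳ R.1#

    point≐ : points (singleton (λ _ → R.1#)) ≐ points (interval 1 0)
    point≐ = (λ w≋1 i → R.≤-reflexive (R.trans 1# (R.sym (w≋1 i))) , R.≤-reflexive (R.trans (w≋1 i) (R.sym 1#))) ,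
             (λ p i → R.trans (R.antisym (proj₂ (p i)) (proj₁ (p i))) 1#)

    interval≐ : points (box origin (λ _ → R.1#)) ≐ points (interval 0 1)
    interval≐ = (λ p i → proj₁ (p i) , R.≤-respʳ-≈ (R.sym 1#) (proj₂ (p i))) ,
                (λ p i → proj₁ (p i) , R.≤-respʳ-≈ 1# (proj₂ (p i)))

    -- With equations, since conversion checking would unfold an interval whose
    -- exponents differ syntactically.
    step : ∀ a k a₁ k₁ a₂ k₂ → a ≡ a₁ ℕ.+ a₂ → k ≡ k₁ ℕ.+ k₂ →
           Generated (M𝓟Ring R 1) Basic [ interval a₁ k₁ ] → Generated (M𝓟Ring R 1) Basic [ interval a₂ k₂ ] →
           Generated (M𝓟Ring R 1) Basic [ interval a k ]
    step a k a₁ k₁ a₂ k₂ ≡.refl ≡.refl p q = resp (𝓟.sym {[ interval a k ]} {[ interval a₁ k₁ ] 𝓟.* [ interval a₂ k₂ ]}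
      ([cell]-* (λ _ → a₁) (λ _ → k₁) (λ _ → a₂) (λ _ → k₂))) (mul p q)

    base : Generated (M𝓟Ring R 1) Basic [ interval 0 0 ]
    base = resp {x = [ singleton origin ]} {y = [ interval 0 0 ]}
      ([]-cong (singleton origin) (interval 0 0) (≐-sym cell-origin)) (resp {x = 𝓟.ι ℂ.1#} {y = 𝓟.1#} 𝓟.ι-1# (scal ℂ.1#))

    lattice-induction : ∀ {q} (Q : ℕ → ℕ → Set q) → Q 0 0 → (∀ k → Q 0 k → Q 0 (suc k)) →
                        (∀ a k → Q a k → Q (suc a) k) → ∀ a k → Q a k
    lattice-induction Q base up right zero    zero    = base
    lattice-induction Q base up right zero    (suc k) = up k (lattice-induction Q base up right zero k)
    lattice-induction Q base up right (suc a) k       = right a k (lattice-induction Q base up right a k)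

  basic-interval : ∀ a k → Generated (M𝓟Ring R 1) Basic [ interval a k ]
  basic-interval = lattice-induction (λ a k → Generated (M𝓟Ring R 1) Basic [ interval a k ]) base
    (λ k → step 0 (suc k) 0 1 0 k ≡.refl ≡.refl (gen segment))
    (λ a k → step (suc a) k 1 0 a k ≡.refl ≡.refl (gen point))

  private
    basic⁺ : ∀ {ℓ} {𝒟 : Pred (Polyhedron 1) ℓ} {P} → 𝒟 P → ∀ a k → points P ≐ points (interval a k) →
             [ interval a k ] ∈M 𝒟
    basic⁺ {P = P} P∈ a k P≐ = resp ([]-cong P (interval a k) P≐) (gen (P , P∈ , ≡.refl))

    basic⁻ : ∀ P a k → points P ≐ points (interval a k) → Generated (M𝓟Ring R 1) Basic [ P ]
    basic⁻ P a k (P⊆ , ⊆P) = resp ([]-cong (interval a k) P (⊆P , P⊆)) (basic-interval a k)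

  -- All that the construction of ψ asks of 𝒟, so both tensor powers of the theorem are treated by
  -- the same argument.
  BasicallyGenerated : ∀ {ℓ} → Pred (Polyhedron 1) ℓ → Set (lsuc 0ℓ ⊔ ℓ)
  BasicallyGenerated 𝒟 = (_∈M 𝒟) ≐ Generated (M𝓟Ring R 1) Basic

  -- Stated up to an equation, so that unification can choose 𝒟 syntactically.
  𝓑⁺-basic : ∀ {𝒟} → 𝒟 ≡ Boxes R 1 → BasicallyGenerated 𝒟
  𝓑⁺-basic ≡.refl =
    generated-⊆ (M𝓟Ring R 1) (λ { (P , P∈ , ≡.refl) → let a , k , P≐ = 𝓑⁺⇒interval P P∈ in basic⁻ P a k P≐ }) ,
    generated-⊆ (M𝓟Ring R 1) λ { point   → basic⁺ {P = interval 1 0} (cell∈𝓑⁺ (λ _ → 1) (λ _ → 0)) 1 0 ≐-refl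
                             ; segment → basic⁺ {P = interval 0 1} (cell∈𝓑⁺ (λ _ → 0) (λ _ → 1)) 0 1 ≐-refl }

  point-and-interval-basic : ∀ {𝒟} → 𝒟 ≡ point-and-interval → BasicallyGenerated 𝒟
  point-and-interval-basic ≡.refl =
    generated-⊆ (M𝓟Ring R 1) (λ
      { (P , here P≐         , ≡.refl) → basic⁻ P 1 0 (≐-trans P≐ point≐)
      ; (P , there (here P≐) , ≡.refl) → basic⁻ P 0 1 (≐-trans P≐ interval≐) }) ,
    generated-⊆ (M𝓟Ring R 1) λ { point   → basic⁺ {P = singleton (λ _ → R.1#)} (here ≐-refl) 1 0 point≐
                             ; segment → basic⁺ {P = box origin (λ _ → R.1#)} (there (here ≐-refl)) 0 1 interval≐ }

  ∈M-≐ : ∀ {ℓ₁ ℓ₂} {𝒟 : Pred (Polyhedron 1) ℓ₁} {𝓔 : Pred (Polyhedron 1) ℓ₂} →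
         BasicallyGenerated 𝒟 → BasicallyGenerated 𝓔 → (_∈M 𝒟) ≐ (_∈M 𝓔)
  ∈M-≐ (𝒟⊆ , ⊆𝒟) (𝓔⊆ , ⊆𝓔) = (λ f∈ → ⊆𝓔 (𝒟⊆ f∈)) , (λ f∈ → ⊆𝒟 (𝓔⊆ f∈))

-- The map ψ.

module TensorMap (R : CompleteOrderedField) (d : ℕ) {ℓ} (𝒟 : Pred (MinkowskiRing.Polyhedron R 1) ℓ)
                 (basic : PointAndInterval.BasicallyGenerated R 𝒟) where
  open MinkowskiRing R hiding (M; M𝓟; 𝓑⁺; module BoxPresentation)
  open MinkowskiRing.BoxPresentation R d using (x; y)
  open PairedExponents d
  open Cells R
  open PointAndInterval R
  open Separation R d using (cellSum; χ-cell)
  private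
    module ℂ = CommutativeRing (ℂ R)
    module 𝓟 = Algebra (M𝓟Ring R 1)
    module M𝒟 = Algebra (MRing R 𝒟)
    module T = Algebra (⨂ {d = d} (λ _ → MRing R 𝒟))
    module P = Algebra (BoxPolynomials R d)
  open Tensors {d = d} (λ _ → MRing R 𝒟)
  open TensorProduct {d = d} (λ _ → MRing R 𝒟) using (PureTensor; pure-cong)
  open Lift (ℂ R) (d ℕ.+ d) (⨂ {d = d} (λ _ → MRing R 𝒟))

  private
    -- Opaque, since conversion checking would otherwise compare the half-spaces of
    -- Minkowski sums.
    opaque
      intervalElement : ℕ → ℕ → M𝒟.Carrier
      intervalElement a k = [ interval a k ] , proj₂ basic (basic-interval a k)

      intervalElement-[] : ∀ a k → proj₁ (intervalElement a k) ≡ [ interval a k ]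
      intervalElement-[] a k = ≡.refl

      intervalElement-* : ∀ {a₁ k₁ a₂ k₂ a k} → a ≡ a₁ ℕ.+ a₂ → k ≡ k₁ ℕ.+ k₂ →
        intervalElement a k M𝒟.≈ intervalElement a₁ k₁ M𝒟.* intervalElement a₂ k₂
      intervalElement-* {a₁} {k₁} {a₂} {k₂} ≡.refl ≡.refl = [cell]-* (λ _ → a₁) (λ _ → k₁) (λ _ → a₂) (λ _ → k₂)

      intervalElement-0 : ∀ {a k} → a ≡ 0 → k ≡ 0 → intervalElement a k M𝒟.≈ M𝒟.1#
      intervalElement-0 ≡.refl ≡.refl = []-cong (interval 0 0) (singleton origin) cell-origin

      intervalElement-cong : ∀ {a a′ k k′} → a ≡ a′ → k ≡ k′ → intervalElement a k M𝒟.≈ intervalElement a′ k′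
      intervalElement-cong {a} {k = k} ≡.refl ≡.refl = M𝒟.refl {intervalElement a k}

      intervalElement-split : intervalElement 0 2 M𝒟.+ intervalElement 1 0 M𝒟.≈ intervalElement 0 1 M𝒟.+ intervalElement 1 1
      intervalElement-split = interval-split

      intervalElement-value : ∀ a k w → LinearFunctional.⟨_⟩ (pointValue 𝒟 w) (intervalElement a k) ℂ.≈ χ (interval a k) w
      intervalElement-value a k w = pointValue-[] (interval a k) w

    intervals : Vec ℕ (d ℕ.+ d) → PureTensor
    intervals m i = intervalElement (X m i) (Y m i)

    pureIntervals : Vec ℕ (d ℕ.+ d) → T.Carrier
    pureIntervals m = (ℂ.1# , intervals m) ∷ []

    pureIntervals-one : pureIntervals one T.≈ T.1#
    pureIntervals-one = pure-cong ℂ.refl λ i → intervalElement-0 (lookup-one (i Fin.↑ˡ d)) (lookup-one (d Fin.↑ʳ i))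

    pureIntervals-∙ : ∀ m m′ → pureIntervals (m ∙ m′) T.≈ pureIntervals m T.* pureIntervals m′
    pureIntervals-∙ m m′ = pure-cong (ℂ.sym (ℂ.*-identityˡ ℂ.1#)) λ i →
      intervalElement-* {X m i} {Y m i} {X m′ i} {Y m′ i} (lookup-∙ (i Fin.↑ˡ d) m m′) (lookup-∙ (d Fin.↑ʳ i) m m′)

  opaque
    ψ : AlgebraHom (BoxPolynomials R d) (⨂ {d = d} (λ _ → MRing R 𝒟))
    ψ = lift pureIntervals pureIntervals-one pureIntervals-∙

    private
      ψ-monomial : ∀ m → AlgebraHom.⟦_⟧ ψ ((ℂ.1# , m) ∷ []) T.≈ pureIntervals m
      ψ-monomial = lift-monomial pureIntervals pureIntervals-one pureIntervals-∙

      ψ-functional : (F : LinearFunctional (⨂ {d = d} (λ _ → MRing R 𝒟))) → let open LinearFunctional F in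
        ∀ p → ⟨ AlgebraHom.⟦_⟧ ψ p ⟩ ℂ.≈ Evaluation.evaluate (ℂ R) (λ m → ⟨ pureIntervals m ⟩) p
      ψ-functional = linear-functional pureIntervals

  private
    module ψ = Hom ψ
    module ι i = Hom {A = MRing R 𝒟} {B = ⨂ {d = d} (λ _ → MRing R 𝒟)} (inclusion i)

    -- Every side but the `i`-th is {0}, the unit of its factor.
    ψ-unit : ∀ i m a k → X m i ≡ a → Y m i ≡ k → (∀ {j} → j ≢ i → X m j ≡ 0 × Y m j ≡ 0) →
             ψ.⟦ (ℂ.1# , m) ∷ [] ⟧ T.≈ ι.⟦_⟧ i (intervalElement a k)
    ψ-unit i m a k X≡ Y≡ off = T.trans (ψ-monomial m)
      (T.sym (inclusion-unique {i} {intervalElement a k} (intervals m)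
        (intervalElement-cong X≡ Y≡) (λ j j≢i → let X≡0 , Y≡0 = off j≢i in intervalElement-0 X≡0 Y≡0)))

    ψ-x : ∀ i → ψ.⟦ x i ⟧ T.≈ ι.⟦_⟧ i (intervalElement 1 0)
    ψ-x i = ψ-unit i (unit (i Fin.↑ˡ d)) 1 0 (X-unit-x i) (Y-unit-x i i) λ {j} j≢i → X-unit-x-≢ j≢i , Y-unit-x i j

    ψ-y : ∀ i → ψ.⟦ y i ⟧ T.≈ ι.⟦_⟧ i (intervalElement 0 1)
    ψ-y i = ψ-unit i (unit (d Fin.↑ʳ i)) 0 1 (X-unit-y i i) (Y-unit-y i) λ {j} j≢i → X-unit-y i j , Y-unit-y-≢ j≢i

    1D-relation : (intervalElement 0 1 M𝒟.- M𝒟.1#) M𝒟.* (intervalElement 0 1 M𝒟.- intervalElement 1 0) M𝒟.≈ M𝒟.0#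
    1D-relation = M𝒟.trans {(y₁ M𝒟.- M𝒟.1#) M𝒟.* (y₁ M𝒟.- x₁)} {(y₁ M𝒟.* y₁ M𝒟.+ x₁) M𝒟.- (y₁ M𝒟.+ x₁ M𝒟.* y₁)} {M𝒟.0#}
      (relation-expanded M𝒟.commutativeRing x₁ y₁)
      (RingProperties.x≈y⇒x∙y⁻¹≈ε M𝒟.ring {y₁ M𝒟.* y₁ M𝒟.+ x₁} {y₁ M𝒟.+ x₁ M𝒟.* y₁}
        (M𝒟.trans {y₁ M𝒟.* y₁ M𝒟.+ x₁} {intervalElement 0 2 M𝒟.+ x₁} {y₁ M𝒟.+ x₁ M𝒟.* y₁}
          (M𝒟.+-congʳ {x₁} {y₁ M𝒟.* y₁} {intervalElement 0 2}
            (M𝒟.sym {intervalElement 0 2} {y₁ M𝒟.* y₁} (intervalElement-* {0} {1} {0} {1} ≡.refl ≡.refl)))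
          (M𝒟.trans {intervalElement 0 2 M𝒟.+ x₁} {y₁ M𝒟.+ intervalElement 1 1} {y₁ M𝒟.+ x₁ M𝒟.* y₁}
            intervalElement-split
            (M𝒟.+-congˡ {y₁} {intervalElement 1 1} {x₁ M𝒟.* y₁} (intervalElement-* {1} {0} {0} {1} ≡.refl ≡.refl)))))
      where
      x₁ = intervalElement 1 0
      y₁ = intervalElement 0 1

  -- Both xᵢ and yᵢ land in the `i`-th factor, and its inclusion is a homomorphism, so the relation
  -- is the image of the one-dimensional one.
  relation-vanishes : ∀ i → ψ.Kernel (boxRelation R d i)
  relation-vanishes i = T.trans (ψ.relation-homo (x i) (y i)) (T.trans
    (T.*-cong (T.+-congʳ (ψ-y i)) (T.+-cong (ψ-y i) (T.-‿cong (ψ-x i)))) (T.trans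
    (T.sym (ι.relation-homo i (intervalElement 1 0) (intervalElement 0 1))) (T.trans
    (ι.cong i 1D-relation) (ι.0#-homo i))))

  private
    proj₁≡⇒≈ : ∀ {f g : M𝒟.Carrier} → proj₁ f ≡ proj₁ g → f M𝒟.≈ g
    proj₁≡⇒≈ ≡.refl _ = ℂ.refl

    -- ψ and the inclusion are homomorphisms, so it is enough to reach {1} and [0,1], by xᵢ and yᵢ.
    -- Equality in the subalgebra ignores generation witnesses; the steps `λ _ → ℂ.refl` exchange
    -- them.
    ι-image : ∀ i {f} (p : Generated (M𝓟Ring R 1) Basic f) → ψ.Image (ι.⟦_⟧ i (f , proj₂ basic p))
    ι-image i (gen point)   = x i , T.trans (ψ-x i) (ι.cong i (proj₁≡⇒≈ {intervalElement 1 0} {[ interval 1 0 ] , proj₂ basic (gen point)} (intervalElement-[] 1 0)))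
    ι-image i (gen segment) = y i , T.trans (ψ-y i) (ι.cong i (proj₁≡⇒≈ {intervalElement 0 1} {[ interval 0 1 ] , proj₂ basic (gen segment)} (intervalElement-[] 0 1)))
    ι-image i (scal k)      = ψ.image-resp (T.trans (T.sym (ι.ι-compatible i k)) (ι.cong i λ _ → ℂ.refl)) (ψ.image-ι k)
    ι-image i (add p q)     = ψ.image-resp (T.trans (T.sym (ι.+-homo i _ _)) (ι.cong i λ _ → ℂ.refl))
                                (ψ.image-+ (ι-image i p) (ι-image i q))
    ι-image i (mul p q)     = ψ.image-resp (T.trans (T.sym (ι.*-homo i _ _)) (ι.cong i λ _ → ℂ.refl))
                                (ψ.image-* (ι-image i p) (ι-image i q))
    ι-image i (resp f≈g p)  = ψ.image-resp (ι.cong i f≈g) (ι-image i p)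

    pure-image : ∀ v → ψ.Image ((ℂ.1# , v) ∷ [])
    pure-image v = pure-∏ ψ.Image ψ.image-resp (P.1# , ψ.1#-homo) ψ.image-* v λ i →
      ψ.image-resp (ι.cong i λ _ → ℂ.refl) (ι-image i (proj₁ basic (proj₂ (v i))))

  ψ-image : ∀ t → ψ.Image t
  ψ-image []            = P.0# , ψ.0#-homo
  ψ-image ((c , v) ∷ t) = ψ.image-+
    (ψ.image-resp {T.ι c T.* ((ℂ.1# , v) ∷ [])} (pure-cong (ℂ.*-identityʳ c) (λ i → M𝒟.*-identityˡ (v i)))
      (ψ.image-* (ψ.image-ι c) (pure-image v)))
    (ψ-image t)

  kernel⊆vanishing : ∀ {p} → ψ.Kernel p → ∀ w → cellSum w p ℂ.≈ ℂ.0#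
  kernel⊆vanishing {p} ψp≈0 w = ℂ.trans
    (ℂ.sym (ℂ.trans (ψ-functional F p) (Evaluation.evaluate-cong (ℂ R) term p)))
    (ℂ.trans (F.⟨⟩-cong ψp≈0) F.⟨⟩-0)
    where
    F = productFunctional (λ i → pointValue 𝒟 (λ _ → w i))
    module F = LinearFunctional F

    term : ∀ m → F.⟨ pureIntervals m ⟩ ℂ.≈ χ (cell (X m) (Y m)) w
    term m = ℂ.trans (productFunctional-pure (λ i → pointValue 𝒟 (λ _ → w i)) (intervals m))
      (ℂ.trans (Products.∏-cong (ℂ R) (λ i → intervalElement-value (X m i) (Y m i) (λ _ → w i)))
               (ℂ.sym (χ-cell (X m) (Y m) w)))

-- Comparison of the kernels and the resulting isomorphisms.

module Kernels (R : CompleteOrderedField) (d : ℕ) where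
  open MinkowskiRing R hiding (M; M𝓟; 𝓑⁺; module BoxPresentation)
  open BoxMap R d
  open PointAndInterval R
  open Separation R d using (cellSum; vanishing⇒ideal)
  private
    module ℂ = CommutativeRing (ℂ R)
    module φ = Hom φ
    module P = Algebra (BoxPolynomials R d)
    module T₁ = TensorMap R d (Boxes R 1) (𝓑⁺-basic ≡.refl)

  -- The detour through a tensor power replaces a decomposition of boxes in dimension `d` by one of
  -- intervals; `Boxes R 1` is merely one admissible family.
  ideal⇒vanishing : ∀ {p} → Ideal (BoxPolynomials R d) (boxRelation R d) p → ∀ w → cellSum w p ℂ.≈ ℂ.0#
  ideal⇒vanishing p∈ = T₁.kernel⊆vanishing (Hom.ideal⊆kernel T₁.ψ (boxRelation R d) T₁.relation-vanishes p∈)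

  kernel-φ : φ.Kernel ≐ Ideal (BoxPolynomials R d) (boxRelation R d)
  kernel-φ =
    (λ {p} φp≈0 → vanishing⇒ideal ideal⇒vanishing p λ w → ℂ.trans (ℂ.sym (φ-value w p)) (φp≈0 w)) ,
    (λ {p} p∈ w → ℂ.trans (φ-value w p) (ideal⇒vanishing p∈ w))

  kernel-ψ : ∀ {ℓ} (𝒟 : Pred (Polyhedron 1) ℓ) (basic : BasicallyGenerated 𝒟) →
             Hom.Kernel (TensorMap.ψ R d 𝒟 basic) ≐ Ideal (BoxPolynomials R d) (boxRelation R d)
  kernel-ψ 𝒟 basic = (λ {p} ψp≈0 → vanishing⇒ideal ideal⇒vanishing p (T.kernel⊆vanishing ψp≈0)) ,
                     Hom.ideal⊆kernel T.ψ (boxRelation R d) T.relation-vanishes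
    where module T = TensorMap R d 𝒟 basic

  M≅ : ∀ {c ℓ} {C : Algebra (ℂ R) c ℓ} (ψ : AlgebraHom (BoxPolynomials R d) C) → (∀ z → Hom.Image ψ z) →
       Hom.Kernel ψ ≐ Ideal (BoxPolynomials R d) (boxRelation R d) → MRing R (Boxes R d) ≅ C
  M≅ ψ image kernel = commonKernel⇒≅ φ ψ (Ideal (BoxPolynomials R d) (boxRelation R d)) φ-image image kernel-φ kernel

  ≈⇒ideal : ∀ {p q} → p P.≈ q → Ideal (BoxPolynomials R d) (boxRelation R d) (p P.- q)
  ≈⇒ideal {p} {q} = Hom.cong (quotientHom (BoxPolynomials R d) (boxRelation R d)) {p} {q}

  ideal-refl : ∀ p → Ideal (BoxPolynomials R d) (boxRelation R d) (p P.- p)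
  ideal-refl p = ≈⇒ideal {p} {p} (P.refl {p})

  M≅⨂ : ∀ {ℓ} {𝓔 : Pred (Polyhedron 1) ℓ} → BasicallyGenerated 𝓔 →
         MRing R (Boxes R d) ≅ ⨂ (λ (_ : Fin d) → MRing R 𝓔)
  M≅⨂ {𝓔 = 𝓔} basic = M≅ T.ψ T.ψ-image (kernel-ψ 𝓔 basic)
    where module T = TensorMap R d 𝓔 basic

  ⨂≅⨂ : ∀ {ℓ₁ ℓ₂} {𝒟 : Pred (Polyhedron 1) ℓ₁} {𝓔 : Pred (Polyhedron 1) ℓ₂} →
         BasicallyGenerated 𝒟 → BasicallyGenerated 𝓔 →
         ⨂ (λ (_ : Fin d) → MRing R 𝒟) ≅ ⨂ (λ (_ : Fin d) → MRing R 𝓔)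
  ⨂≅⨂ {𝒟 = 𝒟} {𝓔} basic basic′ = commonKernel⇒≅ T.ψ T′.ψ (Ideal (BoxPolynomials R d) (boxRelation R d))
    T.ψ-image T′.ψ-image (kernel-ψ 𝒟 basic) (kernel-ψ 𝓔 basic′)
    where
    module T  = TensorMap R d 𝒟 basic
    module T′ = TensorMap R d 𝓔 basic′

corollary3p12 : (R : CompleteOrderedField) (d : ℕ) → 1 ≤ d →
    let open MinkowskiRing R
        open BoxPresentation d
        open Vectors R using (e)
        module R = CompleteOrderedField R
        module 𝓟 = Algebra (M𝓟 d)
        module ℂ[] = Algebra ℂ[x,y]
        module MB = Algebra (M (𝓑⁺ d))
        point-and-interval = finite (singleton (λ _ → R.1#) ∷ box origin (λ _ → R.1#) ∷ [])
    in
    (Σ[ φ ∈ AlgebraHom ℂ[x,y] (M (𝓑⁺ d)) ]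
      let open AlgebraHom φ using (⟦_⟧) in
        (∀ i → proj₁ ⟦ x i ⟧ 𝓟.≈ [ singleton (e i) ])
      × (∀ i → proj₁ ⟦ y i ⟧ 𝓟.≈ [ projectedCube i ])
      × Surjective ℂ[]._≈_ MB._≈_ ⟦_⟧
      × (∀ p → ⟦ p ⟧ MB.≈ MB.0# ⇔ Ideal ℂ[x,y] relation p))
    × (M (𝓑⁺ d) ≅ quotient ℂ[x,y] relation)
    × (M (𝓑⁺ d) ≅ ⨂ (λ (_ : Fin d) → M (𝓑⁺ 1)))
    × ((_∈M 𝓑⁺ 1) ≐ (_∈M point-and-interval))
    × (⨂ (λ (_ : Fin d) → M (𝓑⁺ 1)) ≅ ⨂ (λ (_ : Fin d) → M point-and-interval))
corollary3p12 R d _ =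
    (φ , φ-x , φ-y , Hom.surjective φ φ-image , λ p → mk⇔ (proj₁ kernel-φ {p}) (proj₂ kernel-φ {p}))
  -- The quotient map, with its codomain inferred from the goal: identifying two copies of
  -- the quotient algebra would unfold the ring solver.
  , M≅ (algebraHom (BoxPolynomials R d) _ (λ p → p) (λ {p} {q} → ≈⇒ideal {p} {q})
      (λ p q → ideal-refl (p P.+ q)) (λ p q → ideal-refl (p P.* q)) (λ c → ideal-refl (P.ι c)))
      (λ p → p , ideal-refl p) (proj₁ kernel , proj₂ kernel)
  , M≅⨂ (𝓑⁺-basic ≡.refl)
  , ∈M-≐ (𝓑⁺-basic ≡.refl) (point-and-interval-basic ≡.refl)
  , ⨂≅⨂ (𝓑⁺-basic ≡.refl) (point-and-interval-basic ≡.refl)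
  where
  open BoxMap R d
  open PointAndInterval R
  open Kernels R d
  module P = Algebra (BoxPolynomials R d)
  kernel = quotientHom-kernel (BoxPolynomials R d) (boxRelation R d)
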